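{- Let $G$ be a connected conductance-weighted graph on $n$ vertices and let $x_v>0$ $(v\in V)$ be vertex weights. Then $$K_c(G;x)=\frac1{\tau_c(G)}\Bigg\{m\bigl(S_{c/x}(G),n-2\bigr)\prod_{v\in V}x_v+\sum_{C\in\mathcal C(G)}(-2)^{p(C)}\,c(C)\,m\bigl(S_{c/x}^{C}(G),n-2-|C|\bigr)\prod_{v\notin V(C)}x_v\Bigg\}.$$
   Context: $G=(V,E)$ is a finite connected simple undirected graph; each edge $e$ has a conductance $c_e\in\mathbb R_{>0}$. $\tau_c(G)=\sum_T\prod_{e\in T}c_e$, the sum over spanning trees $T$ of $G$. $r_c(u,v)$ is the effective resistance between $u$ and $v$ in the electrical network with edge conductances $c_e$. The doubly weighted Kirchhoff index is $$K_c(G;x)=\sum_{\{u,v\}\subseteq V}x_ux_v\,r_c(u,v),$$ summed over unordered pairs of distinct vertices. The weighted subdivision graph $S_{c/x}(G)$ has vertex set $V\sqcup\{e^*:e\in E\}$ and, for each $e\in E$ and each endpoint $v$ of $e$, an edge $ve^*$ of weight $c_e/x_v$. For a subgraph $C$ of $G$, $S(C)$ is its subdivision, with vertices $V(C)\cup\{e^*:e\in E(C)\}$, and $S_{c/x}^{C}(G):=S_{c/x}(G)-S(C)$ is obtained by deleting all vertices of $S(C)$ together with their incident edges. For an edge-weighted graph $H$, $m(H,j)$ is the total weight of its $j$-edge matchings, where the weight of a matching is the product of its edge weights ($m(H,0)=1$, and $m(H,j)=0$ for $j<0$). $\mathcal C(G)$ is the set of nonempty vertex-disjoint unions of cycles of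 $G$; for $C\in\mathcal C(G)$, $p(C)$ is its number of cycle components, $c(C)=\prod_{e\in E(C)}c_e$, and $|C|$ is its number of vertices (equal to its number of edges). -}

module Defs where

open import Level using (Level; _⊔_) renaming (suc to lsuc)
open import Algebra.Apartness.Bundles using (HeytingField)
open import Data.Bool.Base using (if_then_else_)
open import Data.Fin.Base using (Fin; zero; suc)
import Data.Fin.Properties as Fin
open import Data.Fin.Subset using (Subset; inside; outside; _∈_; _⊆_; ⊤; ⋃)
open import Data.Fin.Subset.Properties using (_∈?_; _⊆?_; anySubset?)
open import Data.Integer.Base using (ℤ; +_; -[1+_])
open import Data.List.Base
  using (List; []; _∷_; _++_; _∷ʳ_; map; concatMap; cartesianProduct; filter; foldr; length; zip; allFin; lookup)
open import Data.List.Membership.Propositional using () renaming (_∈_ to _∈ˡ_)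
open import Data.List.Membership.Propositional.Properties using (∈-allFin; ∈-lookup)
import Data.List.Membership.DecPropositional as DecMembership
open import Data.List.Relation.Unary.All as All using (All)
open import Data.List.Relation.Unary.AllPairs using (allPairs?; _∷_)
open import Data.List.Relation.Unary.Any as Any using (Any; here; there)
open import Data.List.Relation.Unary.Unique.Propositional using (Unique)
import Data.List.Relation.Unary.Unique.DecPropositional as DecUnique
open import Data.Nat.Base using (ℕ; zero; suc; _≤_; z≤n; s≤s)
import Data.Nat.Properties as ℕ
open import Data.Product.Base using (∃; _×_; _,_; proj₁; proj₂; uncurry)
open import Data.Sum.Base using (_⊎_; inj₁; inj₂)
open import Data.Sum.Properties using () renaming (≡-dec to ⊎-≡-dec)
open import Data.Vec.Base using () renaming ([] to []ᵛ; _∷_ to _∷ᵛ_)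
open import Function.Base using (_∘_)
open import Relation.Binary.Construct.Closure.ReflexiveTransitive using (Star; ε; _◅_; _◅◅_)
open import Relation.Binary.Core using (Rel)
open import Relation.Binary.Definitions using (DecidableEquality)
  renaming (Decidable to Decidable₂)
open import Relation.Binary.PropositionalEquality using (_≡_; refl; sym; cong)
open import Relation.Binary.Structures using (IsStrictPartialOrder)
open import Relation.Nullary using (Dec; yes; no; does; ¬_; ¬?; contradiction; map′; _×-dec_; _⊎-dec_; _→-dec_)
open import Relation.Unary using (Decidable)

-- ℝ is an instance, both classically (with x # y meaning x ≠ y) and
-- constructively; neither decidability of the order nor completeness is assumed.
record OrderedField (a ℓ₁ ℓ₂ ℓ₃ : Level) : Set (lsuc (a ⊔ ℓ₁ ⊔ ℓ₂ ⊔ ℓ₃)) where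
  field
    heytingField : HeytingField a ℓ₁ ℓ₂
  open HeytingField heytingField public
  infix 4 _<_
  field
    _<_                  : Rel Carrier ℓ₃
    isStrictPartialOrder : IsStrictPartialOrder _≈_ _<_
    +-monoʳ-<            : ∀ z {x y} → x < y → z + x < z + y
    *-pos                : ∀ {x y} → 0# < x → 0# < y → 0# < x * y
    <⇒#                  : ∀ {x y} → x < y → x # y
    #⇒<⊎>                : ∀ {x y} → x # y → x < y ⊎ y < x

  inverse : ∀ {x} → x # 0# → Carrier
  inverse x#0 = proj₁ (#⇒invertible x#0)

  pos⇒#0 : ∀ {x} → 0# < x → x # 0#
  pos⇒#0 0<x = #-sym (<⇒# 0<x)

subsets : ∀ m → List (Subset m)
subsets zero    = []ᵛ ∷ []
subsets (suc m) = map (outside ∷ᵛ_) (subsets m) ++ map (inside ∷ᵛ_) (subsets m)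

-- All ways of selecting some of the entries of a list, preserving their order.
sublists : ∀ {a} {A : Set a} → List A → List (List A)
sublists []       = [] ∷ []
sublists (x ∷ xs) = sublists xs ++ map (x ∷_) (sublists xs)

-- The choice of which end of an edge is src and which is tgt carries no meaning.
record Graph (n m : ℕ) : Set where
  field
    src tgt : Fin m → Fin n

  Joins : Fin m → Fin n → Fin n → Set
  Joins e u v = (src e ≡ u × tgt e ≡ v) ⊎ (src e ≡ v × tgt e ≡ u)

  field
    loopless : ∀ e → ¬ src e ≡ tgt e
    simple   : ∀ {e f} → Joins e (src f) (tgt f) → e ≡ f

  _∈ₑ_ : Fin n → Fin m → Set
  v ∈ₑ e = src e ≡ v ⊎ tgt e ≡ v

  joins? : ∀ e u v → Dec (Joins e u v)
  joins? e u v = ((src e Fin.≟ u) ×-dec (tgt e Fin.≟ v))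
           ⊎-dec ((src e Fin.≟ v) ×-dec (tgt e Fin.≟ u))

  _∈ₑ?_ : ∀ v e → Dec (v ∈ₑ e)
  v ∈ₑ? e = (src e Fin.≟ v) ⊎-dec (tgt e Fin.≟ v)

  Adjacent : Subset m → Fin n → Fin n → Set
  Adjacent D u v = ∃ λ e → e ∈ D × Joins e u v

  adjacent? : ∀ D u v → Dec (Adjacent D u v)
  adjacent? D u v = Fin.any? λ e → (e ∈? D) ×-dec joins? e u v

  Covers : Subset m → Fin n → Set
  Covers D v = ∃ λ e → e ∈ D × v ∈ₑ e

  covers? : ∀ D v → Dec (Covers D v)
  covers? D v = Fin.any? λ e → (e ∈? D) ×-dec (v ∈ₑ? e)

-- Reachability is decided by restricting the inner vertices of a walk to a
-- list, which is then shrunk one vertex at a time.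
module _ {n : ℕ} {R : Fin n → Fin n → Set} (R? : Decidable₂ R) where

  private
    Via : List (Fin n) → Fin n → Fin n → Set
    Via []       u v = u ≡ v ⊎ R u v
    Via (k ∷ ks) u v = Via ks u v ⊎ (Via ks u k × Via ks k v)

    via? : ∀ ks → Decidable₂ (Via ks)
    via? []       u v = (u Fin.≟ v) ⊎-dec R? u v
    via? (k ∷ ks) u v = via? ks u v ⊎-dec (via? ks u k ×-dec via? ks k v)

    via-base : ∀ ks {u v} → u ≡ v ⊎ R u v → Via ks u v
    via-base []       p = p
    via-base (_ ∷ ks) p = inj₁ (via-base ks p)

    via⇒star : ∀ ks {u v} → Via ks u v → Star R u v
    via⇒star []       (inj₁ refl)    = ε
    via⇒star []       (inj₂ r)       = r ◅ ε
    via⇒star (_ ∷ ks) (inj₁ p)       = via⇒star ks p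
    via⇒star (_ ∷ ks) (inj₂ (p , q)) = via⇒star ks p ◅◅ via⇒star ks q

    via-trans : ∀ {ks k u v} → k ∈ˡ ks → Via ks u k → Via ks k v → Via ks u v
    via-trans {k ∷ ks} (here refl) p q = inj₂ (into p , out q)
      where
      into : ∀ {u} → Via (k ∷ ks) u k → Via ks u k
      into (inj₁ p)       = p
      into (inj₂ (p , _)) = p
      out : ∀ {v} → Via (k ∷ ks) k v → Via ks k v
      out (inj₁ q)       = q
      out (inj₂ (_ , q)) = q
    via-trans (there k∈) (inj₁ p)       (inj₁ q)       = inj₁ (via-trans k∈ p q)
    via-trans (there k∈) (inj₁ p)       (inj₂ (q , s)) = inj₂ (via-trans k∈ p q , s)
    via-trans (there k∈) (inj₂ (p , s)) (inj₁ q)       = inj₂ (p , via-trans k∈ s q)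
    via-trans (there _)  (inj₂ (p , _)) (inj₂ (_ , q)) = inj₂ (p , q)

    star⇒via : ∀ {u v} → Star R u v → Via (allFin n) u v
    star⇒via ε        = via-base (allFin n) (inj₁ refl)
    star⇒via (r ◅ rs) =
      via-trans (∈-allFin _) (via-base (allFin n) (inj₂ r)) (star⇒via rs)

  star? : Decidable₂ (Star R)
  star? u v = map′ (via⇒star (allFin n)) star⇒via (via? (allFin n) u v)

private
  boundedList? : ∀ {n} {P : List (Fin n) → Set} → Decidable P →
                 ∀ k → Dec (∃ λ vs → length vs ≤ k × P vs)
  boundedList? P? k with P? []
  ... | yes p = yes ([] , z≤n , p)
  boundedList? P? zero    | no ¬p = no λ { ([] , _ , p) → ¬p p }
  boundedList? P? (suc k) | no ¬p =
    map′ (λ { (v , vs , le , p) → v ∷ vs , s≤s le , p })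
         (λ { ([] , _ , p)            → contradiction p ¬p
            ; (v ∷ vs , s≤s le , p) → v , vs , le , p })
         (Fin.any? λ v → boundedList? (P? ∘ (v ∷_)) k)

  lookup-injective : ∀ {A : Set} {xs : List A} → Unique xs →
                     ∀ i j → lookup xs i ≡ lookup xs j → i ≡ j
  lookup-injective (_ ∷ _)    zero    zero    _  = refl
  lookup-injective (x∉ ∷ _)   zero    (suc j) eq = contradiction eq (All.lookup x∉ (∈-lookup j))
  lookup-injective (x∉ ∷ _)   (suc i) zero    eq = contradiction (sym eq) (All.lookup x∉ (∈-lookup i))
  lookup-injective (_ ∷ xs!)  (suc i) (suc j) eq = cong suc (lookup-injective xs! i j eq)

  unique⇒length≤ : ∀ {n} {vs : List (Fin n)} → Unique vs → length vs ≤ n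
  unique⇒length≤ {vs = vs} vs! =
    Fin.injective⇒≤ {f = lookup vs} (λ {i} {j} → lookup-injective vs! i j)

-- (v₁,v₂), (v₂,v₃), …, (vₖ,v₁)
cyclicPairs : ∀ {a} {A : Set a} → List A → List (A × A)
cyclicPairs []       = []
cyclicPairs (v ∷ vs) = zip (v ∷ vs) (vs ∷ʳ v)

-- Spanning subgraphs and subgraphs without isolated vertices, in particular
-- cycles, are given by their edge sets.
module _ {n m : ℕ} (G : Graph n m) where
  open Graph G

  SpanningConnected : Subset m → Set
  SpanningConnected D = 1 ≤ n × (∀ u v → Star (Adjacent D) u v)

  Connected : Set
  Connected = SpanningConnected ⊤

  Traverses : List (Fin n) → Subset m → Set
  Traverses vs D = 3 ≤ length vs
                 × Unique vs
                 × All (uncurry (Adjacent D)) (cyclicPairs vs)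
                 × (∀ e → e ∈ D → Any (uncurry (Joins e)) (cyclicPairs vs))

  IsCycle : Subset m → Set
  IsCycle D = ∃ λ vs → Traverses vs D

  Acyclic : Subset m → Set
  Acyclic T = ∀ D → IsCycle D → ¬ D ⊆ T

  IsSpanningTree : Subset m → Set
  IsSpanningTree T = SpanningConnected T × Acyclic T

  VertexDisjoint : Subset m → Subset m → Set
  VertexDisjoint C D = ∀ v → ¬ (Covers C v × Covers D v)

  traverses? : ∀ D → Decidable (λ vs → Traverses vs D)
  traverses? D vs =
    (3 ℕ.≤? length vs)
    ×-dec DecUnique.unique? Fin._≟_ vs
    ×-dec All.all? (λ (u , v) → adjacent? D u v) (cyclicPairs vs)
    ×-dec Fin.all? (λ e → (e ∈? D) →-dec
                          Any.any? (λ (u , v) → joins? e u v) (cyclicPairs vs))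

  isCycle? : Decidable IsCycle
  isCycle? D = map′ (λ (vs , _ , t) → vs , t)
                    (λ (vs , t) → vs , unique⇒length≤ (proj₁ (proj₂ t)) , t)
                    (boundedList? (traverses? D) n)

  acyclic? : Decidable Acyclic
  acyclic? T = map′ (λ ¬∃ D cyc D⊆T → ¬∃ (D , cyc , λ {e} → D⊆T {e}))
                    (λ ac (D , cyc , D⊆T) → ac D cyc D⊆T)
                    (¬? (anySubset? λ D → isCycle? D ×-dec (D ⊆? T)))

  isSpanningTree? : Decidable IsSpanningTree
  isSpanningTree? T = ((1 ℕ.≤? n)
    ×-dec Fin.all? λ u → Fin.all? λ v → star? (adjacent? T) u v)
    ×-dec acyclic? T

  vertexDisjoint? : Decidable₂ VertexDisjoint
  vertexDisjoint? C D = Fin.all? λ v → ¬? (covers? C v ×-dec covers? D v)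

  spanningTrees : List (Subset m)
  spanningTrees = filter isSpanningTree? (subsets m)

  cycles : List (Subset m)
  cycles = filter isCycle? (subsets m)

  -- A vertex-disjoint union of cycles is represented by the list of its cycles
  -- (in the order of `cycles`), which it determines: they are its components.
  cycleUnions : List (List (Subset m))
  cycleUnions = filter (λ Cs → (1 ℕ.≤? length Cs) ×-dec allPairs? vertexDisjoint? Cs)
                       (sublists cycles)

module CycleUnion {n m : ℕ} (G : Graph n m) (Cs : List (Subset m)) where
  open Graph G

  components : ℕ
  components = length Cs

  edgeList : List (Fin m)
  edgeList = filter (_∈? ⋃ Cs) (allFin m)

  vertexList : List (Fin n)
  vertexList = filter (covers? (⋃ Cs)) (allFin n)

  outsideVertexList : List (Fin n)
  outsideVertexList = filter (¬? ∘ covers? (⋃ Cs)) (allFin n)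

  size : ℕ
  size = length vertexList

  subdivisionVertices : List (Fin n ⊎ Fin m)
  subdivisionVertices = map inj₁ vertexList ++ map inj₂ edgeList

module Weighted {a ℓ₁ ℓ₂ ℓ₃} (F : OrderedField a ℓ₁ ℓ₂ ℓ₃) where
  open OrderedField F

  ∑ ∏ : ∀ {b} {A : Set b} → List A → (A → Carrier) → Carrier
  ∑ xs f = foldr (λ y s → f y + s) 0# xs
  ∏ xs f = foldr (λ y p → f y * p) 1# xs

  infixr 8 _^_
  _^_ : Carrier → ℕ → Carrier
  x ^ zero  = 1#
  x ^ suc k = x * x ^ k

  record WeightedEdge (V : Set) : Set a where
    constructor edge
    field
      end₁ end₂ : V
      weight    : Carrier
  open WeightedEdge

  -- Every edge is listed exactly once.
  record WeightedGraph (V : Set) : Set a where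
    field
      vertices : List V
      edges    : List (WeightedEdge V)
  open WeightedGraph

  module _ {V : Set} (_≟_ : DecidableEquality V) where
    open DecMembership _≟_ using (_∉?_)

    deleteVertices : WeightedGraph V → List V → WeightedGraph V
    deleteVertices H W = record
      { vertices = filter (_∉? W) (vertices H)
      ; edges    = filter (λ e → (end₁ e ∉? W) ×-dec (end₂ e ∉? W)) (edges H)
      }

    NoCommonEnd : WeightedEdge V → WeightedEdge V → Set
    NoCommonEnd e f = (¬ end₁ e ≡ end₁ f) × (¬ end₁ e ≡ end₂ f)
                    × (¬ end₂ e ≡ end₁ f) × (¬ end₂ e ≡ end₂ f)

    noCommonEnd? : Decidable₂ NoCommonEnd
    noCommonEnd? e f = ¬? (end₁ e ≟ end₁ f) ×-dec ¬? (end₁ e ≟ end₂ f)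
                 ×-dec ¬? (end₂ e ≟ end₁ f) ×-dec ¬? (end₂ e ≟ end₂ f)

    matchings : WeightedGraph V → ℕ → List (List (WeightedEdge V))
    matchings H j = filter (λ M → (length M ℕ.≟ j) ×-dec allPairs? noCommonEnd? M)
                           (sublists (edges H))

    matchingWeight : WeightedGraph V → ℤ → Carrier
    matchingWeight H (+ j)    = ∑ (matchings H j) λ M → ∏ M weight
    matchingWeight H -[1+ _ ] = 0#

  δ : ∀ {n} → Fin n → Fin n → Carrier
  δ u v = if does (u Fin.≟ v) then 1# else 0#

  module _ {n m : ℕ} (G : Graph n m) where
    open Graph G

    treeWeight : (Fin m → Carrier) → Carrier
    treeWeight c = ∑ (spanningTrees G) λ T → ∏ (filter (_∈? T) (allFin m)) c

    -- Ohm's law: the current through e, counted positive from src e to tgt e.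
    current : (c : Fin m → Carrier) (φ : Fin n → Carrier) → Fin m → Carrier
    current c φ e = c e * (φ (src e) - φ (tgt e))

    netOutflow : (c : Fin m → Carrier) (φ : Fin n → Carrier) → Fin n → Carrier
    netOutflow c φ w = ∑ (filter (λ e → src e Fin.≟ w) (allFin m)) (current c φ)
                     - ∑ (filter (λ e → tgt e Fin.≟ w) (allFin m)) (current c φ)

    -- ρ is the potential difference between u and v when a unit current enters
    -- the network at u, leaves it at v, and is conserved at all other vertices.
    IsEffectiveResistance : (c : Fin m → Carrier) → Fin n → Fin n → Carrier → Set (a ⊔ ℓ₁)
    IsEffectiveResistance c u v ρ = ∃ λ (φ : Fin n → Carrier) →
      (∀ w → netOutflow c φ w ≈ δ u w - δ v w) × ρ ≈ φ u - φ v

    subdivision : (c : Fin m → Carrier) (x : Fin n → Carrier) → (∀ v → 0# < x v) →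
                  WeightedGraph (Fin n ⊎ Fin m)
    subdivision c x x>0 = record
      { vertices = map inj₁ (allFin n) ++ map inj₂ (allFin m)
      ; edges    = concatMap (λ e → halfEdge e (src e) ∷ halfEdge e (tgt e) ∷ []) (allFin m)
      }
      where
      halfEdge : Fin m → Fin n → WeightedEdge (Fin n ⊎ Fin m)
      halfEdge e v = edge (inj₁ v) (inj₂ e) (c e * inverse (pos⇒#0 (x>0 v)))

  kirchhoffIndex : ∀ {n} → (r : Fin n → Fin n → Carrier) (x : Fin n → Carrier) → Carrier
  kirchhoffIndex {n} r x =
    ∑ (filter (λ (u , v) → u Fin.<? v) (cartesianProduct (allFin n) (allFin n)))
      λ (u , v) → x u * x v * r u v

  m[_,_] : ∀ {n m} → WeightedGraph (Fin n ⊎ Fin m) → ℤ → Carrier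
  m[ H , j ] = matchingWeight (⊎-≡-dec Fin._≟_ Fin._≟_) H j

  _∖_ : ∀ {n m} → WeightedGraph (Fin n ⊎ Fin m) → List (Fin n ⊎ Fin m) →
        WeightedGraph (Fin n ⊎ Fin m)
  H ∖ W = deleteVertices (⊎-≡-dec Fin._≟_ Fin._≟_) H W

{-# OPTIONS --safe #-}

-- Let every vertex either own an incident edge, leading to its parent, or be a root. A matching of the
-- subdivision graph is such a parent map in which no edge is owned twice. It is a rooted forest unless it
-- runs around some cycles, each in one of two senses, so inclusion–exclusion over these cycles turns the
-- braces into the sum over forests with two roots u, v of their weight F_uv times x_u x_v.
-- The weight of the forests rooted at u, v in which w hangs below u is, as a function of w, a potential
-- driving the current τ from u to v, with values F_uv at u and 0 at v; by reciprocity τ r(u,v) = F_uv.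
-- Here τ is the weight of the forests with a single root, which are the spanning trees.

module Submission where

open import Algebra.Apartness.Bundles using (HeytingField; HeytingCommutativeRing)
open import Algebra.Bundles using (CommutativeRing; CommutativeSemiring)
import Algebra.Properties.CommutativeSemigroup as CommutativeSemigroupProperties
import Algebra.Properties.Ring as RingProperties
import Algebra.Solver.Ring.NaturalCoefficients.Default as SemiringSolver
open import Data.Bool.Base using (if_then_else_; Bool; true)
import Data.Bool.Properties as Bool
open import Data.Empty using (⊥; ⊥-elim)
open import Data.Fin.Base using (Fin; zero; suc)
import Data.Fin.Base as Fin
import Data.Fin.Properties as Fin
open import Data.Fin.Subset using (Subset; inside; outside; _∈_; _⊆_; ⊤; ⋃)
open import Data.Fin.Subset.Properties using (_∈?_; ⊆-antisym; ⊆-reflexive; x∈p∪q⁻; x∈p∪q⁺; ∉⊥)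
open import Data.Integer.Base using (ℤ; +_; _⊖_) renaming (_-_ to _-ℤ_)
import Data.Integer.Base as ℤ
import Data.Integer.Properties as ℤ
open import Data.List.Base using (List; []; _∷_; _++_; map; concatMap; cartesianProduct; filter; allFin; tabulate; length; _∷ʳ_; zip)
import Data.List.Base as List
import Data.List.Membership.DecPropositional as DecMembership
open import Data.List.Membership.Propositional using () renaming (_∈_ to _∈ˡ_; _∉_ to _∉ˡ_)
open import Data.List.Membership.Propositional.Properties using (∈-map⁺; ∈-map⁻; ∈-++⁺ˡ; ∈-++⁺ʳ; ∈-++⁻; ∈-lookup; ∈-filter⁺; ∈-filter⁻; ∈-allFin)
open import Data.List.Properties using (map-tabulate; map-∘; length-map; map-++; map-concatMap)
open import Data.List.Relation.Binary.Permutation.Propositional using (_↭_; ↭-sym; ↭⇒↭ₛ)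
import Data.List.Relation.Binary.Permutation.Propositional.Properties as Perm
import Data.List.Relation.Binary.Permutation.Setoid.Properties as PermSetoid
open import Data.List.Relation.Unary.All as All using (All; []; _∷_)
import Data.List.Relation.Unary.All.Properties as All
open import Data.List.Relation.Unary.AllPairs as AllPairs using (AllPairs; []; _∷_; allPairs?)
import Data.List.Relation.Unary.AllPairs.Properties as AllPairs
open import Data.List.Relation.Unary.Any as Any using (here; there; Any)
import Data.List.Relation.Unary.Any.Properties as Any
import Data.List.Relation.Unary.Unique.DecPropositional as DecUnique
open import Data.List.Relation.Unary.Unique.Propositional using (Unique)
import Data.List.Relation.Unary.Unique.Propositional.Properties as Unique
open import Data.Maybe.Base using (Maybe; just; nothing)
import Data.Maybe.Properties as Maybe
open import Data.Nat.Base using (ℕ; zero; suc; _≤_; z≤n; s≤s)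
import Data.Nat.Base as ℕ
import Data.Nat.Properties as ℕ
open import Data.Product.Base using (∃; _×_; _,_; proj₁; proj₂; uncurry; ∃₂; swap; Σ-syntax)
import Data.Product.Properties as Product
open import Data.Sum.Base using (_⊎_; inj₁; inj₂)
open import Data.Sum.Properties using () renaming (≡-dec to ⊎-≡-dec)
open import Data.Unit.Base using (tt) renaming (⊤ to Unit)
open import Data.Vec.Base using (Vec; []; _∷_; lookup; _[_]≔_)
import Data.Vec.Base as Vec
open import Data.Vec.Functional using (updateAt)
open import Data.Vec.Functional.Properties using (updateAt-updates; updateAt-minimal)
import Data.Vec.Properties as Vec
open import Defs
open import Function.Base using (_∘_; id; const)
open import Level using (Level)
open import Relation.Binary.Construct.Closure.ReflexiveTransitive using (Star; ε; _◅_; _◅◅_)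
import Relation.Binary.Construct.Closure.ReflexiveTransitive as Star
open import Relation.Binary.Definitions using (DecidableEquality; tri<; tri≈; tri>)
open import Relation.Binary.PropositionalEquality as ≡ using (_≡_; _≢_; refl; sym; trans; cong; subst)
import Relation.Binary.Reasoning.Setoid as SetoidReasoning
open import Relation.Binary.Structures using (IsStrictPartialOrder)
open import Relation.Nullary using (Dec; yes; no; does; ¬_; ¬?; contradiction; _×-dec_; _⊎-dec_; map′; _→-dec_)
open import Relation.Unary using (Decidable)

-- Finite sums and products

-- A condition on a parent map that concerns one vertex at a time (being a root, owning an incident
-- edge) is put into the weight of `𝔼`, a product over the vertices; a global one (being a forest,
-- owning no edge twice) stays in the summand. The product form is what allows a vertex, or all
-- vertices of a cycle, to be cut out of a sum, and the vertex weights `x` to be distributed over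
-- the vertices. The obstacle is that matchings do not see cycles, while resistances are sums over
-- forests. Subsets of the cycles around which a map runs repair this, and only vertex-disjoint ones
-- occur: two different cycles with a common vertex would require some vertex to own two edges, or
-- an edge to have two owners. Cutting out such a union C leaves its |C| vertices as roots without
-- weight. Hence two roots become |C| + 2, the remaining matchings have n - 2 - |C| edges, and the
-- product of the `x v` extends over the vertices off C only.

module Sums {a ℓ₁ ℓ₂ ℓ₃ : Level} (F : OrderedField a ℓ₁ ℓ₂ ℓ₃) where
  open OrderedField F public renaming (refl to ≈-refl; sym to ≈-sym; trans to ≈-trans) hiding (zero)
  open Weighted F public

  ring : CommutativeRing a ℓ₁
  ring = HeytingCommutativeRing.commutativeRing (HeytingField.heytingCommutativeRing heytingField)

  semiring : CommutativeSemiring a ℓ₁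
  semiring = CommutativeRing.commutativeSemiring ring

  open SetoidReasoning setoid public
  open RingProperties (CommutativeRing.ring ring) public
    using (-‿distribˡ-*; -‿distribʳ-*; -‿+-comm; -‿involutive; -0#≈0#)
  open CommutativeSemigroupProperties (CommutativeRing.*-commutativeSemigroup ring) public
    using (x∙yz≈y∙xz)
  module Solver = SemiringSolver semiring
  open Solver public using (solve; _:+_; _:*_; _:=_)

  -- Iverson's bracket. Written with `does`, it is the same term as `δ` of the statement when the
  -- proposition is an equality of vertices.
  ⟦_⟧ : ∀ {p} {P : Set p} → Dec P → Carrier
  ⟦ P? ⟧ = if does P? then 1# else 0#

  module _ {p} {P : Set p} where

    ⟦⟧-yes : (P? : Dec P) → P → ⟦ P? ⟧ ≈ 1#
    ⟦⟧-yes (yes _) _ = ≈-refl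
    ⟦⟧-yes (no ¬p) p = contradiction p ¬p

    ⟦⟧-no : (P? : Dec P) → ¬ P → ⟦ P? ⟧ ≈ 0#
    ⟦⟧-no (yes p) ¬p = contradiction p ¬p
    ⟦⟧-no (no _)  _  = ≈-refl

    -- Where the bracket vanishes there is nothing to show. So a property of a parent map may be
    -- assumed while the factor beside its indicator is rewritten.
    ⟦⟧-guard : (P? : Dec P) {x y : Carrier} → (P → x ≈ y) → ⟦ P? ⟧ * x ≈ ⟦ P? ⟧ * y
    ⟦⟧-guard (yes p) eq = *-congˡ (eq p)
    ⟦⟧-guard (no _)  eq = ≈-trans (zeroˡ _) (≈-sym (zeroˡ _))

    ⟦⟧-¬ : (P? : Dec P) → ⟦ ¬? P? ⟧ + ⟦ P? ⟧ ≈ 1#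
    ⟦⟧-¬ (yes _) = +-identityˡ 1#
    ⟦⟧-¬ (no _)  = +-identityʳ 1#

  module _ {p q} {P : Set p} {Q : Set q} where

    ⟦⟧-cong : (P? : Dec P) (Q? : Dec Q) → (P → Q) → (Q → P) → ⟦ P? ⟧ ≈ ⟦ Q? ⟧
    ⟦⟧-cong (yes p) Q? f g = ≈-sym (⟦⟧-yes Q? (f p))
    ⟦⟧-cong (no ¬p) Q? f g = ≈-sym (⟦⟧-no Q? (¬p ∘ g))

    ⟦⟧-× : (P? : Dec P) (Q? : Dec Q) → ⟦ P? ×-dec Q? ⟧ ≈ ⟦ P? ⟧ * ⟦ Q? ⟧
    ⟦⟧-× (yes _) (yes _) = ≈-sym (*-identityˡ 1#)
    ⟦⟧-× (yes _) (no _)  = ≈-sym (*-identityˡ 0#)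
    ⟦⟧-× (no _)  _       = ≈-sym (zeroˡ _)

    ⟦⟧-⊎ : (P? : Dec P) (Q? : Dec Q) → ¬ (P × Q) → ⟦ P? ⊎-dec Q? ⟧ ≈ ⟦ P? ⟧ + ⟦ Q? ⟧
    ⟦⟧-⊎ (yes p) (yes q) ¬pq = contradiction (p , q) ¬pq
    ⟦⟧-⊎ (yes p) (no _)  _   = ≈-sym (+-identityʳ 1#)
    ⟦⟧-⊎ (no _)  (yes _) _   = ≈-sym (+-identityˡ 1#)
    ⟦⟧-⊎ (no _)  (no _)  _   = ≈-sym (+-identityˡ 0#)

  module _ {b} {A : Set b} where

    ∑-cong-∈ : (xs : List A) {f g : A → Carrier} → (∀ {y} → y ∈ˡ xs → f y ≈ g y) → ∑ xs f ≈ ∑ xs g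
    ∑-cong-∈ []       eq = ≈-refl
    ∑-cong-∈ (x ∷ xs) eq = +-cong (eq (here refl)) (∑-cong-∈ xs (eq ∘ there))

    ∑-cong : (xs : List A) {f g : A → Carrier} → (∀ y → f y ≈ g y) → ∑ xs f ≈ ∑ xs g
    ∑-cong xs eq = ∑-cong-∈ xs (λ {y} _ → eq y)

    ∑-zero : (xs : List A) → ∑ xs (λ _ → 0#) ≈ 0#
    ∑-zero []       = ≈-refl
    ∑-zero (x ∷ xs) = ≈-trans (+-identityˡ _) (∑-zero xs)

    ∑-vanish : (xs : List A) (f : A → Carrier) → ∑ xs (λ y → 0# * f y) ≈ 0#
    ∑-vanish xs f = ≈-trans (∑-cong xs (λ y → zeroˡ (f y))) (∑-zero xs)

    ∑-+ : (xs : List A) (f g : A → Carrier) → ∑ xs (λ y → f y + g y) ≈ ∑ xs f + ∑ xs g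
    ∑-+ []       f g = ≈-sym (+-identityˡ 0#)
    ∑-+ (x ∷ xs) f g = begin
      (f x + g x) + ∑ xs (λ y → f y + g y)  ≈⟨ +-congˡ (∑-+ xs f g) ⟩
      (f x + g x) + (∑ xs f + ∑ xs g)
        ≈⟨ solve 4 (λ p q r s → (p :+ q) :+ (r :+ s) := (p :+ r) :+ (q :+ s)) ≈-refl _ _ _ _ ⟩
      (f x + ∑ xs f) + (g x + ∑ xs g)       ∎

    ∑-*ˡ : (k : Carrier) (xs : List A) (f : A → Carrier) → ∑ xs (λ y → k * f y) ≈ k * ∑ xs f
    ∑-*ˡ k []       f = ≈-sym (zeroʳ k)
    ∑-*ˡ k (x ∷ xs) f = ≈-trans (+-congˡ (∑-*ˡ k xs f)) (≈-sym (distribˡ k _ _))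

    ∑-*ʳ : (k : Carrier) (xs : List A) (f : A → Carrier) → ∑ xs (λ y → f y * k) ≈ ∑ xs f * k
    ∑-*ʳ k xs f = ≈-trans (∑-cong xs (λ y → *-comm (f y) k)) (≈-trans (∑-*ˡ k xs f) (*-comm k _))

    ∑-neg : (xs : List A) (f : A → Carrier) → ∑ xs (λ y → - f y) ≈ - ∑ xs f
    ∑-neg []       f = ≈-sym -0#≈0#
    ∑-neg (x ∷ xs) f = ≈-trans (+-congˡ (∑-neg xs f)) (-‿+-comm (f x) (∑ xs f))

    ∑-++ : (xs ys : List A) (f : A → Carrier) → ∑ (xs ++ ys) f ≈ ∑ xs f + ∑ ys f
    ∑-++ []       ys f = ≈-sym (+-identityˡ _)
    ∑-++ (x ∷ xs) ys f = ≈-trans (+-congˡ (∑-++ xs ys f)) (≈-sym (+-assoc _ _ _))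

    ∑-filter : ∀ {p} {P : A → Set p} (P? : Decidable P) (xs : List A) (f : A → Carrier) →
               ∑ (filter P? xs) f ≈ ∑ xs (λ y → ⟦ P? y ⟧ * f y)
    ∑-filter P? []       f = ≈-refl
    ∑-filter P? (x ∷ xs) f with P? x
    ... | yes _ = +-cong (≈-sym (*-identityˡ _)) (∑-filter P? xs f)
    ... | no  _ = ≈-trans (∑-filter P? xs f) (≈-sym (≈-trans (+-congʳ (zeroˡ _)) (+-identityˡ _)))

    ∏-cong-∈ : (xs : List A) {f g : A → Carrier} → (∀ {y} → y ∈ˡ xs → f y ≈ g y) → ∏ xs f ≈ ∏ xs g
    ∏-cong-∈ []       eq = ≈-refl
    ∏-cong-∈ (x ∷ xs) eq = *-cong (eq (here refl)) (∏-cong-∈ xs (eq ∘ there))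

    ∏-cong : (xs : List A) {f g : A → Carrier} → (∀ y → f y ≈ g y) → ∏ xs f ≈ ∏ xs g
    ∏-cong xs eq = ∏-cong-∈ xs (λ {y} _ → eq y)

    ∏-one : (xs : List A) → ∏ xs (λ _ → 1#) ≈ 1#
    ∏-one []       = ≈-refl
    ∏-one (x ∷ xs) = ≈-trans (*-identityˡ _) (∏-one xs)

    ∏-* : (xs : List A) (f g : A → Carrier) → ∏ xs (λ y → f y * g y) ≈ ∏ xs f * ∏ xs g
    ∏-* []       f g = ≈-sym (*-identityˡ 1#)
    ∏-* (x ∷ xs) f g = begin
      (f x * g x) * ∏ xs (λ y → f y * g y)  ≈⟨ *-congˡ (∏-* xs f g) ⟩
      (f x * g x) * (∏ xs f * ∏ xs g)
        ≈⟨ solve 4 (λ p q r s → (p :* q) :* (r :* s) := (p :* r) :* (q :* s)) ≈-refl _ _ _ _ ⟩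
      (f x * ∏ xs f) * (g x * ∏ xs g)       ∎

    ∏-zero-∈ : {xs : List A} (f : A → Carrier) {x : A} → x ∈ˡ xs → f x ≈ 0# → ∏ xs f ≈ 0#
    ∏-zero-∈ f (here refl) eq = ≈-trans (*-congʳ eq) (zeroˡ _)
    ∏-zero-∈ f (there x∈)  eq = ≈-trans (*-congˡ (∏-zero-∈ f x∈ eq)) (zeroʳ _)

    ∏-filter : ∀ {p} {P : A → Set p} (P? : Decidable P) (xs : List A) (f : A → Carrier) →
               ∏ (filter P? xs) f ≈ ∏ xs (λ y → if does (P? y) then f y else 1#)
    ∏-filter P? []       f = ≈-refl
    ∏-filter P? (x ∷ xs) f with P? x
    ... | yes _ = *-congˡ (∏-filter P? xs f)
    ... | no  _ = ≈-trans (∏-filter P? xs f) (≈-sym (*-identityˡ _))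

  module _ {b b'} {A : Set b} {B : Set b'} where

    ∑-map : (h : B → A) (xs : List B) (f : A → Carrier) → ∑ (map h xs) f ≈ ∑ xs (f ∘ h)
    ∑-map h []       f = ≈-refl
    ∑-map h (x ∷ xs) f = +-congˡ (∑-map h xs f)

    ∏-map : (h : B → A) (xs : List B) (f : A → Carrier) → ∏ (map h xs) f ≈ ∏ xs (f ∘ h)
    ∏-map h []       f = ≈-refl
    ∏-map h (x ∷ xs) f = *-congˡ (∏-map h xs f)

    ∑-concatMap : (h : B → List A) (xs : List B) (f : A → Carrier) →
                  ∑ (concatMap h xs) f ≈ ∑ xs (λ x → ∑ (h x) f)
    ∑-concatMap h []       f = ≈-refl
    ∑-concatMap h (x ∷ xs) f = ≈-trans (∑-++ (h x) _ f) (+-congˡ (∑-concatMap h xs f))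

    ∑-swap : (xs : List A) (ys : List B) (f : A → B → Carrier) →
             ∑ xs (λ x → ∑ ys (f x)) ≈ ∑ ys (λ y → ∑ xs (λ x → f x y))
    ∑-swap []       ys f = ≈-sym (∑-zero ys)
    ∑-swap (x ∷ xs) ys f = ≈-trans (+-congˡ (∑-swap xs ys f)) (≈-sym (∑-+ ys (f x) _))

  -- Multiplying out: a sublist records the factors from which `f` was taken. Inclusion-exclusion is
  -- the case where `f` is minus an indicator.
  ∑-sublists-∏ : ∀ {b} {A : Set b} (xs : List A) (f : A → Carrier) →
                 ∑ (sublists xs) (λ ys → ∏ ys f) ≈ ∏ xs (λ y → 1# + f y)
  ∑-sublists-∏ []       f = +-identityʳ 1#
  ∑-sublists-∏ (x ∷ xs) f = begin
    ∑ (sublists xs ++ map (x ∷_) (sublists xs)) (λ ys → ∏ ys f)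
      ≈⟨ ∑-++ (sublists xs) _ _ ⟩
    S + ∑ (map (x ∷_) (sublists xs)) (λ ys → ∏ ys f)
      ≈⟨ +-congˡ (≈-trans (∑-map (x ∷_) (sublists xs) _) (∑-*ˡ (f x) (sublists xs) _)) ⟩
    S + f x * S
      ≈⟨ +-congʳ (*-identityˡ S) ⟨
    1# * S + f x * S
      ≈⟨ distribʳ S 1# (f x) ⟨
    (1# + f x) * S
      ≈⟨ *-congˡ (∑-sublists-∏ xs f) ⟩
    (1# + f x) * ∏ xs (λ y → 1# + f y) ∎
    where S = ∑ (sublists xs) (λ ys → ∏ ys f)

  ∑-cartesianProduct : ∀ {b b'} {A : Set b} {B : Set b'} (xs : List A) (ys : List B) (f : A × B → Carrier) →
    ∑ (cartesianProduct xs ys) f ≈ ∑ xs (λ x → ∑ ys (λ y → f (x , y)))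
  ∑-cartesianProduct []       ys f = ≈-refl
  ∑-cartesianProduct (x ∷ xs) ys f =
    ≈-trans (∑-++ (map (x ,_) ys) _ f) (+-cong (∑-map (x ,_) ys f) (∑-cartesianProduct xs ys f))

  ∑-allFin-suc : ∀ {n} (f : Fin (suc n) → Carrier) → ∑ (allFin (suc n)) f ≈ f zero + ∑ (allFin n) (f ∘ suc)
  ∑-allFin-suc {n} f = +-congˡ (≈-trans (reflexive (cong (λ xs → ∑ xs f) (sym (map-tabulate id suc)))) (∑-map suc (allFin n) f))

  ∏-allFin-suc : ∀ {n} (f : Fin (suc n) → Carrier) → ∏ (allFin (suc n)) f ≈ f zero * ∏ (allFin n) (f ∘ suc)
  ∏-allFin-suc {n} f = *-congˡ (≈-trans (reflexive (cong (λ xs → ∏ xs f) (sym (map-tabulate id suc)))) (∏-map suc (allFin n) f))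

  ∑-δ : ∀ {n} (j : Fin n) (f : Fin n → Carrier) → ∑ (allFin n) (λ i → ⟦ j Fin.≟ i ⟧ * f i) ≈ f j
  ∑-δ {suc n} zero f = begin
    ∑ (allFin (suc n)) (λ i → ⟦ zero Fin.≟ i ⟧ * f i)
      ≈⟨ ∑-allFin-suc (λ i → ⟦ zero Fin.≟ i ⟧ * f i) ⟩
    1# * f zero + ∑ (allFin n) (λ i → 0# * f (suc i))
      ≈⟨ +-cong (*-identityˡ _) (∑-vanish (allFin n) _) ⟩
    f zero + 0#  ≈⟨ +-identityʳ _ ⟩
    f zero       ∎
  ∑-δ {suc n} (suc j) f = begin
    ∑ (allFin (suc n)) (λ i → ⟦ suc j Fin.≟ i ⟧ * f i)
      ≈⟨ ∑-allFin-suc (λ i → ⟦ suc j Fin.≟ i ⟧ * f i) ⟩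
    0# * f zero + ∑ (allFin n) (λ i → ⟦ suc j Fin.≟ suc i ⟧ * f (suc i))
      ≈⟨ +-cong (zeroˡ _) (∑-cong (allFin n) (λ i →
           *-congʳ (⟦⟧-cong (suc j Fin.≟ suc i) (j Fin.≟ i) Fin.suc-injective (cong suc)))) ⟩
    0# + ∑ (allFin n) (λ i → ⟦ j Fin.≟ i ⟧ * f (suc i))
      ≈⟨ ≈-trans (+-identityˡ _) (∑-δ j (f ∘ suc)) ⟩
    f (suc j) ∎

-- Sums over parent maps

-- A partial map from vertices to edges; `nothing` marks a root.
ParentMap : ℕ → ℕ → Set
ParentMap n m = Vec (Maybe (Fin m)) n

_≟ᵐ_ : ∀ {m} → DecidableEquality (Maybe (Fin m))
_≟ᵐ_ = Maybe.≡-dec Fin._≟_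

_≟ᵖ_ : ∀ {n m} → DecidableEquality (ParentMap n m)
_≟ᵖ_ = Vec.≡-dec _≟ᵐ_

module WeightedSums {a ℓ₁ ℓ₂ ℓ₃ : Level} (F : OrderedField a ℓ₁ ℓ₂ ℓ₃) (m : ℕ) where
  open Sums F

  choices : List (Maybe (Fin m))
  choices = nothing ∷ map just (allFin m)

  ∑-choices : (h : Maybe (Fin m) → Carrier) → ∑ choices h ≈ h nothing + ∑ (allFin m) (h ∘ just)
  ∑-choices h = +-congˡ (∑-map just (allFin m) h)

  ∑-choices-δ : ∀ b (h : Maybe (Fin m) → Carrier) → ∑ choices (λ a → ⟦ b ≟ᵐ a ⟧ * h a) ≈ h b
  ∑-choices-δ nothing h = begin
    ∑ choices (λ a → ⟦ nothing ≟ᵐ a ⟧ * h a)        ≈⟨ ∑-choices (λ a → ⟦ nothing ≟ᵐ a ⟧ * h a) ⟩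
    1# * h nothing + ∑ (allFin m) (λ e → 0# * h (just e))
      ≈⟨ +-cong (*-identityˡ _) (∑-vanish (allFin m) _) ⟩
    h nothing + 0#                                   ≈⟨ +-identityʳ _ ⟩
    h nothing                                        ∎
  ∑-choices-δ (just e) h = begin
    ∑ choices (λ a → ⟦ just e ≟ᵐ a ⟧ * h a)         ≈⟨ ∑-choices (λ a → ⟦ just e ≟ᵐ a ⟧ * h a) ⟩
    0# * h nothing + ∑ (allFin m) (λ e' → ⟦ just e ≟ᵐ just e' ⟧ * h (just e'))
      ≈⟨ +-cong (zeroˡ _) (∑-cong (allFin m) λ e' →
           *-congʳ (⟦⟧-cong (just e ≟ᵐ just e') (e Fin.≟ e') (λ { refl → refl }) (cong just))) ⟩
    0# + ∑ (allFin m) (λ e' → ⟦ e Fin.≟ e' ⟧ * h (just e'))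
      ≈⟨ ≈-trans (+-identityˡ _) (∑-δ e (h ∘ just)) ⟩
    h (just e)                                       ∎

  Weight : ℕ → Set a
  Weight n = Fin n → Maybe (Fin m) → Carrier

  -- 𝔼 ω g = ∑_f (∏_v ω v (f v)) * g f
  𝔼 : ∀ {n} → Weight n → (ParentMap n m → Carrier) → Carrier
  𝔼 {zero}  ω g = g []
  𝔼 {suc n} ω g = ∑ choices λ a → ω zero a * 𝔼 (ω ∘ suc) (λ f → g (a ∷ f))

  -- The weight of a vertex that must be a root. It takes the vertex out of a sum while the maps
  -- keep their length.
  root : Maybe (Fin m) → Carrier
  root nothing  = 1#
  root (just _) = 0#

  -- A map that violates `P` at some vertex has a factor zero in its weight. What the weight
  -- enforces vertex by vertex thus becomes a hypothesis about the whole map.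
  𝔼-cong-on : ∀ {n p} (P : Fin n → Maybe (Fin m) → Set p) {ω : Weight n} {g g' : ParentMap n m → Carrier} →
              (∀ v a → P v a ⊎ ω v a ≈ 0#) →
              (∀ f → (∀ v → P v (lookup f v)) → g f ≈ g' f) → 𝔼 ω g ≈ 𝔼 ω g'
  𝔼-cong-on {zero}  P     supp eq = eq [] λ ()
  𝔼-cong-on {suc n} P {ω} supp eq = ∑-cong choices step
    where
    step : ∀ a → ω zero a * _ ≈ ω zero a * _
    step a with supp zero a
    ... | inj₁ p  = *-congˡ (𝔼-cong-on (P ∘ suc) (supp ∘ suc)
                      (λ f ps → eq (a ∷ f) (λ { zero → p ; (suc v) → ps v })))
    ... | inj₂ ≈0 = ≈-trans (≈-trans (*-congʳ ≈0) (zeroˡ _)) (≈-sym (≈-trans (*-congʳ ≈0) (zeroˡ _)))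

  𝔼-congʷ : ∀ {n} {ω ω' : Weight n} (g : ParentMap n m → Carrier) → (∀ v a → ω v a ≈ ω' v a) → 𝔼 ω g ≈ 𝔼 ω' g
  𝔼-congʷ {zero}  g eq = ≈-refl
  𝔼-congʷ {suc n} g eq = ∑-cong choices λ a → *-cong (eq zero a) (𝔼-congʷ (λ f → g (a ∷ f)) (eq ∘ suc))

  𝔼-∑ : ∀ {n b} {B : Set b} (ω : Weight n) (xs : List B) (g : B → ParentMap n m → Carrier) →
        𝔼 ω (λ f → ∑ xs (λ x → g x f)) ≈ ∑ xs (λ x → 𝔼 ω (g x))
  𝔼-∑ {zero}  ω xs g = ≈-refl
  𝔼-∑ {suc n} ω xs g = begin
    ∑ choices (λ a → ω zero a * 𝔼 (ω ∘ suc) (λ f → ∑ xs (λ x → g x (a ∷ f))))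
      ≈⟨ ∑-cong choices (λ a → ≈-trans (*-congˡ (𝔼-∑ (ω ∘ suc) xs (λ x f → g x (a ∷ f))))
                                       (≈-sym (∑-*ˡ (ω zero a) xs _))) ⟩
    ∑ choices (λ a → ∑ xs (λ x → ω zero a * 𝔼 (ω ∘ suc) (λ f → g x (a ∷ f))))
      ≈⟨ ∑-swap choices xs _ ⟩
    ∑ xs (λ x → ∑ choices (λ a → ω zero a * 𝔼 (ω ∘ suc) (λ f → g x (a ∷ f)))) ∎

  𝔼-*ˡ : ∀ {n} (ω : Weight n) (k : Carrier) (g : ParentMap n m → Carrier) → 𝔼 ω (λ f → k * g f) ≈ k * 𝔼 ω g
  𝔼-*ˡ {zero}  ω k g = ≈-refl
  𝔼-*ˡ {suc n} ω k g = begin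
    ∑ choices (λ a → ω zero a * 𝔼 (ω ∘ suc) (λ f → k * g (a ∷ f)))
      ≈⟨ ∑-cong choices (λ a → ≈-trans (*-congˡ (𝔼-*ˡ (ω ∘ suc) k _))
           (x∙yz≈y∙xz _ _ _)) ⟩
    ∑ choices (λ a → k * (ω zero a * 𝔼 (ω ∘ suc) (λ f → g (a ∷ f))))
      ≈⟨ ∑-*ˡ k choices _ ⟩
    k * 𝔼 ω g ∎

  𝔼-cong : ∀ {n} (ω : Weight n) {g g' : ParentMap n m → Carrier} → (∀ f → g f ≈ g' f) → 𝔼 ω g ≈ 𝔼 ω g'
  𝔼-cong ω eq = 𝔼-cong-on (λ _ _ → ω ≡ ω) {ω} (λ _ _ → inj₁ refl) (λ f _ → eq f)

  𝔼-+ : ∀ {n} (ω : Weight n) (g g' : ParentMap n m → Carrier) → 𝔼 ω (λ f → g f + g' f) ≈ 𝔼 ω g + 𝔼 ω g'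
  𝔼-+ {zero}  ω g g' = ≈-refl
  𝔼-+ {suc n} ω g g' = ≈-trans
    (∑-cong choices (λ a → ≈-trans (*-congˡ (𝔼-+ (ω ∘ suc) _ _)) (distribˡ _ _ _)))
    (∑-+ choices _ _)

  𝔼-neg : ∀ {n} (ω : Weight n) (g : ParentMap n m → Carrier) → 𝔼 ω (λ f → - g f) ≈ - 𝔼 ω g
  𝔼-neg {zero}  ω g = ≈-refl
  𝔼-neg {suc n} ω g = ≈-trans
    (∑-cong choices (λ a → ≈-trans (*-congˡ (𝔼-neg (ω ∘ suc) _)) (≈-sym (-‿distribʳ-* _ _))))
    (∑-neg choices _)

  -- The choice at `w` moves innermost. In the outer sum `w` is forced to be a root, a placeholder
  -- that the inner sum overwrites.
  𝔼-split : ∀ {n} (w : Fin n) (ω : Weight n) (g : ParentMap n m → Carrier) →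
            𝔼 ω g ≈ 𝔼 (updateAt ω w (const root)) (λ f → ∑ choices λ a → ω w a * g (f [ w ]≔ a))
  𝔼-split zero ω g = begin
    ∑ choices (λ a → ω zero a * 𝔼 (ω ∘ suc) (λ f → g (a ∷ f)))
      ≈⟨ ∑-cong choices (λ a → 𝔼-*ˡ (ω ∘ suc) (ω zero a) _) ⟨
    ∑ choices (λ a → 𝔼 (ω ∘ suc) (λ f → ω zero a * g (a ∷ f)))
      ≈⟨ 𝔼-∑ (ω ∘ suc) choices _ ⟨
    X  ≈⟨ +-identityʳ X ⟨
    X + 0#
      ≈⟨ +-cong (*-identityˡ X) (∑-vanish (allFin m) _) ⟨
    1# * X + ∑ (allFin m) (λ _ → 0# * X)
      ≈⟨ ∑-choices (λ a → root a * X) ⟨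
    ∑ choices (λ a → root a * X) ∎
    where X = 𝔼 (ω ∘ suc) (λ f → ∑ choices λ a → ω zero a * g (a ∷ f))
  𝔼-split (suc w) ω g = ∑-cong choices λ a → *-congˡ (𝔼-split w (ω ∘ suc) (λ f → g (a ∷ f)))

  𝔼-fix : ∀ {n} (w : Fin n) b (ω : Weight n) (g : ParentMap n m → Carrier) →
          𝔼 ω (λ f → ⟦ b ≟ᵐ lookup f w ⟧ * g f) ≈
          ω w b * 𝔼 (updateAt ω w (const root)) (λ f → g (f [ w ]≔ b))
  𝔼-fix w b ω g = begin
    𝔼 ω (λ f → ⟦ b ≟ᵐ lookup f w ⟧ * g f)
      ≈⟨ 𝔼-split w ω _ ⟩
    𝔼 ω' (λ f → ∑ choices λ a → ω w a * (⟦ b ≟ᵐ lookup (f [ w ]≔ a) w ⟧ * g (f [ w ]≔ a)))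
      ≈⟨ 𝔼-cong ω' (λ f → ∑-cong choices λ a → ≈-trans
           (*-congˡ (*-congʳ (reflexive (cong (λ z → ⟦ b ≟ᵐ z ⟧) (Vec.lookup∘updateAt w f)))))
           (x∙yz≈y∙xz _ _ _)) ⟩
    𝔼 ω' (λ f → ∑ choices λ a → ⟦ b ≟ᵐ a ⟧ * (ω w a * g (f [ w ]≔ a)))
      ≈⟨ 𝔼-cong ω' (λ f → ∑-choices-δ b _) ⟩
    𝔼 ω' (λ f → ω w b * g (f [ w ]≔ b))
      ≈⟨ 𝔼-*ˡ ω' (ω w b) _ ⟩
    ω w b * 𝔼 ω' (λ f → g (f [ w ]≔ b)) ∎
    where ω' = updateAt ω w (const root)

  -- Every map takes exactly one factor from each vertex, root or not, so all maps are scaled alike.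
  𝔼-scale : ∀ {n} (ξ : Fin n → Carrier) (ω : Weight n) (g : ParentMap n m → Carrier) →
            𝔼 (λ v a → ξ v * ω v a) g ≈ ∏ (allFin n) ξ * 𝔼 ω g
  𝔼-scale {zero}  ξ ω g = ≈-sym (*-identityˡ _)
  𝔼-scale {suc n} ξ ω g = begin
    ∑ choices (λ a → ξ zero * ω zero a * 𝔼 (λ v a → ξ (suc v) * ω (suc v) a) (λ f → g (a ∷ f)))
      ≈⟨ ∑-cong choices (λ a → ≈-trans (*-congˡ (𝔼-scale (ξ ∘ suc) (ω ∘ suc) _))
           (solve 4 (λ p q r s → (p :* q) :* (r :* s) := (p :* r) :* (q :* s)) ≈-refl _ _ _ _)) ⟩
    ∑ choices (λ a → ξ zero * ∏ (allFin n) (ξ ∘ suc) * (ω zero a * 𝔼 (ω ∘ suc) (λ f → g (a ∷ f))))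
      ≈⟨ ∑-*ˡ _ choices _ ⟩
    ξ zero * ∏ (allFin n) (ξ ∘ suc) * 𝔼 ω g
      ≈⟨ *-congʳ (∏-allFin-suc ξ) ⟨
    ∏ (allFin (suc n)) ξ * 𝔼 ω g ∎

  𝔼-δ : ∀ {n} (f₀ : ParentMap n m) (ω : Weight n) →
        𝔼 ω (λ f → ⟦ f₀ ≟ᵖ f ⟧) ≈ ∏ (allFin n) (λ v → ω v (lookup f₀ v))
  𝔼-δ {zero}  []        ω = ≈-refl
  𝔼-δ {suc n} (b ∷ f₀) ω = begin
    ∑ choices (λ a → ω zero a * 𝔼 (ω ∘ suc) (λ f → ⟦ (b ∷ f₀) ≟ᵖ (a ∷ f) ⟧))
      ≈⟨ ∑-cong choices (λ a → *-congˡ (≈-trans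
           (𝔼-cong (ω ∘ suc) (λ f → ≈-trans
             (⟦⟧-cong ((b ∷ f₀) ≟ᵖ (a ∷ f)) ((b ≟ᵐ a) ×-dec (f₀ ≟ᵖ f)) Vec.∷-injective (uncurry (≡.cong₂ _∷_)))
             (⟦⟧-× (b ≟ᵐ a) (f₀ ≟ᵖ f))))
           (𝔼-*ˡ (ω ∘ suc) _ _))) ⟩
    ∑ choices (λ a → ω zero a * (⟦ b ≟ᵐ a ⟧ * 𝔼 (ω ∘ suc) (λ f → ⟦ f₀ ≟ᵖ f ⟧)))
      ≈⟨ ∑-cong choices (λ a → x∙yz≈y∙xz _ _ _) ⟩
    ∑ choices (λ a → ⟦ b ≟ᵐ a ⟧ * (ω zero a * 𝔼 (ω ∘ suc) (λ f → ⟦ f₀ ≟ᵖ f ⟧)))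
      ≈⟨ ∑-choices-δ b _ ⟩
    ω zero b * 𝔼 (ω ∘ suc) (λ f → ⟦ f₀ ≟ᵖ f ⟧)
      ≈⟨ *-congˡ (𝔼-δ f₀ (ω ∘ suc)) ⟩
    ω zero b * ∏ (allFin n) (λ v → ω (suc v) (lookup f₀ v))
      ≈⟨ ∏-allFin-suc (λ v → ω v (lookup (b ∷ f₀) v)) ⟨
    ∏ (allFin (suc n)) (λ v → ω v (lookup (b ∷ f₀) v)) ∎

-- Parent maps of a graph, their walks and grafts

module Parents {n m : ℕ} (G : Graph n m) where
  open Graph G

  joins-sym : ∀ {e u v} → Joins e u v → Joins e v u
  joins-sym (inj₁ p) = inj₂ p
  joins-sym (inj₂ p) = inj₁ p

  joins⇒∈ : ∀ {e u v} → Joins e u v → u ∈ₑ e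
  joins⇒∈ (inj₁ (p , _)) = inj₁ p
  joins⇒∈ (inj₂ (_ , p)) = inj₂ p

  joins-≢ : ∀ {e u v} → Joins e u v → u ≢ v
  joins-≢ {e} (inj₁ (p , q)) refl = loopless e (trans p (sym q))
  joins-≢ {e} (inj₂ (p , q)) refl = loopless e (trans p (sym q))

  joins-injective : ∀ {e f u v} → Joins e u v → Joins f u v → e ≡ f
  joins-injective {e} {f} {u} {v} p (inj₁ (refl , refl)) = simple p
  joins-injective {e} {f} {u} {v} p (inj₂ (refl , refl)) = simple (joins-sym p)

  -- Meaningful only when v is an end of e.
  other : Fin m → Fin n → Fin n
  other e v with src e Fin.≟ v
  ... | yes _ = tgt e
  ... | no  _ = src e

  other-joins : ∀ {e v} → v ∈ₑ e → Joins e v (other e v)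
  other-joins {e} {v} v∈e with src e Fin.≟ v
  other-joins v∈e      | yes p = inj₁ (p , refl)
  other-joins (inj₁ q) | no ¬p = contradiction q ¬p
  other-joins (inj₂ q) | no ¬p = inj₂ (refl , q)

  joins⇒other : ∀ {e v w} → Joins e v w → other e v ≡ w
  joins⇒other {e} {v} j with src e Fin.≟ v
  joins⇒other     (inj₁ (_ , q)) | yes _ = q
  joins⇒other {e} (inj₂ (_ , q)) | yes p = contradiction (trans p (sym q)) (loopless e)
  joins⇒other     (inj₁ (p , _)) | no ¬p = contradiction p ¬p
  joins⇒other     (inj₂ (p , _)) | no _  = p

  ∈⇒joins : ∀ {e u v} → u ∈ₑ e → v ∈ₑ e → u ≢ v → Joins e u v
  ∈⇒joins (inj₁ p) (inj₁ q) u≢v = contradiction (trans (sym p) q) u≢v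
  ∈⇒joins (inj₁ p) (inj₂ q) u≢v = inj₁ (p , q)
  ∈⇒joins (inj₂ p) (inj₁ q) u≢v = inj₂ (q , p)
  ∈⇒joins (inj₂ p) (inj₂ q) u≢v = contradiction (trans (sym p) q) u≢v

  Map : Set
  Map = ParentMap n m

  Valid : Map → Set
  Valid f = ∀ {v e} → lookup f v ≡ just e → v ∈ₑ e

  -- The matching condition at the vertices e* of the subdivision graph; at the vertices of `G` it
  -- holds because a parent map is a function. Roots share the value `nothing`, hence the first
  -- alternative.
  EdgeInjective : Map → Set
  EdgeInjective f = ∀ v w → lookup f v ≡ lookup f w → lookup f v ≡ nothing ⊎ v ≡ w

  edgeInjective? : ∀ f → Dec (EdgeInjective f)
  edgeInjective? f = Fin.all? λ v → Fin.all? λ w →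
    (lookup f v ≟ᵐ lookup f w) →-dec ((lookup f v ≟ᵐ nothing) ⊎-dec (v Fin.≟ w))

  owner-unique : ∀ f {v w e} → EdgeInjective f → lookup f v ≡ just e → lookup f w ≡ just e → v ≡ w
  owner-unique f {v} {w} inj p q with inj v w (trans p (sym q))
  ... | inj₁ r = contradiction (trans (sym r) p) λ ()
  ... | inj₂ r = r

  Step : Map → Fin n → Fin n → Set
  Step f v w = ∃ λ e → lookup f v ≡ just e × other e v ≡ w

  step? : ∀ f v w → Dec (Step f v w)
  step? f v w with lookup f v
  ... | nothing = no λ ()
  ... | just e  = map′ (λ eq → e , refl , eq) (λ { (_ , refl , eq) → eq }) (other e v Fin.≟ w)

  -- Inductive, so only finite walks count: a vertex whose ancestors run into a cycle leads to no
  -- root.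
  data Leads (f : Map) : Fin n → Fin n → Set where
    halt : ∀ {v} → lookup f v ≡ nothing → Leads f v v
    move : ∀ {v e a} → lookup f v ≡ just e → Leads f (other e v) a → Leads f v a

  leads⇒root : ∀ {f v a} → Leads f v a → lookup f a ≡ nothing
  leads⇒root (halt p)   = p
  leads⇒root (move _ l) = leads⇒root l

  leads? : ∀ f v a → Dec (Leads f v a)
  leads? f v a = map′ (uncurry from) (λ l → to l , leads⇒root l)
                      (star? (step? f) v a ×-dec (lookup f a ≟ᵐ nothing))
    where
    from : ∀ {v} → Star (Step f) v a → lookup f a ≡ nothing → Leads f v a
    from ε                   r = halt r
    from ((_ , p , refl) ◅ s) r = move p (from s r)
    to : ∀ {v} → Leads f v a → Star (Step f) v a
    to (halt _)   = ε
    to (move p l) = (_ , p , refl) ◅ to l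

  leads-unique : ∀ {f v a b} → Leads f v a → Leads f v b → a ≡ b
  leads-unique (halt _)   (halt _)   = refl
  leads-unique (halt p)   (move q _) = contradiction (trans (sym p) q) λ ()
  leads-unique (move p _) (halt q)   = contradiction (trans (sym q) p) λ ()
  leads-unique (move p l) (move q k) with trans (sym p) q
  ... | refl = leads-unique l k

  Forest : Map → Set
  Forest f = ∀ v → ∃ (Leads f v)

  forest? : ∀ f → Dec (Forest f)
  forest? f = Fin.all? λ v → Fin.any? λ a → leads? f v a

  -- The tree of `w` is hung by `e`. Walks of `h` that end elsewhere survive, and walks that end at
  -- `w` go on from the other end of `e`; a forest remains a forest exactly when that end lies
  -- outside the tree of `w`.
  module Graft (h : Map) {w : Fin n} (w-root : lookup h w ≡ nothing) (e : Fin m) where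
    h⁺ : Map
    h⁺ = h [ w ]≔ just e

    at : lookup h⁺ w ≡ just e
    at = Vec.lookup∘updateAt w h

    away : ∀ {v} → v ≢ w → lookup h⁺ v ≡ lookup h v
    away {v} v≢w = Vec.lookup∘updateAt′ v w v≢w h

    lift : ∀ {v a} → a ≢ w → Leads h v a → Leads h⁺ v a
    lift a≢w (halt p) = halt (trans (away a≢w) p)
    lift {v} a≢w (move p l) = move (trans (away λ { refl → contradiction (trans (sym w-root) p) λ () }) p) (lift a≢w l)

    through : ∀ {v a} → Leads h v w → Leads h⁺ (other e w) a → Leads h⁺ v a
    through (halt _)   k = move at k
    through (move p l) k =
      move (trans (away λ { refl → contradiction (trans (sym w-root) p) λ () }) p) (through l k)

    lower : ∀ {v a} → Leads h⁺ v a → Leads h v a ⊎ (Leads h v w × Leads h (other e w) a)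
    lower {v} (halt p) with v Fin.≟ w
    ... | yes refl = contradiction (trans (sym at) p) λ ()
    ... | no v≢w   = inj₁ (halt (trans (sym (away v≢w)) p))
    lower {v} (move p l) with v Fin.≟ w
    lower (move p l) | yes refl with trans (sym at) p
    ... | refl with lower l
    ...   | inj₁ k       = inj₂ (halt w-root , k)
    -- If the walk passes `w` again, only what follows the last passage is kept.
    ...   | inj₂ (_ , k) = inj₂ (halt w-root , k)
    lower (move p l) | no v≢w with lower l
    ... | inj₁ k       = inj₁ (move (trans (sym (away v≢w)) p) k)
    ... | inj₂ (i , k) = inj₂ (move (trans (sym (away v≢w)) p) i , k)

    root⁺-≢ : ∀ {v a} → Leads h⁺ v a → a ≢ w
    root⁺-≢ l refl = contradiction (trans (sym at) (leads⇒root l)) λ ()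

    forest⁻ : Forest h⁺ → Forest h
    forest⁻ fst v with fst v
    ... | a , l with lower l
    ...   | inj₁ k       = a , k
    ...   | inj₂ (k , _) = w , k

    -- In `h⁺` the walk from the other end of `e` stops at a root other than `w`. By `lower` it
    -- reaches the same root in `h`, and a walk reaches only one root.
    forest⁻-cut : Forest h⁺ → ¬ Leads h (other e w) w
    forest⁻-cut fst k with fst (other e w)
    ... | a , l with lower l
    ...   | inj₁ i       = root⁺-≢ l (leads-unique i k)
    ...   | inj₂ (_ , i) = root⁺-≢ l (leads-unique i k)

    forest⁺ : Forest h → ¬ Leads h (other e w) w → Forest h⁺
    forest⁺ fst cut v with fst v
    ... | a , l with a Fin.≟ w
    ...   | no a≢w = a , lift a≢w l
    ...   | yes refl with fst (other e w)
    ...     | b , k with b Fin.≟ w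
    ...       | yes refl = contradiction k cut
    ...       | no b≢w   = b , through l (lift b≢w k)

-- Effective resistance and forests with two roots

module _ {n : ℕ} where
  open DecMembership (Fin._≟_ {n}) public using () renaming (_∈?_ to _∈ˡ?_)

module Network {a ℓ₁ ℓ₂ ℓ₃ : Level} (F : OrderedField a ℓ₁ ℓ₂ ℓ₃) {n m : ℕ} (G : Graph n m)
               (c : Fin m → OrderedField.Carrier F) where
  open Sums F
  open WeightedSums F m
  open Graph G
  open Parents G

  incident : Fin n → Fin m → Carrier
  incident v e = ⟦ v ∈ₑ? e ⟧ * c e

  incident-zero : ∀ {v e} → ¬ v ∈ₑ e → incident v e ≈ 0#
  incident-zero {v} {e} v∉e = ≈-trans (*-congʳ (⟦⟧-no (v ∈ₑ? e) v∉e)) (zeroˡ _)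

  -- The common form of `rooted` and `away`: `ρ` weighs the roots and `κ` says which vertices may
  -- own an edge. The indicator inside `incident` restricts the sum to valid maps.
  net : (ρ κ : Fin n → Carrier) → Weight n
  net ρ κ v nothing  = ρ v
  net ρ κ v (just e) = κ v * incident v e

  Supported : (Fin n → Set) → Fin n → Maybe (Fin m) → Set
  Supported S v nothing  = S v
  Supported S v (just e) = ¬ S v × v ∈ₑ e

  rooted : List (Fin n) → Weight n
  rooted R = net (λ v → ⟦ v ∈ˡ? R ⟧) (λ v → ⟦ ¬? (v ∈ˡ? R) ⟧)

  rooted-supported : ∀ R v b → Supported (_∈ˡ R) v b ⊎ rooted R v b ≈ 0#
  rooted-supported R v nothing with v ∈ˡ? R
  ... | yes v∈R = inj₁ v∈R
  ... | no _    = inj₂ ≈-refl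
  rooted-supported R v (just e) with v ∈ˡ? R
  ... | yes _   = inj₂ (zeroˡ _)
  ... | no v∉R with v ∈ₑ? e
  ...   | yes v∈e = inj₁ (v∉R , v∈e)
  ...   | no v∉e  = inj₂ (≈-trans (*-congˡ (incident-zero v∉e)) (zeroʳ _))

  record RootedAt (R : List (Fin n)) (f : Map) : Set where
    field
      valid  : Valid f
      isRoot : ∀ {v} → v ∈ˡ R → lookup f v ≡ nothing
      root∈  : ∀ {v} → lookup f v ≡ nothing → v ∈ˡ R

  supported⇒rootedAt : ∀ {R} f → (∀ v → Supported (_∈ˡ R) v (lookup f v)) → RootedAt R f
  supported⇒rootedAt {R} f supp = record
    { valid  = λ {v} eq → proj₂ (subst (Supported _ v) eq (supp v))
    ; isRoot = λ {v} → isRoot v (lookup f v) (supp v)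
    ; root∈  = λ {v} eq → subst (Supported _ v) eq (supp v)
    }
    where
    isRoot : ∀ v b → Supported (_∈ˡ R) v b → v ∈ˡ R → b ≡ nothing
    isRoot v nothing  _         _   = refl
    isRoot v (just e) (v∉R , _) v∈R = contradiction v∈R v∉R

  𝔼-rooted-cong : ∀ R {g g' : Map → Carrier} → (∀ f → RootedAt R f → g f ≈ g' f) → 𝔼 (rooted R) g ≈ 𝔼 (rooted R) g'
  𝔼-rooted-cong R eq =
    𝔼-cong-on (Supported (_∈ˡ R)) (rooted-supported R) (λ f supp → eq f (supported⇒rootedAt f supp))

  rooted-cong : ∀ R R' → (∀ {v} → v ∈ˡ R → v ∈ˡ R') → (∀ {v} → v ∈ˡ R' → v ∈ˡ R) → ∀ v b → rooted R v b ≈ rooted R' v b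
  rooted-cong R R' to from v nothing  = ⟦⟧-cong (v ∈ˡ? R) (v ∈ˡ? R') to from
  rooted-cong R R' to from v (just e) = *-congʳ (⟦⟧-cong (¬? (v ∈ˡ? R)) (¬? (v ∈ˡ? R')) (_∘ from) (_∘ to))

  updateAt-root : ∀ (ω ω' : Weight n) w → (∀ b → ω' w b ≈ root b) → (∀ v → v ≢ w → ∀ b → ω' v b ≈ ω v b) →
                  ∀ v b → updateAt ω w (const root) v b ≈ ω' v b
  updateAt-root ω ω' w at away v b with v Fin.≟ w
  ... | yes refl = ≈-trans (reflexive (cong (λ h → h b) (updateAt-updates w ω))) (≈-sym (at b))
  ... | no v≢w   = ≈-trans (reflexive (cong (λ h → h b) (updateAt-minimal v w ω v≢w))) (≈-sym (away v v≢w b))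

  -- Detaching the non-root `w` from its parent leaves a map with the additional root `w`; `e` is
  -- the edge that was cut. All three balance equations rest on this.
  𝔼-rooted-split : ∀ R w → w ∉ˡ R → (g : Map → Carrier) →
    𝔼 (rooted R) g ≈ 𝔼 (rooted (w ∷ R)) (λ h → ∑ (allFin m) λ e → incident w e * g (h [ w ]≔ just e))
  𝔼-rooted-split R w w∉R g = begin
    𝔼 (rooted R) g
      ≈⟨ 𝔼-split w (rooted R) g ⟩
    𝔼 (updateAt (rooted R) w (const root)) (λ h → ∑ choices λ b → rooted R w b * g (h [ w ]≔ b))
      ≈⟨ 𝔼-congʷ _ (updateAt-root (rooted R) (rooted (w ∷ R)) w at away) ⟩
    𝔼 (rooted (w ∷ R)) (λ h → ∑ choices λ b → rooted R w b * g (h [ w ]≔ b))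
      ≈⟨ 𝔼-cong (rooted (w ∷ R)) (λ h → ≈-trans (∑-choices (λ b → rooted R w b * g (h [ w ]≔ b)))
           (≈-trans (+-cong (≈-trans (*-congʳ (⟦⟧-no (w ∈ˡ? R) w∉R)) (zeroˡ _))
                            (∑-cong (allFin m) λ e → *-congʳ
                              (≈-trans (*-congʳ (⟦⟧-yes (¬? (w ∈ˡ? R)) w∉R)) (*-identityˡ _))))
                    (+-identityˡ _))) ⟩
    𝔼 (rooted (w ∷ R)) (λ h → ∑ (allFin m) λ e → incident w e * g (h [ w ]≔ just e)) ∎
    where
    at : ∀ b → rooted (w ∷ R) w b ≈ root b
    at nothing  = ⟦⟧-yes (w ∈ˡ? (w ∷ R)) (here refl)
    at (just e) = ≈-trans (*-congʳ (⟦⟧-no (¬? (w ∈ˡ? (w ∷ R))) (λ ∉ → ∉ (here refl)))) (zeroˡ _)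
    drop : ∀ {v} → v ≢ w → v ∈ˡ (w ∷ R) → v ∈ˡ R
    drop v≢w (here eq)  = contradiction eq v≢w
    drop v≢w (there v∈) = v∈
    away : ∀ v → v ≢ w → ∀ b → rooted (w ∷ R) v b ≈ rooted R v b
    away v v≢w nothing  = ⟦⟧-cong (v ∈ˡ? (w ∷ R)) (v ∈ˡ? R) (drop v≢w) there
    away v v≢w (just e) = *-congʳ (⟦⟧-cong (¬? (v ∈ˡ? (w ∷ R))) (¬? (v ∈ˡ? R)) (_∘ there) (_∘ drop v≢w))

  forests : List (Fin n) → Carrier
  forests R = 𝔼 (rooted R) (λ f → ⟦ forest? f ⟧)

  degree : Fin n → Carrier
  degree w = ∑ (allFin m) (incident w)

  module Potential (u v : Fin n) (u≢v : u ≢ v) where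

    -- The potential of the overview. It drives the current τ instead of 1, which keeps it a
    -- polynomial in the conductances.
    ψ : Fin n → Carrier
    ψ w = 𝔼 (rooted (u ∷ v ∷ [])) (λ f → ⟦ forest? f ⟧ * ⟦ leads? f w u ⟧)

    -- The neighbours' part of the Laplacian: the net outflow at `w` is `degree w * ψ w - inflow w`,
    -- so each balance equation below is one row of the Laplacian system for `ψ`.
    inflow : Fin n → Carrier
    inflow w = ∑ (allFin m) λ e → incident w e * ψ (other e w)

    private
      inflow-𝔼 : ∀ w → inflow w ≈ 𝔼 (rooted (u ∷ v ∷ []))
        (λ f → ∑ (allFin m) λ e → incident w e * (⟦ forest? f ⟧ * ⟦ leads? f (other e w) u ⟧))
      inflow-𝔼 w = ≈-trans (∑-cong (allFin m) (λ e → ≈-sym (𝔼-*ˡ (rooted (u ∷ v ∷ [])) (incident w e) _)))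
                           (≈-sym (𝔼-∑ (rooted (u ∷ v ∷ [])) (allFin m) _))

      degree-𝔼 : ∀ w R (g : Map → Carrier) →
                 degree w * 𝔼 (rooted R) g ≈ 𝔼 (rooted R) (λ f → ∑ (allFin m) λ e → incident w e * g f)
      degree-𝔼 w R g = ≈-trans (≈-sym (𝔼-*ˡ (rooted R) (degree w) g))
                               (𝔼-cong (rooted R) (λ f → ≈-sym (∑-*ʳ (g f) (allFin m) (incident w))))

      graft-forest : ∀ {f w} → lookup f w ≡ nothing → ∀ e →
        ⟦ forest? (f [ w ]≔ just e) ⟧ ≈ ⟦ forest? f ⟧ * ⟦ ¬? (leads? f (other e w) w) ⟧
      graft-forest {f} {w} r e = ≈-trans
        (⟦⟧-cong (forest? h⁺) (forest? f ×-dec ¬? (leads? f (other e w) w))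
          (λ fst → forest⁻ fst , forest⁻-cut fst) (uncurry forest⁺))
        (⟦⟧-× (forest? f) (¬? (leads? f (other e w) w)))
        where open Graft f r e

    ψ-source : ψ u ≈ forests (u ∷ v ∷ [])
    ψ-source = 𝔼-rooted-cong (u ∷ v ∷ []) λ f at →
      ≈-trans (*-congˡ (⟦⟧-yes (leads? f u u) (halt (RootedAt.isRoot at (here refl))))) (*-identityʳ _)

    ψ-sink : ψ v ≈ 0#
    ψ-sink = begin
      ψ v  ≈⟨ 𝔼-rooted-cong (u ∷ v ∷ []) (λ f at → *-congˡ (⟦⟧-no (leads? f v u)
                (λ l → u≢v (leads-unique l (halt (RootedAt.isRoot at (there (here refl)))))))) ⟩
      𝔼 (rooted (u ∷ v ∷ [])) (λ f → ⟦ forest? f ⟧ * 0#)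
           ≈⟨ 𝔼-cong (rooted (u ∷ v ∷ [])) (λ f → *-comm _ _) ⟩
      𝔼 (rooted (u ∷ v ∷ [])) (λ f → 0# * ⟦ forest? f ⟧)
           ≈⟨ 𝔼-*ˡ (rooted (u ∷ v ∷ [])) 0# _ ⟩
      0# * _  ≈⟨ zeroˡ _ ⟩
      0# ∎

    -- An edge at `u` ends in the tree of `u`, which `inflow u` counts, or in that of `v`. In the
    -- second case `u` can be hung by it, and every forest rooted at `v` alone arises once in this
    -- way.
    balance-source : degree u * ψ u ≈ inflow u + forests (v ∷ [])
    balance-source = begin
      degree u * ψ u
        ≈⟨ *-congˡ ψ-source ⟩
      degree u * forests (u ∷ v ∷ [])
        ≈⟨ degree-𝔼 u (u ∷ v ∷ []) _ ⟩
      𝔼 (rooted (u ∷ v ∷ [])) (λ f → ∑ (allFin m) λ e → incident u e * ⟦ forest? f ⟧)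
        ≈⟨ 𝔼-rooted-cong (u ∷ v ∷ []) pointwise ⟩
      𝔼 (rooted (u ∷ v ∷ [])) (λ f →
          ∑ (allFin m) (λ e → incident u e * (⟦ forest? f ⟧ * ⟦ leads? f (other e u) u ⟧))
        + ∑ (allFin m) (λ e → incident u e * ⟦ forest? (f [ u ]≔ just e) ⟧))
        ≈⟨ 𝔼-+ (rooted (u ∷ v ∷ [])) _ _ ⟩
      _ + _
        ≈⟨ +-cong (inflow-𝔼 u) (𝔼-rooted-split (v ∷ []) u (λ { (here eq) → u≢v eq }) (λ f → ⟦ forest? f ⟧)) ⟨
      inflow u + forests (v ∷ []) ∎
      where
      pointwise : ∀ f → RootedAt (u ∷ v ∷ []) f → _
      pointwise f at = ≈-trans (∑-cong (allFin m) (λ e → begin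
        incident u e * φ
          ≈⟨ *-congˡ (≈-sym (≈-trans (*-congˡ (≈-trans (+-comm _ _) (⟦⟧-¬ (leads? f (other e u) u)))) (*-identityʳ φ))) ⟩
        incident u e * (φ * (⟦ leads? f (other e u) u ⟧ + ⟦ ¬? (leads? f (other e u) u) ⟧))
          ≈⟨ solve 4 (λ i p l k → i :* (p :* (l :+ k)) := i :* (p :* l) :+ i :* (p :* k)) ≈-refl _ _ _ _ ⟩
        incident u e * (φ * ⟦ leads? f (other e u) u ⟧) + incident u e * (φ * ⟦ ¬? (leads? f (other e u) u) ⟧)
          ≈⟨ +-congˡ (*-congˡ (graft-forest (RootedAt.isRoot at (here refl)) e)) ⟨
        incident u e * (φ * ⟦ leads? f (other e u) u ⟧) + incident u e * ⟦ forest? (f [ u ]≔ just e) ⟧ ∎))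
        (∑-+ (allFin m) _ _)
        where φ = ⟦ forest? f ⟧

    -- `inflow v` counts the edges from `v` into the tree of `u`. These are exactly the edges by
    -- which `v` can be hung so that a forest rooted at `u` alone results.
    balance-sink : inflow v ≈ forests (u ∷ [])
    balance-sink = begin
      inflow v
        ≈⟨ inflow-𝔼 v ⟩
      𝔼 (rooted (u ∷ v ∷ [])) (λ f → ∑ (allFin m) λ e → incident v e * (⟦ forest? f ⟧ * ⟦ leads? f (other e v) u ⟧))
        ≈⟨ 𝔼-rooted-cong (u ∷ v ∷ []) (λ f at → ∑-cong (allFin m) λ e → *-congˡ (pointwise f at e)) ⟩
      𝔼 (rooted (u ∷ v ∷ [])) (λ f → ∑ (allFin m) λ e → incident v e * ⟦ forest? (f [ v ]≔ just e) ⟧)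
        ≈⟨ 𝔼-congʷ _ (rooted-cong (u ∷ v ∷ []) (v ∷ u ∷ []) exchange exchange) ⟩
      𝔼 (rooted (v ∷ u ∷ [])) (λ f → ∑ (allFin m) λ e → incident v e * ⟦ forest? (f [ v ]≔ just e) ⟧)
        ≈⟨ 𝔼-rooted-split (u ∷ []) v (λ { (here eq) → u≢v (sym eq) }) (λ f → ⟦ forest? f ⟧) ⟨
      forests (u ∷ []) ∎
      where
      exchange : ∀ {x y z : Fin n} → z ∈ˡ (x ∷ y ∷ []) → z ∈ˡ (y ∷ x ∷ [])
      exchange (here eq)         = there (here eq)
      exchange (there (here eq)) = here eq
      pointwise : ∀ f → RootedAt (u ∷ v ∷ []) f → ∀ e →
        ⟦ forest? f ⟧ * ⟦ leads? f (other e v) u ⟧ ≈ ⟦ forest? (f [ v ]≔ just e) ⟧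
      pointwise f at e = ≈-trans
        (⟦⟧-guard (forest? f) λ fst → ⟦⟧-cong (leads? f (other e v) u) (¬? (leads? f (other e v) v))
          (λ l k → u≢v (leads-unique l k))
          (λ ¬l → elim ¬l (fst (other e v))))
        (≈-sym (graft-forest (isRoot (there (here refl))) e))
        where
        open RootedAt at
        elim : ¬ Leads f (other e v) v → ∃ (Leads f (other e v)) → Leads f (other e v) u
        elim ¬l (b , l) with root∈ (leads⇒root l)
        ... | here refl         = l
        ... | there (here refl) = contradiction l ¬l

    -- Both sides remove the edge e′ owned by w from a forest h⁺ and add one more edge e at w. With
    -- A, B, C the total conductance at w towards the trees of u, v and w in the remaining forest h,
    -- the identity reads (A + B + C) A = A (A + B) + C A.
    balance-inner : ∀ w → w ≢ u → w ≢ v → degree w * ψ w ≈ inflow w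
    balance-inner w w≢u w≢v = begin
      degree w * ψ w
        ≈⟨ *-congˡ (split (λ f → ⟦ forest? f ⟧ * ⟦ leads? f w u ⟧)) ⟩
      degree w * 𝔼 (rooted R) (λ h → ∑ E λ e' → N e' * (⟦ forest? (h [ w ]≔ just e') ⟧ * ⟦ leads? (h [ w ]≔ just e') w u ⟧))
        ≈⟨ degree-𝔼 w R _ ⟩
      𝔼 (rooted R) (λ h → ∑ E λ e → N e * ∑ E λ e' → N e' * (⟦ forest? (h [ w ]≔ just e') ⟧ * ⟦ leads? (h [ w ]≔ just e') w u ⟧))
        ≈⟨ 𝔼-rooted-cong R pointwise ⟩
      𝔼 (rooted R) (λ h → ∑ E λ e' → N e' * ∑ E λ e → N e * (⟦ forest? (h [ w ]≔ just e') ⟧ * ⟦ leads? (h [ w ]≔ just e') (other e w) u ⟧))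
        ≈⟨ split (λ f → ∑ E λ e → N e * (⟦ forest? f ⟧ * ⟦ leads? f (other e w) u ⟧)) ⟨
      𝔼 (rooted (u ∷ v ∷ [])) (λ f → ∑ E λ e → N e * (⟦ forest? f ⟧ * ⟦ leads? f (other e w) u ⟧))
        ≈⟨ inflow-𝔼 w ⟨
      inflow w ∎
      where
      R = w ∷ u ∷ v ∷ []
      E = allFin m
      N = incident w
      split : (g : Map → Carrier) →
        𝔼 (rooted (u ∷ v ∷ [])) g ≈ 𝔼 (rooted R) (λ h → ∑ E λ e → N e * g (h [ w ]≔ just e))
      split = 𝔼-rooted-split (u ∷ v ∷ []) w λ { (here eq) → w≢u eq ; (there (here eq)) → w≢v eq }

      module _ (h : Map) (rt : RootedAt R h) where
        open RootedAt rt
        w-root = isRoot (here refl)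
        φ = ⟦ forest? h ⟧
        towards : Fin n → Fin m → Carrier
        towards x e = ⟦ leads? h (other e w) x ⟧

        one : Forest h → ∀ e → 1# ≈ towards u e + towards v e + towards w e
        one fst e = ≈-sym (begin
          towards u e + towards v e + towards w e
            ≈⟨ +-congʳ (⟦⟧-⊎ (leads? h o u) (leads? h o v) (λ (k , l) → u≢v (leads-unique k l))) ⟨
          ⟦ leads? h o u ⊎-dec leads? h o v ⟧ + towards w e
            ≈⟨ ⟦⟧-⊎ (leads? h o u ⊎-dec leads? h o v) (leads? h o w)
                 (λ { (inj₁ k , l) → w≢u (leads-unique l k) ; (inj₂ k , l) → w≢v (leads-unique l k) }) ⟨
          ⟦ (leads? h o u ⊎-dec leads? h o v) ⊎-dec leads? h o w ⟧
            ≈⟨ ⟦⟧-yes ((leads? h o u ⊎-dec leads? h o v) ⊎-dec leads? h o w) (somewhere (fst o)) ⟩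
          1# ∎)
          where
          o = other e w
          somewhere : ∃ (Leads h o) → (Leads h o u ⊎ Leads h o v) ⊎ Leads h o w
          somewhere (b , l) with root∈ (leads⇒root l)
          ... | here refl                 = inj₂ l
          ... | there (here refl)         = inj₁ (inj₁ l)
          ... | there (there (here refl)) = inj₁ (inj₂ l)

        owned : ∀ e' → ⟦ forest? (h [ w ]≔ just e') ⟧ * ⟦ leads? (h [ w ]≔ just e') w u ⟧ ≈ φ * towards u e'
        owned e' = begin
          _ ≈⟨ ⟦⟧-× (forest? h⁺) (leads? h⁺ w u) ⟨
          _ ≈⟨ ⟦⟧-cong (forest? h⁺ ×-dec leads? h⁺ w u) (forest? h ×-dec leads? h (other e' w) u)
                 (λ (fst , l) → forest⁻ fst , to (lower l))
                 (λ (fst , l) → forest⁺ fst (λ k → w≢u (leads-unique k l)) ,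
                                through (halt w-root) (lift (w≢u ∘ sym) l)) ⟩
          _ ≈⟨ ⟦⟧-× (forest? h) (leads? h (other e' w) u) ⟩
          _ ∎
          where
          open Graft h w-root e'
          to : Leads h w u ⊎ (Leads h w w × Leads h (other e' w) u) → Leads h (other e' w) u
          to (inj₁ l)       = contradiction (leads-unique (halt w-root) l) w≢u
          to (inj₂ (_ , l)) = l

        -- Either the other end of `e` was below `u` before the graft, and then `e'` may lead into
        -- the tree of `u` or of `v`; or it was below `w`, and the graft by `e'` brought it below
        -- `u`.
        met : ∀ e' e → ⟦ forest? (h [ w ]≔ just e') ⟧ * ⟦ leads? (h [ w ]≔ just e') (other e w) u ⟧ ≈
              φ * (towards u e * (towards u e' + towards v e') + towards w e * towards u e')
        met e' e = begin
          _ ≈⟨ ⟦⟧-× (forest? h⁺) (leads? h⁺ o u) ⟨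
          _ ≈⟨ ⟦⟧-cong (forest? h⁺ ×-dec leads? h⁺ o u) (forest? h ×-dec (P? ⊎-dec Q?))
                 (λ (fst , l) → forest⁻ fst , to fst (lower l) (forest⁻ fst o')) from ⟩
          _ ≈⟨ ⟦⟧-× (forest? h) (P? ⊎-dec Q?) ⟩
          _ ≈⟨ *-congˡ (⟦⟧-⊎ P? Q? (λ ((k , _) , (l , _)) → w≢u (leads-unique l k))) ⟩
          _ ≈⟨ *-congˡ (+-cong (≈-trans (⟦⟧-× (leads? h o u) S?)
                 (*-congˡ (⟦⟧-⊎ (leads? h o' u) (leads? h o' v) (λ (k , l) → u≢v (leads-unique k l)))))
                 (⟦⟧-× (leads? h o w) (leads? h o' u))) ⟩
          _ ∎
          where
          open Graft h w-root e'
          o  = other e w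
          o' = other e' w
          S? = leads? h o' u ⊎-dec leads? h o' v
          P? = leads? h o u ×-dec S?
          Q? = leads? h o w ×-dec leads? h o' u
          to : Forest h⁺ → Leads h o u ⊎ (Leads h o w × Leads h o' u) → ∃ (Leads h o') →
               (Leads h o u × (Leads h o' u ⊎ Leads h o' v)) ⊎ (Leads h o w × Leads h o' u)
          to fst (inj₂ q) _ = inj₂ q
          to fst (inj₁ l) (b , k) with root∈ (leads⇒root k)
          ... | here refl                 = contradiction k (forest⁻-cut fst)
          ... | there (here refl)         = inj₁ (l , inj₁ k)
          ... | there (there (here refl)) = inj₁ (l , inj₂ k)
          from : Forest h × ((Leads h o u × (Leads h o' u ⊎ Leads h o' v)) ⊎ (Leads h o w × Leads h o' u)) →
                 Forest h⁺ × Leads h⁺ o u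
          from (fst , inj₁ (l , inj₁ k)) = forest⁺ fst (λ i → w≢u (leads-unique i k)) , lift (w≢u ∘ sym) l
          from (fst , inj₁ (l , inj₂ k)) = forest⁺ fst (λ i → w≢v (leads-unique i k)) , lift (w≢u ∘ sym) l
          from (fst , inj₂ (l , k))      = forest⁺ fst (λ i → w≢u (leads-unique i k)) ,
                                           through l (lift (w≢u ∘ sym) k)

        double : (Fin m → Fin m → Carrier) → Carrier
        double t = ∑ E λ e → ∑ E λ e' → N e * (N e' * (φ * t e e'))

        double-+ : ∀ s t → double (λ e e' → s e e' + t e e') ≈ double s + double t
        double-+ s t = ≈-trans (∑-cong E λ e → ≈-trans (∑-cong E λ e' →
          solve 5 (λ p q r x y → p :* (q :* (r :* (x :+ y))) := p :* (q :* (r :* x)) :+ p :* (q :* (r :* y)))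
            ≈-refl _ _ _ _ _) (∑-+ E _ _)) (∑-+ E _ _)

        double-swap : ∀ t → double t ≈ double (λ e e' → t e' e)
        double-swap t = ≈-trans (∑-swap E E _) (∑-cong E λ e → ∑-cong E λ e' →
          x∙yz≈y∙xz _ _ _)

        pointwise : (∑ E λ e → N e * ∑ E λ e' → N e' * (⟦ forest? (h [ w ]≔ just e') ⟧ * ⟦ leads? (h [ w ]≔ just e') w u ⟧)) ≈
          (∑ E λ e' → N e' * ∑ E λ e → N e * (⟦ forest? (h [ w ]≔ just e') ⟧ * ⟦ leads? (h [ w ]≔ just e') (other e w) u ⟧))
        pointwise = begin
          _ ≈⟨ ∑-cong E (λ e → ≈-sym (∑-*ˡ (N e) E _)) ⟩
          _ ≈⟨ ∑-cong E (λ e → ∑-cong E λ e' → *-congˡ (*-congˡ (≈-trans (owned e')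
                 (⟦⟧-guard (forest? h) λ fst → begin
                    towards u e'       ≈⟨ *-identityˡ _ ⟨
                    1# * towards u e'  ≈⟨ *-congʳ (one fst e) ⟩
                    (towards u e + towards v e + towards w e) * towards u e'
                      ≈⟨ solve 4 (λ x y z t → (x :+ y :+ z) :* t := (x :* t :+ z :* t) :+ t :* y) ≈-refl _ _ _ _ ⟩
                    (towards u e * towards u e' + towards w e * towards u e') + towards u e' * towards v e ∎)))) ⟩
          double (λ e e' → (towards u e * towards u e' + towards w e * towards u e') + towards u e' * towards v e)
            ≈⟨ double-+ _ _ ⟩
          _ + double (λ e e' → towards u e' * towards v e)
            -- In the term A B the two edges exchange their roles. For a single pair of edges the
            -- two sides differ; only the double sums agree.
            ≈⟨ +-congˡ (double-swap _) ⟩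
          _ + double (λ e e' → towards u e * towards v e')
            ≈⟨ double-+ _ _ ⟨
          double (λ e e' → (towards u e * towards u e' + towards w e * towards u e') + towards u e * towards v e')
            ≈⟨ ∑-cong E (λ e → ∑-cong E λ e' → *-congˡ (*-congˡ (≈-trans (*-congˡ
                 (solve 5 (λ x y z p q → (x :* p :+ z :* p) :+ x :* q := x :* (p :+ q) :+ z :* p) ≈-refl _ (towards v e) _ _ _))
                 (≈-sym (met e' e))))) ⟩
          (∑ E λ e → ∑ E λ e' → N e * (N e' * (⟦ forest? (h [ w ]≔ just e') ⟧ * ⟦ leads? (h [ w ]≔ just e') (other e w) u ⟧)))
            ≈⟨ ∑-swap E E _ ⟩
          (∑ E λ e' → ∑ E λ e → N e * (N e' * (⟦ forest? (h [ w ]≔ just e') ⟧ * ⟦ leads? (h [ w ]≔ just e') (other e w) u ⟧)))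
            ≈⟨ ∑-cong E (λ e' → ≈-trans (∑-cong E λ e →
                 x∙yz≈y∙xz _ _ _) (∑-*ˡ (N e') E _)) ⟩
          _ ∎

-- Current conservation and reciprocity

module Kirchhoff {a ℓ₁ ℓ₂ ℓ₃ : Level} (F : OrderedField a ℓ₁ ℓ₂ ℓ₃) {n m : ℕ} (G : Graph n m)
                 (c : Fin m → OrderedField.Carrier F) where
  open Sums F
  open Graph G
  open Parents G
  open Network F G c
  open RingProperties (CommutativeRing.ring ring) using (x[y-z]≈xy-xz; [y-z]x≈yx-zx)

  ∑-minus : ∀ {b} {A : Set b} (xs : List A) (f g : A → Carrier) → ∑ xs (λ y → f y - g y) ≈ ∑ xs f - ∑ xs g
  ∑-minus xs f g = ≈-trans (∑-+ xs f (λ y → - g y)) (+-congˡ (∑-neg xs g))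

  minus-cong : ∀ {x x' y y'} → x ≈ x' → y ≈ y' → x - y ≈ x' - y'
  minus-cong p q = +-cong p (-‿cong q)

  netOutflow-≈ : ∀ (φ : Fin n → Carrier) w → netOutflow G c φ w ≈
    ∑ (allFin m) λ e → ⟦ src e Fin.≟ w ⟧ * current G c φ e - ⟦ tgt e Fin.≟ w ⟧ * current G c φ e
  netOutflow-≈ φ w = ≈-trans
    (minus-cong (∑-filter (λ e → src e Fin.≟ w) (allFin m) _) (∑-filter (λ e → tgt e Fin.≟ w) (allFin m) _))
    (≈-sym (∑-minus (allFin m) _ _))

  -- Summation by parts: the current through an edge is counted positively at one end and negatively
  -- at the other. The right side is the Dirichlet form, symmetric in `φ` and `ψ`.
  ∑-netOutflow : ∀ (φ ψ : Fin n → Carrier) → ∑ (allFin n) (λ w → φ w * netOutflow G c ψ w) ≈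
                         ∑ (allFin m) (λ e → c e * ((φ (src e) - φ (tgt e)) * (ψ (src e) - ψ (tgt e))))
  ∑-netOutflow φ ψ = begin
    ∑ (allFin n) (λ w → φ w * netOutflow G c ψ w)
      ≈⟨ ∑-cong (allFin n) (λ w → ≈-trans (*-congˡ (netOutflow-≈ ψ w)) (≈-sym (∑-*ˡ (φ w) (allFin m) _))) ⟩
    ∑ (allFin n) (λ w → ∑ (allFin m) λ e → φ w * (⟦ src e Fin.≟ w ⟧ * I e - ⟦ tgt e Fin.≟ w ⟧ * I e))
      ≈⟨ ∑-swap (allFin n) (allFin m) _ ⟩
    ∑ (allFin m) (λ e → ∑ (allFin n) λ w → φ w * (⟦ src e Fin.≟ w ⟧ * I e - ⟦ tgt e Fin.≟ w ⟧ * I e))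
      ≈⟨ ∑-cong (allFin m) per-edge ⟩
    ∑ (allFin m) (λ e → c e * ((φ (src e) - φ (tgt e)) * (ψ (src e) - ψ (tgt e)))) ∎
    where
    I = current G c ψ
    per-edge : ∀ e → _
    per-edge e = begin
      ∑ (allFin n) (λ w → φ w * (⟦ src e Fin.≟ w ⟧ * I e - ⟦ tgt e Fin.≟ w ⟧ * I e))
        ≈⟨ ∑-cong (allFin n) (λ w → ≈-trans (x[y-z]≈xy-xz _ _ _) (minus-cong
             (x∙yz≈y∙xz _ _ _)
             (x∙yz≈y∙xz _ _ _))) ⟩
      ∑ (allFin n) (λ w → ⟦ src e Fin.≟ w ⟧ * (φ w * I e) - ⟦ tgt e Fin.≟ w ⟧ * (φ w * I e))
        ≈⟨ ∑-minus (allFin n) _ _ ⟩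
      _ - _
        ≈⟨ minus-cong (∑-δ (src e) (λ w → φ w * I e)) (∑-δ (tgt e) (λ w → φ w * I e)) ⟩
      φ (src e) * I e - φ (tgt e) * I e
        ≈⟨ [y-z]x≈yx-zx _ _ _ ⟨
      (φ (src e) - φ (tgt e)) * (c e * (ψ (src e) - ψ (tgt e)))
        ≈⟨ x∙yz≈y∙xz _ _ _ ⟩
      c e * ((φ (src e) - φ (tgt e)) * (ψ (src e) - ψ (tgt e))) ∎

  reciprocity : ∀ (φ ψ : Fin n → Carrier) → ∑ (allFin n) (λ w → φ w * netOutflow G c ψ w) ≈ ∑ (allFin n) (λ w → ψ w * netOutflow G c φ w)
  reciprocity φ ψ = ≈-trans (∑-netOutflow φ ψ) (≈-trans
    (∑-cong (allFin m) (λ e → *-congˡ (*-comm _ _))) (≈-sym (∑-netOutflow ψ φ)))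

  -- The orientation of the edges drops out: for an edge with target `w`, both the current and the
  -- sign with which it is counted are reversed.
  netOutflow-laplacian : ∀ (ψ : Fin n → Carrier) w → netOutflow G c ψ w ≈
    degree w * ψ w - ∑ (allFin m) (λ e → incident w e * ψ (other e w))
  netOutflow-laplacian ψ w = begin
    netOutflow G c ψ w
      ≈⟨ netOutflow-≈ ψ w ⟩
    ∑ (allFin m) (λ e → ⟦ src e Fin.≟ w ⟧ * I e - ⟦ tgt e Fin.≟ w ⟧ * I e)
      ≈⟨ ∑-cong (allFin m) per-edge ⟩
    ∑ (allFin m) (λ e → incident w e * ψ w - incident w e * ψ (other e w))
      ≈⟨ ∑-minus (allFin m) _ _ ⟩
    ∑ (allFin m) (λ e → incident w e * ψ w) - ∑ (allFin m) (λ e → incident w e * ψ (other e w))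
      ≈⟨ +-congʳ (∑-*ʳ (ψ w) (allFin m) (incident w)) ⟩
    degree w * ψ w - ∑ (allFin m) (λ e → incident w e * ψ (other e w)) ∎
    where
    I = current G c ψ
    one-* : ∀ {p} {P : Set p} (P? : Dec P) {x} → P → ⟦ P? ⟧ * x ≈ x
    one-* P? p = ≈-trans (*-congʳ (⟦⟧-yes P? p)) (*-identityˡ _)
    zero-* : ∀ {p} {P : Set p} (P? : Dec P) {x} → ¬ P → ⟦ P? ⟧ * x ≈ 0#
    zero-* P? ¬p = ≈-trans (*-congʳ (⟦⟧-no P? ¬p)) (zeroˡ _)
    per-edge : ∀ e → ⟦ src e Fin.≟ w ⟧ * I e - ⟦ tgt e Fin.≟ w ⟧ * I e ≈ incident w e * ψ w - incident w e * ψ (other e w)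
    per-edge e with w ∈ₑ? e
    ... | no w∉e = begin
      _ ≈⟨ minus-cong (zero-* (src e Fin.≟ w) (w∉e ∘ inj₁)) (zero-* (tgt e Fin.≟ w) (w∉e ∘ inj₂)) ⟩
      0# - 0#
        ≈⟨ minus-cong (≈-trans (*-congʳ (incident-zero w∉e)) (zeroˡ _)) (≈-trans (*-congʳ (incident-zero w∉e)) (zeroˡ _)) ⟨
      _ ∎
    ... | yes w∈@(inj₁ refl) = begin
      _ ≈⟨ minus-cong (one-* (src e Fin.≟ w) refl) (zero-* (tgt e Fin.≟ w) (loopless e ∘ sym)) ⟩
      I e - 0#                       ≈⟨ ≈-trans (+-congˡ -0#≈0#) (+-identityʳ _) ⟩
      c e * (ψ (src e) - ψ (tgt e))  ≈⟨ x[y-z]≈xy-xz _ _ _ ⟩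
      c e * ψ (src e) - c e * ψ (tgt e)
        ≈⟨ minus-cong (*-congʳ (one-* (w ∈ₑ? e) w∈))
             (*-cong (one-* (w ∈ₑ? e) w∈) (reflexive (cong ψ (joins⇒other (inj₁ (refl , refl)))))) ⟨
      _ ∎
    ... | yes w∈@(inj₂ refl) = begin
      _ ≈⟨ minus-cong (zero-* (src e Fin.≟ w) (loopless e)) (one-* (tgt e Fin.≟ w) refl) ⟩
      0# - I e                               ≈⟨ +-identityˡ _ ⟩
      - (c e * (ψ (src e) - ψ (tgt e)))      ≈⟨ -‿cong (x[y-z]≈xy-xz _ _ _) ⟩
      - (c e * ψ (src e) - c e * ψ (tgt e))  ≈⟨ -‿+-comm _ _ ⟨
      - (c e * ψ (src e)) + - - (c e * ψ (tgt e)) ≈⟨ +-comm _ _ ⟩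
      - - (c e * ψ (tgt e)) - c e * ψ (src e) ≈⟨ +-congʳ (-‿involutive _) ⟩
      c e * ψ (tgt e) - c e * ψ (src e)
        ≈⟨ minus-cong (*-congʳ (one-* (w ∈ₑ? e) w∈))
             (*-cong (one-* (w ∈ₑ? e) w∈) (reflexive (cong ψ (joins⇒other (inj₂ (refl , refl)))))) ⟨
      _ ∎

  module _ {τ : Carrier} (forests-τ : ∀ u → forests (u ∷ []) ≈ τ) {u v : Fin n} (u≢v : u ≢ v) where
    open Potential u v u≢v

    -- The outflow at `u` is the weight of the trees rooted at `v`, and the inflow at `v` that of
    -- the trees rooted at `u`; `forests-τ` makes the two equal.
    ψ-outflow : ∀ w → netOutflow G c ψ w ≈ τ * (δ u w - δ v w)
    ψ-outflow w = ≈-trans (netOutflow-laplacian ψ w) (cases (u Fin.≟ w) (v Fin.≟ w))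
      where
      cancel : ∀ {x y} → x ≈ y → x - y ≈ 0#
      cancel {x} {y} x≈y = ≈-trans (+-congʳ x≈y) (-‿inverseʳ y)
      cases : (P : Dec (u ≡ w)) (Q : Dec (v ≡ w)) → degree w * ψ w - inflow w ≈ τ * (⟦ P ⟧ - ⟦ Q ⟧)
      cases (yes refl) (yes q) = contradiction (sym q) u≢v
      cases (yes refl) (no _)  = begin
        degree u * ψ u - inflow u                   ≈⟨ +-congʳ balance-source ⟩
        (inflow u + forests (v ∷ [])) - inflow u    ≈⟨ +-congʳ (+-comm _ _) ⟩
        (forests (v ∷ []) + inflow u) - inflow u    ≈⟨ +-assoc _ _ _ ⟩
        forests (v ∷ []) + (inflow u - inflow u)    ≈⟨ +-cong (forests-τ v) (-‿inverseʳ _) ⟩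
        τ + 0#                                      ≈⟨ +-identityʳ _ ⟩
        τ                                           ≈⟨ *-identityʳ _ ⟨
        τ * 1#                                      ≈⟨ *-congˡ (≈-trans (+-congˡ -0#≈0#) (+-identityʳ _)) ⟨
        τ * (1# - 0#)                               ∎
      cases (no _) (yes refl) = begin
        degree v * ψ v - inflow v  ≈⟨ minus-cong (≈-trans (*-congˡ ψ-sink) (zeroʳ _)) (≈-trans balance-sink (forests-τ u)) ⟩
        0# - τ                     ≈⟨ +-identityˡ _ ⟩
        - τ                        ≈⟨ -‿cong (*-identityʳ _) ⟨
        - (τ * 1#)                 ≈⟨ -‿distribʳ-* _ _ ⟩
        τ * - 1#                   ≈⟨ *-congˡ (+-identityˡ _) ⟨
        τ * (0# - 1#)              ∎
      cases (no p) (no q) = begin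
        degree w * ψ w - inflow w  ≈⟨ cancel (balance-inner w (p ∘ sym) (q ∘ sym)) ⟩
        0#                         ≈⟨ zeroʳ _ ⟨
        τ * 0#                     ≈⟨ *-congˡ (cancel ≈-refl) ⟨
        τ * (0# - 0#)              ∎

    private
      ∑-dipole : ∀ (χ : Fin n → Carrier) → ∑ (allFin n) (λ w → χ w * (δ u w - δ v w)) ≈ χ u - χ v
      ∑-dipole χ = begin
        ∑ (allFin n) (λ w → χ w * (δ u w - δ v w))
          ≈⟨ ∑-cong (allFin n) (λ w → ≈-trans (*-comm _ _) ([y-z]x≈yx-zx _ _ _)) ⟩
        ∑ (allFin n) (λ w → ⟦ u Fin.≟ w ⟧ * χ w - ⟦ v Fin.≟ w ⟧ * χ w)
          ≈⟨ ∑-minus (allFin n) _ _ ⟩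
        _ - _ ≈⟨ minus-cong (∑-δ u χ) (∑-δ v χ) ⟩
        χ u - χ v ∎

    -- The hypothesis supplies some potential `φ`, of which only the outflow is known. Pairing it
    -- with `ψ` both ways gives τ (φ u - φ v) on one side and ψ u - ψ v on the other.
    resistance-forests : ∀ {ρ} → IsEffectiveResistance G c u v ρ → τ * ρ ≈ forests (u ∷ v ∷ [])
    resistance-forests {ρ} (φ , φ-outflow , ρ≈) = begin
      τ * ρ
        ≈⟨ *-congˡ (≈-trans ρ≈ (≈-sym (∑-dipole φ))) ⟩
      τ * ∑ (allFin n) (λ w → φ w * (δ u w - δ v w))
        ≈⟨ ∑-*ˡ τ (allFin n) _ ⟨
      ∑ (allFin n) (λ w → τ * (φ w * (δ u w - δ v w)))
        ≈⟨ ∑-cong (allFin n) (λ w → ≈-trans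
             (x∙yz≈y∙xz _ _ _) (*-congˡ (≈-sym (ψ-outflow w)))) ⟩
      ∑ (allFin n) (λ w → φ w * netOutflow G c ψ w)
        ≈⟨ reciprocity φ ψ ⟩
      ∑ (allFin n) (λ w → ψ w * netOutflow G c φ w)
        ≈⟨ ∑-cong (allFin n) (λ w → *-congˡ (φ-outflow w)) ⟩
      ∑ (allFin n) (λ w → ψ w * (δ u w - δ v w))
        ≈⟨ ∑-dipole ψ ⟩
      ψ u - ψ v
        ≈⟨ minus-cong ψ-source ψ-sink ⟩
      forests (u ∷ v ∷ []) - 0#
        ≈⟨ ≈-trans (+-congˡ -0#≈0#) (+-identityʳ _) ⟩
      forests (u ∷ v ∷ []) ∎

-- Oriented cycles

module _ {a b} {A : Set a} {B : Set b} where

  unique-map-on : (g : A → B) {xs : List A} → Unique xs →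
                  (∀ {x y} → x ∈ˡ xs → y ∈ˡ xs → g x ≡ g y → x ≡ y) → Unique (map g xs)
  unique-map-on g []        inj = []
  unique-map-on g (x∉ ∷ xs!) inj =
    All.map⁺ (All.tabulate λ y∈ eq → All.lookup x∉ y∈ (inj (here refl) (there y∈) eq)) ∷
    unique-map-on g xs! (λ x∈ y∈ → inj (there x∈) (there y∈))

  unique-map-injective : (g : A → B) {xs : List A} → Unique (map g xs) →
                         ∀ {x y} → x ∈ˡ xs → y ∈ˡ xs → g x ≡ g y → x ≡ y
  unique-map-injective g (x∉ ∷ u) (here refl) (here refl) eq = refl
  unique-map-injective g (x∉ ∷ u) (here refl) (there y∈)  eq = contradiction eq (All.lookup x∉ (∈-map⁺ g y∈))
  unique-map-injective g (x∉ ∷ u) (there x∈)  (here refl) eq = contradiction (sym eq) (All.lookup x∉ (∈-map⁺ g x∈))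
  unique-map-injective g (x∉ ∷ u) (there x∈)  (there y∈)  eq = unique-map-injective g u x∈ y∈ eq

lookup-unique : ∀ {a} {A : Set a} {xs : List A} → Unique xs → ∀ {i j} → List.lookup xs i ≡ List.lookup xs j → i ≡ j
lookup-unique (_ ∷ _)  {zero}  {zero}  _  = refl
lookup-unique (x∉ ∷ _) {zero}  {suc j} eq = contradiction eq (All.lookup x∉ (∈-lookup j))
lookup-unique (x∉ ∷ _) {suc i} {zero}  eq = contradiction (sym eq) (All.lookup x∉ (∈-lookup i))
lookup-unique (_ ∷ u)  {suc i} {suc j} eq = cong suc (lookup-unique u eq)

unique⇒length≤n : ∀ {n} {xs : List (Fin n)} → Unique xs → length xs ≤ n
unique⇒length≤n u = Fin.injective⇒≤ (lookup-unique u)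

module _ {m : ℕ} {p} {P : Fin m → Set p} (P? : Decidable P) where

  subsetOf : Subset m
  subsetOf = Vec.tabulate (does ∘ P?)

  ∈-subsetOf⁺ : ∀ {e} → P e → e ∈ subsetOf
  ∈-subsetOf⁺ {e} pe = Vec.lookup⇒[]= e subsetOf (trans (Vec.lookup∘tabulate (does ∘ P?) e) (holds (P? e)))
    where
    holds : (d : Dec (P e)) → does d ≡ true
    holds (yes _) = refl
    holds (no ¬p) = contradiction pe ¬p

  ∈-subsetOf⁻ : ∀ {e} → e ∈ subsetOf → P e
  ∈-subsetOf⁻ {e} e∈ = holds (P? e) (trans (sym (Vec.lookup∘tabulate (does ∘ P?) e)) (Vec.[]=⇒lookup e∈))
    where
    holds : (d : Dec (P e)) → does d ≡ true → P e
    holds (yes pe) _ = pe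

module _ {a} {A : Set a} where

  -- The arcs of a walk from `v` through `ws` to `z`. With `z` equal to `v` these are the
  -- `cyclicPairs` of `v ∷ ws`; the free end point is what makes induction over `ws` possible.
  chain : A → List A → A → List (A × A)
  chain v ws z = zip (v ∷ ws) (ws ∷ʳ z)

  chain-proj₁ : ∀ v ws z → map proj₁ (chain v ws z) ≡ v ∷ ws
  chain-proj₁ v []       z = refl
  chain-proj₁ v (w ∷ ws) z = cong (v ∷_) (chain-proj₁ w ws z)

  chain-proj₂ : ∀ v ws z → map proj₂ (chain v ws z) ≡ ws ∷ʳ z
  chain-proj₂ v []       z = refl
  chain-proj₂ v (w ∷ ws) z = cong (w ∷_) (chain-proj₂ w ws z)

  module _ {p} (P : A → Set p) where

    chain-forward : ∀ v ws {z} → (∀ {a b} → (a , b) ∈ˡ chain v ws z → P a → P b) → P v → All P (v ∷ ws)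
    chain-forward v []       cl p = p ∷ []
    chain-forward v (w ∷ ws) cl p = p ∷ chain-forward w ws (cl ∘ there) (cl (here refl) p)

    -- On a closed walk, where `z` is `v`, this brings `P` from any vertex to the starting point,
    -- and `chain-forward` carries it on to all vertices. The next two lemmas do the same in the
    -- other direction.
    chain-end : ∀ v ws {z} → (∀ {a b} → (a , b) ∈ˡ chain v ws z → P a → P b) → ∀ {x} → x ∈ˡ (v ∷ ws) → P x → P z
    chain-end v []       cl (here refl) p = cl (here refl) p
    chain-end v (w ∷ ws) cl (here refl) p = chain-end w ws (cl ∘ there) (here refl) (cl (here refl) p)
    chain-end v (w ∷ ws) cl (there x∈)  p = chain-end w ws (cl ∘ there) x∈ p

    chain-backward : ∀ v ws {z} → (∀ {a b} → (a , b) ∈ˡ chain v ws z → P b → P a) → P z → All P (v ∷ ws)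
    chain-backward v []       cl p = cl (here refl) p ∷ []
    chain-backward v (w ∷ ws) cl p with chain-backward w ws (cl ∘ there) p
    ... | q ∷ qs = cl (here refl) q ∷ q ∷ qs

    chain-start : ∀ v ws {z} → (∀ {a b} → (a , b) ∈ˡ chain v ws z → P b → P a) → ∀ {x} → x ∈ˡ (v ∷ ws) → P x → P v
    chain-start v ws       cl (here refl) p = p
    chain-start v (w ∷ ws) cl (there x∈)  p = cl (here refl) (chain-start w ws (cl ∘ there) x∈ p)

module Circuits {n m : ℕ} (G : Graph n m) where
  open Graph G
  open Parents G

  -- A cycle together with one of its two senses of rotation.
  record Circuit (D : Subset m) : Set₁ where
    field
      arcs         : List (Fin n × Fin n)
      arcs-unique  : Unique arcs
      next-unique  : ∀ {a b b'} → (a , b) ∈ˡ arcs → (a , b') ∈ˡ arcs → b ≡ b'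
      prev-unique  : ∀ {a a' b} → (a , b) ∈ˡ arcs → (a' , b) ∈ˡ arcs → a ≡ a'
      next         : ∀ {a b} → (a , b) ∈ˡ arcs → ∃ λ c → (b , c) ∈ˡ arcs
      prev         : ∀ {a b} → (a , b) ∈ˡ arcs → ∃ λ c → (c , a) ∈ˡ arcs
      asymmetric   : ∀ {a b} → (a , b) ∈ˡ arcs → ¬ (b , a) ∈ˡ arcs
      adjacent     : ∀ {a b} → (a , b) ∈ˡ arcs → Adjacent D a b
      arcOf        : ∀ {e} → e ∈ D → ∃₂ λ a b → (a , b) ∈ˡ arcs × Joins e a b
      start        : ∃ (_∈ˡ arcs)
      -- Induction around the cycle. This field and the next are the ones that force the arcs to
      -- form a single cycle and not several.
      propagate    : (P : Fin n → Set) → (∀ {a b} → (a , b) ∈ˡ arcs → P a → P b) →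
                     ∀ {a b a' b'} → (a , b) ∈ˡ arcs → (a' , b') ∈ˡ arcs → P a → P a'
      propagate⁻   : (P : Fin n → Set) → (∀ {a b} → (a , b) ∈ˡ arcs → P b → P a) →
                     ∀ {a b a' b'} → (a , b) ∈ˡ arcs → (a' , b') ∈ˡ arcs → P a → P a'

    covered⇒arc : ∀ {v} → Covers D v → ∃ λ w → (v , w) ∈ˡ arcs
    covered⇒arc (e , e∈D , v∈e) with arcOf e∈D
    covered⇒arc (e , e∈D , inj₁ refl) | a , b , ab , inj₁ (refl , _) = b , ab
    covered⇒arc (e , e∈D , inj₁ refl) | a , b , ab , inj₂ (refl , _) = next ab
    covered⇒arc (e , e∈D , inj₂ refl) | a , b , ab , inj₁ (_ , refl) = next ab
    covered⇒arc (e , e∈D , inj₂ refl) | a , b , ab , inj₂ (_ , refl) = b , ab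

    arc⇒covered : ∀ {v w} → (v , w) ∈ˡ arcs → Covers D v
    arc⇒covered ab with adjacent ab
    ... | e , e∈D , j = e , e∈D , joins⇒∈ j

  module _ {D : Subset m} where

    reverse : Circuit D → Circuit D
    reverse C = record
      { arcs        = map swap arcs
      ; arcs-unique = unique-map-on swap arcs-unique (λ { _ _ refl → refl })
      ; next-unique = λ p q → prev-unique (to p) (to q)
      ; prev-unique = λ p q → next-unique (to p) (to q)
      ; next        = λ p → proj₁ (prev (to p)) , from (proj₂ (prev (to p)))
      ; prev        = λ p → proj₁ (next (to p)) , from (proj₂ (next (to p)))
      ; asymmetric  = λ p q → asymmetric (to p) (to q)
      ; adjacent    = λ p → sym-adjacent (adjacent (to p))
      ; arcOf       = λ e∈D → flip-arc (arcOf e∈D)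
      ; start       = _ , ∈-map⁺ swap (proj₂ start)
      ; propagate   = λ P cl p q → propagate⁻ P (cl ∘ from) (proj₂ (next (to p))) (proj₂ (next (to q)))
      ; propagate⁻  = λ P cl p q → propagate P (cl ∘ from) (proj₂ (next (to p))) (proj₂ (next (to q)))
      }
      where
      open Circuit C
      to : ∀ {a b} → (a , b) ∈ˡ map swap arcs → (b , a) ∈ˡ arcs
      to p with ∈-map⁻ swap p
      ... | _ , q , refl = q
      from : ∀ {a b} → (a , b) ∈ˡ arcs → (b , a) ∈ˡ map swap arcs
      from = ∈-map⁺ swap
      sym-adjacent : ∀ {a b} → Adjacent D a b → Adjacent D b a
      sym-adjacent (e , e∈D , j) = e , e∈D , joins-sym j
      flip-arc : ∀ {e} → (∃₂ λ a b → (a , b) ∈ˡ arcs × Joins e a b) → ∃₂ λ a b → (a , b) ∈ˡ map swap arcs × Joins e a b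
      flip-arc (a , b , ab , j) = b , a , from ab , joins-sym j

    circuit : IsCycle G D → Circuit D
    circuit ([] , () , _)
    circuit (v ∷ ws , len , vs! , adj , cov) = record
      { arcs        = arcs
      ; arcs-unique = Unique.map⁻ heads!
      ; next-unique = nxt
      ; prev-unique = λ p q → cong proj₁ (unique-map-injective proj₂ tails! p q refl)
      ; next        = λ p → ∈heads (Perm.∈-resp-↭ (↭-sym rotate) (∈tails p))
      ; prev        = λ p → ∈tails⁻ (Perm.∈-resp-↭ rotate (head∈ p))
      ; asymmetric  = asym
      ; adjacent    = All.lookup adj
      ; arcOf       = λ {e} e∈D → find (cov e e∈D)
      ; start       = _ , proj₂ (∈heads (here refl))
      ; propagate   = λ P cl p q Pa →
          All.lookup (chain-forward P v ws cl (chain-end P v ws cl (head∈ p) Pa)) (head∈ q)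
      ; propagate⁻  = λ P cl p q Pa →
          All.lookup (chain-backward P v ws cl (chain-start P v ws cl (head∈ p) Pa)) (head∈ q)
      }
      where
      arcs = chain v ws v
      rotate : (v ∷ ws) ↭ (ws ∷ʳ v)
      rotate = Perm.∷↭∷ʳ v ws
      heads! : Unique (map proj₁ arcs)
      heads! = subst Unique (sym (chain-proj₁ v ws v)) vs!
      tails! : Unique (map proj₂ arcs)
      tails! = subst Unique (sym (chain-proj₂ v ws v)) (PermSetoid.Unique-resp-↭ (≡.setoid (Fin n)) rotate' vs!)
        where rotate' = ↭⇒↭ₛ rotate
      head∈ : ∀ {a b} → (a , b) ∈ˡ arcs → a ∈ˡ (v ∷ ws)
      head∈ p = subst (_ ∈ˡ_) (chain-proj₁ v ws v) (∈-map⁺ proj₁ p)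
      ∈tails : ∀ {a b} → (a , b) ∈ˡ arcs → b ∈ˡ (ws ∷ʳ v)
      ∈tails p = subst (_ ∈ˡ_) (chain-proj₂ v ws v) (∈-map⁺ proj₂ p)
      ∈heads : ∀ {a} → a ∈ˡ (v ∷ ws) → ∃ λ b → (a , b) ∈ˡ arcs
      ∈heads a∈ with ∈-map⁻ proj₁ (subst (_ ∈ˡ_) (sym (chain-proj₁ v ws v)) a∈)
      ... | (_ , b) , p , refl = b , p
      ∈tails⁻ : ∀ {b} → b ∈ˡ (ws ∷ʳ v) → ∃ λ a → (a , b) ∈ˡ arcs
      ∈tails⁻ b∈ with ∈-map⁻ proj₂ (subst (_ ∈ˡ_) (sym (chain-proj₂ v ws v)) b∈)
      ... | (a , _) , p , refl = a , p
      nxt : ∀ {a b b'} → (a , b) ∈ˡ arcs → (a , b') ∈ˡ arcs → b ≡ b'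
      nxt p q = cong proj₂ (unique-map-injective proj₁ heads! p q refl)
      find : ∀ {e ps} → Any (uncurry (Joins e)) ps → ∃₂ λ a b → (a , b) ∈ˡ ps × Joins e a b
      find (here j)  = _ , _ , here refl , j
      find (there q) with find q
      ... | a , b , ab , j = a , b , there ab , j
      pigeon : ∀ {a b : Fin n} {vs} → 3 ≤ length vs → Unique vs → All (λ x → x ≡ a ⊎ x ≡ b) vs → ⊥
      pigeon {vs = _ ∷ []} (s≤s ())
      pigeon {vs = _ ∷ _ ∷ []} (s≤s (s≤s ()))
      pigeon {vs = x ∷ y ∷ z ∷ _} _ ((x≢y ∷ x≢z ∷ _) ∷ (y≢z ∷ _) ∷ _) (p ∷ q ∷ r ∷ _) = go p q r
        where
        go : ∀ {a b} → x ≡ a ⊎ x ≡ b → y ≡ a ⊎ y ≡ b → z ≡ a ⊎ z ≡ b → ⊥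
        go (inj₁ refl) (inj₁ refl) _           = x≢y refl
        go (inj₁ refl) (inj₂ refl) (inj₁ refl) = x≢z refl
        go (inj₁ refl) (inj₂ refl) (inj₂ refl) = y≢z refl
        go (inj₂ refl) (inj₂ refl) _           = x≢y refl
        go (inj₂ refl) (inj₁ refl) (inj₁ refl) = y≢z refl
        go (inj₂ refl) (inj₁ refl) (inj₂ refl) = x≢z refl
      -- If both arcs occurred, the set of `a` and `b` would be closed under successors and hence
      -- contain the whole cycle, which has at least three vertices.
      asym : ∀ {a b} → (a , b) ∈ˡ arcs → ¬ (b , a) ∈ˡ arcs
      asym {a} {b} ab ba = pigeon len vs!
        (chain-forward P v ws closed (chain-end P v ws closed (head∈ ab) (inj₁ refl)))
        where
        P = λ x → x ≡ a ⊎ x ≡ b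
        closed : ∀ {x y} → (x , y) ∈ˡ arcs → P x → P y
        closed xy (inj₁ refl) = inj₂ (nxt xy ab)
        closed xy (inj₂ refl) = inj₁ (nxt xy ba)

  -- No sense of rotation is mentioned, since inclusion-exclusion ranges over unoriented cycles;
  -- `Follows` tells the two senses apart.
  Rotates : Subset m → Map → Set
  Rotates D f = ∀ v → Covers D v → ∃ λ e → e ∈ D × lookup f v ≡ just e

  Follows : ∀ {D} → Circuit D → Map → Set
  Follows C f = ∀ {a b} → (a , b) ∈ˡ Circuit.arcs C → ∃ λ e → lookup f a ≡ just e × Joins e a b

  module _ {D : Subset m} {f : Map} (f-valid : Valid f) (f-inj : EdgeInjective f) where

    -- Each vertex owns the cycle's edge ahead of it or the one behind it. If a vertex owned the
    -- edge ahead and its successor the edge behind, both would own the same edge. So the choice of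
    -- one vertex spreads around the whole cycle.
    rotates⇒follows : (C : Circuit D) → Rotates D f → Follows C f ⊎ Follows (reverse C) f
    rotates⇒follows C rot = result (direction (proj₂ start))
      where
      open Circuit C
      Fwd Bwd : Fin n → Set
      Fwd a = ∃ λ b → (a , b) ∈ˡ arcs × ∃ λ e → lookup f a ≡ just e × Joins e a b
      Bwd a = ∃ λ b → (b , a) ∈ˡ arcs × ∃ λ e → lookup f a ≡ just e × Joins e a b

      direction : ∀ {a b} → (a , b) ∈ˡ arcs → Fwd a ⊎ Bwd a
      direction {a} ab with rot a (arc⇒covered ab)
      ... | e , e∈D , fa with arcOf e∈D | f-valid fa
      ... | p , q , pq , j | a∈e with a Fin.≟ p
      ...   | yes refl = inj₁ (q , pq , e , fa , j)
      ...   | no a≢p with a Fin.≟ q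
      ...     | yes refl = inj₂ (p , pq , e , fa , joins-sym j)
      ...     | no a≢q = ⊥-elim (absurd j a∈e)
        where
        absurd : Joins e p q → a ∈ₑ e → ⊥
        absurd (inj₁ (s , _)) (inj₁ r) = a≢p (trans (sym r) s)
        absurd (inj₁ (_ , t)) (inj₂ r) = a≢q (trans (sym r) t)
        absurd (inj₂ (s , _)) (inj₁ r) = a≢q (trans (sym r) s)
        absurd (inj₂ (_ , t)) (inj₂ r) = a≢p (trans (sym r) t)

      clash : ∀ {a b} → (a , b) ∈ˡ arcs → Fwd a → Bwd b → ⊥
      clash ab (_ , ab' , e , fa , j) (_ , a'b , e' , fb , j') with next-unique ab ab' | prev-unique ab a'b
      ... | refl | refl with joins-injective j (joins-sym j')
      ... | refl = joins-≢ j (owner-unique f f-inj fa fb)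

      fwd-closed : ∀ {a b} → (a , b) ∈ˡ arcs → Fwd a → Fwd b
      fwd-closed ab fwd with direction (proj₂ (next ab))
      ... | inj₁ p = p
      ... | inj₂ q = ⊥-elim (clash ab fwd q)

      bwd-closed : ∀ {a b} → (a , b) ∈ˡ arcs → Bwd b → Bwd a
      bwd-closed ab bwd with direction ab
      ... | inj₁ p = ⊥-elim (clash ab p bwd)
      ... | inj₂ q = q

      result : Fwd (proj₁ (proj₁ start)) ⊎ Bwd (proj₁ (proj₁ start)) → Follows C f ⊎ Follows (reverse C) f
      result (inj₁ p) = inj₁ λ ab → fwd ab (propagate Fwd fwd-closed (proj₂ start) ab p)
        where
        fwd : ∀ {a b} → (a , b) ∈ˡ arcs → Fwd a → ∃ λ e → lookup f a ≡ just e × Joins e a b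
        fwd ab (_ , ab' , x) with next-unique ab ab'
        ... | refl = x
      result (inj₂ p) = inj₂ λ ba → bwd (∈-map⁻ swap ba)
        where
        bwd : ∀ {a b} → (∃ λ p → p ∈ˡ arcs × (a , b) ≡ swap p) → ∃ λ e → lookup f a ≡ just e × Joins e a b
        bwd (_ , ba , refl) with propagate⁻ Bwd bwd-closed (proj₂ start) (proj₂ (next ba)) p
        ... | _ , b'a , x with prev-unique ba b'a
        ... | refl = x

    follows⇒rotates : (C : Circuit D) → Follows C f → Rotates D f
    follows⇒rotates C fol v cov with Circuit.covered⇒arc C cov
    ... | w , vw with fol vw | Circuit.adjacent C vw
    ... | e , fv , j | e' , e'∈D , j' with joins-injective j j'
    ... | refl = e , e'∈D , fv

    ¬follows-both : (C : Circuit D) → Follows C f → ¬ Follows (reverse C) f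
    ¬follows-both C fol fol' with Circuit.start C
    ... | (a , b) , ab with fol ab | fol' (∈-map⁺ swap ab)
    ... | e , fa , j | e' , fb , j' with joins-injective j (joins-sym j')
    ... | refl = joins-≢ j (owner-unique f f-inj fa fb)

  module _ {D D' : Subset m} {f : Map} (f-valid : Valid f) (f-inj : EdgeInjective f) where

    -- From the common vertex `f` walks all around `D`. Each edge it uses also lies in `D'`, because
    -- the vertex that owns it is on `D'`, and then so is the next vertex.
    follows-⊆ : (C : Circuit D) → Follows C f → Rotates D' f → ∀ {v} → Covers D v → Covers D' v → D ⊆ D'
    follows-⊆ C fol rot' v-cov v-cov' {e} e∈D with Circuit.arcOf C e∈D
    ... | a , b , ab , j with fol ab | rot' a (propagate (Covers D') closed (proj₂ (covered⇒arc v-cov)) ab v-cov')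
      where
      open Circuit C
      closed : ∀ {a b} → (a , b) ∈ˡ arcs → Covers D' a → Covers D' b
      closed {a} ab cov with fol ab | rot' a cov
      ... | e , fa , j | e' , e'∈ , fa' with trans (sym fa) fa'
      ... | refl = e , e'∈ , joins⇒∈ (joins-sym j)
    ... | e₁ , fa , j₁ | e₂ , e₂∈ , fa' with trans (sym fa) fa' | joins-injective j j₁
    ... | refl | refl = e₂∈

    -- Applied in both directions it shows that two cycles around which `f` runs are equal or
    -- vertex-disjoint, which is why only disjoint unions occur in the expansion.
    rotates-⊆ : IsCycle G D → Rotates D f → Rotates D' f → ∀ {v} → Covers D v → Covers D' v → D ⊆ D'
    rotates-⊆ cyc rot rot' cov cov' with rotates⇒follows {f = f} f-valid f-inj (circuit cyc) rot
    ... | inj₁ fol = follows-⊆ (circuit cyc) fol rot' cov cov'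
    ... | inj₂ fol = follows-⊆ (reverse (circuit cyc)) fol rot' cov cov'

-- Acyclic parent maps and spanning trees

least : ∀ {p} {P : ℕ → Set p} → Decidable P → ∀ k → P k → ∃ λ j → P j × (∀ i → P i → j ≤ i)
least P? k p with P? 0
... | yes p₀ = 0 , p₀ , λ _ _ → z≤n
least P? zero    p | no ¬p₀ = contradiction p ¬p₀
least P? (suc k) p | no ¬p₀ with least (P? ∘ suc) k p
... | j , pj , min = suc j , pj , λ { zero p₀ → contradiction p₀ ¬p₀ ; (suc i) pi → s≤s (min i pi) }

lookup-ext : ∀ {a} {A : Set a} {n} {xs ys : Vec A n} → (∀ i → lookup xs i ≡ lookup ys i) → xs ≡ ys
lookup-ext {xs = xs} {ys} eq =
  trans (sym (Vec.tabulate∘lookup xs)) (trans (Vec.tabulate-cong eq) (Vec.tabulate∘lookup ys))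

module Forests {n m : ℕ} (G : Graph n m) where
  open Graph G
  open Parents G
  open Circuits G

  rotates? : ∀ D f → Dec (Rotates D f)
  rotates? D f = Fin.all? λ v → covers? D v →-dec Fin.any? λ e → (e ∈? D) ×-dec (lookup f v ≟ᵐ just e)

  image : Map → Subset m
  image f = subsetOf λ e → Fin.any? λ v → lookup f v ≟ᵐ just e

  image⁺ : ∀ f {v e} → lookup f v ≡ just e → e ∈ image f
  image⁺ f fv = ∈-subsetOf⁺ (λ e → Fin.any? λ v → lookup f v ≟ᵐ just e) (_ , fv)

  image⁻ : ∀ f {e} → e ∈ image f → ∃ λ v → lookup f v ≡ just e
  image⁻ f = ∈-subsetOf⁻ (λ e → Fin.any? λ v → lookup f v ≟ᵐ just e)

  -- Two vertices that own the same edge are its ends and hence each other's parents; the walk from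
  -- either would go back and forth forever.
  forest⇒injective : ∀ {f} → Valid f → Forest f → EdgeInjective f
  forest⇒injective {f} val fst v w eq with lookup f v in fv | v Fin.≟ w
  ... | nothing | _        = inj₁ refl
  ... | just e  | yes refl = inj₂ refl
  ... | just e  | no v≢w   = ⊥-elim (bounce (∈⇒joins (val fv) (val (sym eq)) v≢w) fv (sym eq) (proj₂ (fst v)))
    where
    bounce : ∀ {e v w a} → Joins e v w → lookup f v ≡ just e → lookup f w ≡ just e → ¬ Leads f v a
    bounce j fv fw (halt r) = contradiction (trans (sym r) fv) λ ()
    bounce j fv fw (move p l) with trans (sym fv) p
    ... | refl with joins⇒other j
    ... | refl = bounce (joins-sym j) fw fv l

  -- A walk that starts on `D` stays on `D`, where every vertex owns an edge, so it never reaches a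
  -- root.
  forest⇒¬rotates : ∀ {D f} → IsCycle G D → Valid f → Forest f → ¬ Rotates D f
  forest⇒¬rotates {D} {f} cyc val fst rot = absurd (Circuit.arc⇒covered C (proj₂ (Circuit.start C))) (proj₂ (fst _))
    where
    C = circuit cyc
    absurd : ∀ {v a} → Covers D v → ¬ Leads f v a
    absurd cov (halt r) with rot _ cov
    ... | e , _ , p = contradiction (trans (sym r) p) λ ()
    absurd cov (move q l) with rot _ cov
    ... | e , e∈D , p with trans (sym p) q
    ... | refl = absurd (e , e∈D , joins⇒∈ (joins-sym (other-joins (val p)))) l

  module _ {f : Map} (val : Valid f) (inj : EdgeInjective f) where

    private
      -- Visited vertices are listed with the newest first, so the steps to the parent run from
      -- right to left, and `z` is the vertex whose parent is the last entry. With `z` equal to `u`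
      -- the orbit is closed.
      Orbit : Fin n → List (Fin n) → Fin n → Set
      Orbit u us z = Unique (u ∷ us) × All (λ (x , y) → Step f y x) (chain u us z)

      Trail : Fin n → List (Fin n) → Set
      Trail u []       = Unit
      Trail u (y ∷ us) = Step f y u × Trail y us

      cut : ∀ {u us w} → Unique (u ∷ us) → Trail u us → w ∈ˡ (u ∷ us) → ∀ {z} → Step f z w →
            ∃ λ ws → Orbit u ws z × (∀ {x} → x ∈ˡ ws → x ∈ˡ us)
      cut u! tr (here refl) st = [] , ([] ∷ [] , st ∷ []) , λ ()
      cut {us = y ∷ us} (u∉ ∷ u!) (yu , tr) (there w∈) st with cut u! tr w∈ st
      ... | ws , (ws! , steps) , sub = y ∷ ws , (All.tabulate (λ x∈ → All.lookup u∉ (keep x∈)) ∷ ws! , yu ∷ steps) , keep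
        where
        keep : ∀ {x} → x ∈ˡ (y ∷ ws) → x ∈ˡ (y ∷ us)
        keep (here eq)  = here eq
        keep (there x∈) = there (sub x∈)

      -- `k` is the room that is left for new vertices: once it is used up, the trail would consist
      -- of n + 1 distinct vertices.
      grow : ∀ k u us → Unique (u ∷ us) → Trail u us → ¬ ∃ (Leads f u) → length (u ∷ us) ℕ.+ k ≡ suc n →
             ∃₂ λ u us → Orbit u us u
      grow zero    u us u! tr nl len =
        contradiction (ℕ.≤-trans (ℕ.≤-reflexive (trans (sym len) (ℕ.+-identityʳ _))) (unique⇒length≤n u!)) ℕ.1+n≰n
      grow (suc k) u us u! tr nl len with lookup f u in fu
      ... | nothing = contradiction (u , halt fu) nl
      ... | just e with other e u ∈ˡ? (u ∷ us)
      ...   | yes w∈ = u , proj₁ (cut u! tr w∈ (e , fu , refl)) , proj₁ (proj₂ (cut u! tr w∈ (e , fu , refl)))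
      ...   | no w∉  = grow k (other e u) (u ∷ us)
                         (All.tabulate (λ x∈ eq → w∉ (subst (_∈ˡ (u ∷ us)) (sym eq) x∈)) ∷ u!) ((e , fu , refl) , tr)
                         (λ (a , l) → nl (a , move fu l)) (trans (sym (ℕ.+-suc _ k)) len)

      step-joins : ∀ {y x} → Step f y x → ∃ λ e → lookup f y ≡ just e × Joins e y x
      step-joins (e , fy , refl) = e , fy , other-joins (val fy)

    -- A walk that never reaches a root must come back to a vertex it has visited. Injectivity
    -- excludes that it closes after two steps. The inclusion in `image f` is what contradicts
    -- acyclicity when `f` lives on a spanning tree.
    rotatedCycle : ¬ Forest f → ∃ λ D → IsCycle G D × Rotates D f × D ⊆ image f
    rotatedCycle ¬fst = result (grow n v₀ [] ([] ∷ []) tt (proj₂ stuck) refl)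
      where
      stuck = Fin.¬∀⟶∃¬ n (λ v → ∃ (Leads f v)) (λ v → Fin.any? (leads? f v)) ¬fst
      v₀ = proj₁ stuck

      result : (∃₂ λ u us → Orbit u us u) → ∃ λ D → IsCycle G D × Rotates D f × D ⊆ image f
      result (u , us , us! , steps) = D , (u ∷ us , long us us! steps , us! , adj , cov) , rot , D⊆
        where
        arcs = chain u us u
        owned? = λ e → Any.any? (λ v → lookup f v ≟ᵐ just e) (u ∷ us)
        D = subsetOf owned?
        stepOf : ∀ {x y} → (x , y) ∈ˡ arcs → Step f y x
        stepOf = All.lookup steps
        tail∈ : ∀ {x y} → (x , y) ∈ˡ arcs → y ∈ˡ (u ∷ us)
        tail∈ p with ∈-++⁻ us (subst (_ ∈ˡ_) (chain-proj₂ u us u) (∈-map⁺ proj₂ p))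
        ... | inj₁ y∈          = there y∈
        ... | inj₂ (here refl) = here refl
        head∈ : ∀ {x y} → (x , y) ∈ˡ arcs → x ∈ˡ (u ∷ us)
        head∈ p = subst (_ ∈ˡ_) (chain-proj₁ u us u) (∈-map⁺ proj₁ p)
        into : ∀ {y} → y ∈ˡ (u ∷ us) → ∃ λ x → (x , y) ∈ˡ arcs
        into {y} y∈ with ∈-map⁻ proj₂ (subst (_ ∈ˡ_) (sym (chain-proj₂ u us u)) (rot∈ y∈))
          where
          rot∈ : y ∈ˡ (u ∷ us) → y ∈ˡ (us ∷ʳ u)
          rot∈ (here refl) = ∈-++⁺ʳ us (here refl)
          rot∈ (there y∈)  = ∈-++⁺ˡ y∈
        ... | (x , _) , p , refl = x , p
        D⁺ : ∀ {e v} → v ∈ˡ (u ∷ us) → lookup f v ≡ just e → e ∈ D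
        D⁺ v∈ fv = ∈-subsetOf⁺ owned? (Any.map (λ { refl → fv }) v∈)
        D⁻ : ∀ {e} → e ∈ D → ∃ λ v → v ∈ˡ (u ∷ us) × lookup f v ≡ just e
        D⁻ e∈ = find (∈-subsetOf⁻ owned? e∈)
          where
          find : ∀ {vs e} → Any (λ v → lookup f v ≡ just e) vs → ∃ λ v → v ∈ˡ vs × lookup f v ≡ just e
          find (here p)  = _ , here refl , p
          find (there q) with find q
          ... | v , v∈ , p = v , there v∈ , p
        D⊆ : D ⊆ image f
        D⊆ e∈ = image⁺ f (proj₂ (proj₂ (D⁻ e∈)))
        adj : All (uncurry (Adjacent D)) arcs
        adj = All.tabulate λ p → adj' p (step-joins (stepOf p))
          where
          adj' : ∀ {x y} → (x , y) ∈ˡ arcs → (∃ λ e → lookup f y ≡ just e × Joins e y x) → Adjacent D x y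
          adj' p (e , fy , j) = e , D⁺ (tail∈ p) fy , joins-sym j
        place : ∀ {e} → e ∈ D → ∃₂ λ x y → (x , y) ∈ˡ arcs × Joins e x y
        place e∈ with D⁻ e∈
        ... | v , v∈ , fv with into v∈
        ... | x , p with step-joins (stepOf p)
        ... | e' , fv' , j with trans (sym fv) fv'
        ... | refl = x , v , p , joins-sym j
        cov : ∀ e → e ∈ D → Any (uncurry (Joins e)) arcs
        cov e e∈ with place e∈
        ... | x , y , p , j = Any.map (λ { refl → j }) p
        rot : Rotates D f
        rot v (e , e∈D , v∈e) = at (v∈ v∈e)
          where
          v∈ : v ∈ₑ e → v ∈ˡ (u ∷ us)
          v∈ v∈e with place e∈D
          v∈ (inj₁ refl) | x , y , p , inj₁ (refl , _) = head∈ p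
          v∈ (inj₁ refl) | x , y , p , inj₂ (refl , _) = tail∈ p
          v∈ (inj₂ refl) | x , y , p , inj₁ (_ , refl) = tail∈ p
          v∈ (inj₂ refl) | x , y , p , inj₂ (_ , refl) = head∈ p
          at : v ∈ˡ (u ∷ us) → ∃ λ e → e ∈ D × lookup f v ≡ just e
          at v∈ with into v∈
          ... | x , p with stepOf p
          ... | e , fv , _ = e , D⁺ v∈ fv , fv

        long : ∀ us → Unique (u ∷ us) → All (λ (x , y) → Step f y x) (chain u us u) → 3 ≤ length (u ∷ us)
        long [] _ (st ∷ []) with step-joins st
        ... | _ , _ , j = contradiction refl (joins-≢ j)
        long (w ∷ []) ((u≢w ∷ []) ∷ _) (st ∷ st' ∷ []) with step-joins st | step-joins st'
        ... | e , fw , j | e' , fu , j' with joins-injective j (joins-sym j')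
        ... | refl = contradiction (owner-unique f inj fu fw) u≢w
        long (_ ∷ _ ∷ _) _ _ = s≤s (s≤s (s≤s z≤n))

  module _ {f : Map} (val : Valid f) (inj : EdgeInjective f) where

    -- Every edge of the cycle is owned by one of its ends. A vertex that owns the edge behind it
    -- cannot also own the one ahead, which is a different edge by `asymmetric`; so the sense in
    -- which one edge is owned spreads to all.
    ⊆image⇒follows : ∀ {D} (C : Circuit D) → D ⊆ image f → Follows C f ⊎ Follows (reverse C) f
    ⊆image⇒follows {D} C D⊆ = result (direction (proj₂ start))
      where
      open Circuit C
      Owns : Fin n → Fin n → Set
      Owns a b = ∃ λ e → lookup f a ≡ just e × Joins e a b
      Fwd Bwd : Fin n → Set
      Fwd a = ∃ λ b → (a , b) ∈ˡ arcs × Owns a b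
      Bwd b = ∃ λ a → (a , b) ∈ˡ arcs × Owns b a

      direction : ∀ {a b} → (a , b) ∈ˡ arcs → Owns a b ⊎ Owns b a
      direction ab with adjacent ab
      ... | e , e∈D , j with image⁻ f (D⊆ e∈D)
      ... | x , fx with val fx | j
      ... | inj₁ refl | inj₁ (refl , _) = inj₁ (e , fx , j)
      ... | inj₁ refl | inj₂ (refl , _) = inj₂ (e , fx , joins-sym j)
      ... | inj₂ refl | inj₁ (_ , refl) = inj₂ (e , fx , joins-sym j)
      ... | inj₂ refl | inj₂ (_ , refl) = inj₁ (e , fx , j)

      clash : ∀ {a b c} → (a , b) ∈ˡ arcs → (b , c) ∈ˡ arcs → Owns b a → ¬ Owns b c
      clash ab bc (e , fb , j) (e' , fb' , j') with trans (sym fb) fb'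
      ... | refl with trans (sym (joins⇒other j)) (joins⇒other j')
      ... | refl = asymmetric ab bc

      fwd-closed : ∀ {a b} → (a , b) ∈ˡ arcs → Fwd b → Fwd a
      fwd-closed ab (c , bc , own) with direction ab
      ... | inj₁ p = _ , ab , p
      ... | inj₂ q = contradiction own (clash ab bc q)

      bwd-closed : ∀ {b c} → (b , c) ∈ˡ arcs → Bwd b → Bwd c
      bwd-closed bc (a , ab , own) with direction bc
      ... | inj₁ p = contradiction p (clash ab bc own)
      ... | inj₂ q = _ , bc , q

      result : Owns _ _ ⊎ Owns _ _ → Follows C f ⊎ Follows (reverse C) f
      result (inj₁ p) = inj₁ λ ab → fwd ab (propagate⁻ Fwd fwd-closed (proj₂ start) ab (_ , proj₂ start , p))
        where
        fwd : ∀ {a b} → (a , b) ∈ˡ arcs → Fwd a → Owns a b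
        fwd ab (_ , ab' , own) with next-unique ab ab'
        ... | refl = own
      result (inj₂ q) = inj₂ λ ba → bwd (∈-map⁻ swap ba)
        where
        bwd : ∀ {a b} → (∃ λ p → p ∈ˡ arcs × (a , b) ≡ swap p) → Owns a b
        bwd (_ , ba , refl) with propagate Bwd bwd-closed (proj₂ (next (proj₂ start))) (proj₂ (next ba)) (_ , proj₂ start , q)
        ... | _ , b'a , own with prev-unique ba b'a
        ... | refl = own

  record TreeTo (u : Fin n) (f : Map) : Set where
    field
      valid  : Valid f
      forest : Forest f
      isRoot : lookup f u ≡ nothing
      root≡  : ∀ {v} → lookup f v ≡ nothing → v ≡ u

    injective : EdgeInjective f
    injective = forest⇒injective valid forest

  module _ {u : Fin n} {f : Map} (t : TreeTo u f) where
    open TreeTo t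

    treeTo⇒connected : ∀ v w → Star (Adjacent (image f)) v w
    treeTo⇒connected v w = to v ◅◅ Star.reverse adjacent-sym (to w)
      where
      adjacent-sym : ∀ {x y} → Adjacent (image f) x y → Adjacent (image f) y x
      adjacent-sym (e , e∈ , j) = e , e∈ , joins-sym j
      walk : ∀ {v a} → Leads f v a → Star (Adjacent (image f)) v a
      walk (halt _)   = ε
      walk (move p l) = (_ , image⁺ f p , other-joins (valid p)) ◅ walk l
      to : ∀ v → Star (Adjacent (image f)) v u
      to v with forest v
      ... | a , l with root≡ (leads⇒root l)
      ... | refl = walk l

    treeTo⇒spanningTree : IsSpanningTree G (image f)
    treeTo⇒spanningTree = (ℕ.≤-trans (s≤s z≤n) (Fin.toℕ<n u) , treeTo⇒connected) , acyclic
      where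
      acyclic : ∀ D → IsCycle G D → ¬ D ⊆ image f
      acyclic D cyc D⊆ with ⊆image⇒follows {f = f} valid injective (circuit cyc) D⊆
      ... | inj₁ fol = forest⇒¬rotates cyc valid forest (follows⇒rotates {f = f} valid injective (circuit cyc) fol)
      ... | inj₂ fol = forest⇒¬rotates cyc valid forest (follows⇒rotates {f = f} valid injective (reverse (circuit cyc)) fol)

    -- Induction along the walk in `g`. The edge that `v` owns in `g` is owned in `f` by `v` or by
    -- its other end; in the second case that end, on which both maps already agree, would share the
    -- edge with `v` in `g`.
    treeTo-unique : ∀ {g} → TreeTo u g → image g ⊆ image f → g ≡ f
    treeTo-unique {g} t' ⊆img = lookup-ext λ v → sym (agree (proj₂ (TreeTo.forest t' v)))
      where
      agree : ∀ {v a} → Leads g v a → lookup f v ≡ lookup g v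
      agree (halt r) with TreeTo.root≡ t' r
      ... | refl = trans isRoot (sym r)
      agree {v} (move p l) with image⁻ f (⊆img (image⁺ g p))
      ... | x , fx with x Fin.≟ v
      ...   | yes refl = trans fx (sym p)
      ...   | no x≢v   = contradiction (sym (owner-unique g (TreeTo.injective t') p gx)) x≢v
        where
        x≡ : x ≡ other _ v
        x≡ = sym (joins⇒other (∈⇒joins (TreeTo.valid t' p) (valid fx) (x≢v ∘ sym)))
        gx : lookup g x ≡ just _
        gx = trans (cong (lookup g) x≡) (trans (sym (agree l)) (trans (cong (lookup f) (sym x≡)) fx))

  -- The parent of v is the first edge of a shortest walk from v to u.
  module _ {D : Subset m} (u : Fin n) (conn : ∀ v → Star (Adjacent D) v u) where

    private
      Walk : Fin n → ℕ → Set
      Walk v zero    = v ≡ u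
      Walk v (suc k) = ∃ λ w → Adjacent D v w × Walk w k

      walk? : ∀ v k → Dec (Walk v k)
      walk? v zero    = v Fin.≟ u
      walk? v (suc k) = Fin.any? λ w → adjacent? D v w ×-dec walk? w k

      walk : ∀ {v} → Star (Adjacent D) v u → ∃ (Walk v)
      walk ε        = 0 , refl
      walk (a ◅ as) with walk as
      ... | k , p = suc k , _ , a , p

      shortest : ∀ v → ∃ λ k → Walk v k × (∀ i → Walk v i → k ≤ i)
      shortest v with walk (conn v)
      ... | k , p = least (walk? v) k p

      firstEdge : ∀ {v} k → Walk v k → Maybe (Fin m)
      firstEdge zero    _                 = nothing
      firstEdge (suc _) (_ , (e , _) , _) = just e

      parent : Fin n → Maybe (Fin m)
      parent v = firstEdge (proj₁ (shortest v)) (proj₁ (proj₂ (shortest v)))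

      g : Map
      g = Vec.tabulate parent

      g≡ : ∀ v → lookup g v ≡ parent v
      g≡ = Vec.lookup∘tabulate parent

      firstEdge-∈ : ∀ {v e} k (p : Walk v k) → firstEdge k p ≡ just e → e ∈ D × v ∈ₑ e
      firstEdge-∈ (suc k) (_ , (e , e∈D , j) , _) refl = e∈D , joins⇒∈ j

      firstEdge-nothing : ∀ {v} k (p : Walk v k) → firstEdge k p ≡ nothing → v ≡ u
      firstEdge-nothing zero p _ = p

      -- Induction on a bound for the distance: the rest of a shortest walk from `v` bounds the
      -- distance of the parent.
      leads : ∀ b v → proj₁ (shortest v) ≤ b → Leads g v u
      leads b v le with shortest v in eq
      leads b v le | zero , refl , min = halt (trans (g≡ v) (cong (λ s → firstEdge (proj₁ s) (proj₁ (proj₂ s))) eq))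
      leads (suc b) v (s≤s le) | suc k , (w , (e , e∈D , j) , p) , min =
        move (trans (g≡ v) (cong (λ s → firstEdge (proj₁ s) (proj₁ (proj₂ s))) eq))
             (subst (λ z → Leads g z u) (sym (joins⇒other j))
               (leads b w (ℕ.≤-trans (proj₂ (proj₂ (shortest w)) k p) le)))

    treeTo : ∃ λ f → TreeTo u f × image f ⊆ D
    treeTo = g , tree , λ e∈ → sub (image⁻ g e∈)
      where
      sub : ∀ {e} → (∃ λ v → lookup g v ≡ just e) → e ∈ D
      sub (v , gv) = proj₁ (firstEdge-∈ _ _ (trans (sym (g≡ v)) gv))
      tree : TreeTo u g
      tree = record
        { valid  = λ {v} gv → proj₂ (firstEdge-∈ _ _ (trans (sym (g≡ v)) gv))
        ; forest = λ v → u , leads _ v ℕ.≤-refl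
        ; isRoot = leads⇒root (leads _ u ℕ.≤-refl)
        ; root≡  = λ {v} gv → firstEdge-nothing _ _ (trans (sym (g≡ v)) gv)
        }

  -- An edge of T missed by f could be added to the tree (re-rooted at one end of that edge), which makes
  -- every vertex own an edge and hence closes a cycle inside T.
  spanningTree⇒treeTo : ∀ {T} → IsSpanningTree G T → ∀ u → ∃ λ f → TreeTo u f × image f ⊆ T × T ⊆ image f
  spanningTree⇒treeTo {T} ((_ , conn) , acyc) u = complete (treeTo u (λ v → conn v u))
    where
    module _ {f : Map} (f⊆T : image f ⊆ T) {e : Fin m} (e∈T : e ∈ T) (e∉f : ¬ e ∈ image f)
             {h : Map} (s : TreeTo (src e) h) (h⊆f : image h ⊆ image f) where
      open Graft h (TreeTo.isRoot s) e
      e≢ : ∀ {v} → lookup h v ≢ just e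
      e≢ hv = e∉f (h⊆f (image⁺ h hv))
      value : ∀ {v b} → lookup h⁺ v ≡ b → (v ≡ src e × just e ≡ b) ⊎ (v ≢ src e × lookup h v ≡ b)
      value {v} hv with v Fin.≟ src e
      ... | yes refl = inj₁ (refl , trans (sym at) hv)
      ... | no v≢    = inj₂ (v≢ , trans (sym (away v≢)) hv)
      val : Valid h⁺
      val hv with value hv
      ... | inj₁ (refl , refl) = inj₁ refl
      ... | inj₂ (_ , hv')     = TreeTo.valid s hv'
      total : ∀ {v} → lookup h⁺ v ≢ nothing
      total hv with value hv
      ... | inj₁ (refl , ())
      ... | inj₂ (v≢ , hv') = v≢ (TreeTo.root≡ s hv')
      inj : EdgeInjective h⁺
      inj v w eq with value {v} refl | value {w} refl
      ... | inj₁ (refl , _) | inj₁ (refl , _) = inj₂ refl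
      ... | inj₁ (refl , p) | inj₂ (_ , q)    = contradiction (trans q (trans (sym eq) (sym p))) e≢
      ... | inj₂ (_ , q)    | inj₁ (refl , p) = contradiction (trans q (trans eq (sym p))) e≢
      ... | inj₂ (_ , p)    | inj₂ (_ , q) with TreeTo.injective s v w (trans p (trans eq (sym q)))
      ...   | inj₁ r = contradiction (trans (sym p) r) total
      ...   | inj₂ r = inj₂ r
      ⊆T : image h⁺ ⊆ T
      ⊆T x∈ with image⁻ h⁺ x∈
      ... | v , hv with value hv
      ... | inj₁ (_ , refl) = e∈T
      ... | inj₂ (_ , hv')  = f⊆T (h⊆f (image⁺ h hv'))
      impossible : ⊥
      impossible = uncycle (rotatedCycle {f = h⁺} val inj λ fst → total (leads⇒root (proj₂ (fst (src e)))))
        where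
        uncycle : (∃ λ D → IsCycle G D × Rotates D h⁺ × D ⊆ image h⁺) → ⊥
        uncycle (D , cyc , _ , D⊆) = acyc D cyc λ x∈ → ⊆T (D⊆ x∈)

    complete : (∃ λ f → TreeTo u f × image f ⊆ T) → ∃ λ f → TreeTo u f × image f ⊆ T × T ⊆ image f
    complete (f , t , f⊆T) = f , t , f⊆T , T⊆f
      where
      T⊆f : T ⊆ image f
      T⊆f {e} e∈T with e ∈? image f
      ... | yes e∈f = e∈f
      -- To move the root, the construction by shortest walks is repeated inside `image f` with
      -- `src e` as the target.
      ... | no e∉f  = ⊥-elim (close (treeTo (src e) (λ v → treeTo⇒connected t v (src e))))
        where
        close : (∃ λ h → TreeTo (src e) h × image h ⊆ image f) → ⊥
        close (h , s , h⊆f) = impossible {f = f} f⊆T e∈T e∉f s h⊆f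

-- Trees with one root and spanning trees

_≟ˢ_ : ∀ {m} → DecidableEquality (Subset m)
_≟ˢ_ = Vec.≡-dec Bool._≟_

∈-subsets : ∀ {m} (S : Subset m) → S ∈ˡ subsets m
∈-subsets []            = here refl
∈-subsets (outside ∷ S) = ∈-++⁺ˡ (∈-map⁺ (outside ∷_) (∈-subsets S))
∈-subsets (inside ∷ S)  = ∈-++⁺ʳ (map (outside ∷_) (subsets _)) (∈-map⁺ (inside ∷_) (∈-subsets S))

module Products {a ℓ₁ ℓ₂ ℓ₃ : Level} (F : OrderedField a ℓ₁ ℓ₂ ℓ₃) where
  open Sums F

  -- The bracket as an exponent; it turns a product over a filtered list into one over all indices.
  _^⟦_⟧ : ∀ {p} {P : Set p} → Carrier → Dec P → Carrier
  x ^⟦ P? ⟧ = if does P? then x else 1#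

  ^⟦⟧-yes : ∀ {p} {P : Set p} (P? : Dec P) {x} → P → x ^⟦ P? ⟧ ≈ x
  ^⟦⟧-yes (yes _) _ = ≈-refl
  ^⟦⟧-yes (no ¬p) p = contradiction p ¬p

  ^⟦⟧-no : ∀ {p} {P : Set p} (P? : Dec P) {x} → ¬ P → x ^⟦ P? ⟧ ≈ 1#
  ^⟦⟧-no (yes p) ¬p = contradiction p ¬p
  ^⟦⟧-no (no _)  _  = ≈-refl

  ^⟦⟧-cong : ∀ {p q} {P : Set p} {Q : Set q} (P? : Dec P) (Q? : Dec Q) {x} → (P → Q) → (Q → P) → x ^⟦ P? ⟧ ≈ x ^⟦ Q? ⟧
  ^⟦⟧-cong (yes p) Q? f g = ≈-sym (^⟦⟧-yes Q? (f p))
  ^⟦⟧-cong (no ¬p) Q? f g = ≈-sym (^⟦⟧-no Q? (¬p ∘ g))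

  ^⟦⟧-⊎ : ∀ {p q} {P : Set p} {Q : Set q} (P? : Dec P) (Q? : Dec Q) {x} → ¬ (P × Q) →
          x ^⟦ P? ⊎-dec Q? ⟧ ≈ x ^⟦ P? ⟧ * x ^⟦ Q? ⟧
  ^⟦⟧-⊎ (yes p) (yes q) ¬pq = contradiction (p , q) ¬pq
  ^⟦⟧-⊎ (yes _) (no _)  _   = ≈-sym (*-identityʳ _)
  ^⟦⟧-⊎ (no _)  (yes _) _   = ≈-sym (*-identityˡ _)
  ^⟦⟧-⊎ (no _)  (no _)  _   = ≈-sym (*-identityˡ _)

  ∏-swap : ∀ {b b'} {A : Set b} {B : Set b'} (xs : List A) (ys : List B) (f : A → B → Carrier) →
           ∏ xs (λ x → ∏ ys (f x)) ≈ ∏ ys (λ y → ∏ xs (λ x → f x y))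
  ∏-swap []       ys f = ≈-sym (∏-one ys)
  ∏-swap (x ∷ xs) ys f = ≈-trans (*-congˡ (∏-swap xs ys f)) (≈-sym (∏-* ys (f x) _))

  ∏-single : ∀ {n} (i : Fin n) (f : Fin n → Carrier) → (∀ j → j ≢ i → f j ≈ 1#) → ∏ (allFin n) f ≈ f i
  ∏-single {suc n} zero f eq = ≈-trans (∏-allFin-suc f)
    (≈-trans (*-congˡ (≈-trans (∏-cong (allFin n) (λ j → eq (suc j) λ ())) (∏-one (allFin n)))) (*-identityʳ _))
  ∏-single {suc n} (suc i) f eq = ≈-trans (∏-allFin-suc f)
    (≈-trans (*-cong (eq zero λ ()) (∏-single i (f ∘ suc) (λ j j≢i → eq (suc j) (j≢i ∘ Fin.suc-injective)))) (*-identityˡ _))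

  -- A duplicate-free list enters a product through its members alone, so lists in different orders
  -- can be compared, such as the edges along a cycle and the same edges by index.
  ∏-unique : ∀ {n} {xs : List (Fin n)} → Unique xs → (f : Fin n → Carrier) →
             ∏ xs f ≈ ∏ (allFin n) (λ i → f i ^⟦ i ∈ˡ? xs ⟧)
  ∏-unique {n} {[]}     _          f = ≈-sym (∏-one (allFin n))
  ∏-unique {n} {x ∷ xs} (x∉ ∷ xs!) f = begin
    f x * ∏ xs f
      ≈⟨ *-cong (≈-sym (≈-trans (∏-single x (λ i → f i ^⟦ i Fin.≟ x ⟧) (λ j j≢x → ^⟦⟧-no (j Fin.≟ x) j≢x))
                                (^⟦⟧-yes (x Fin.≟ x) refl)))
                (∏-unique xs! f) ⟩
    ∏ (allFin n) (λ i → f i ^⟦ i Fin.≟ x ⟧) * ∏ (allFin n) (λ i → f i ^⟦ i ∈ˡ? xs ⟧)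
      ≈⟨ ∏-* (allFin n) _ _ ⟨
    ∏ (allFin n) (λ i → f i ^⟦ i Fin.≟ x ⟧ * f i ^⟦ i ∈ˡ? xs ⟧)
      ≈⟨ ∏-cong (allFin n) (λ i → ≈-trans (≈-sym (^⟦⟧-⊎ (i Fin.≟ x) (i ∈ˡ? xs)
            (λ { (refl , x∈) → All.lookup x∉ x∈ refl })))
            (^⟦⟧-cong ((i Fin.≟ x) ⊎-dec (i ∈ˡ? xs)) (i ∈ˡ? (x ∷ xs)) (λ { (inj₁ p) → here p ; (inj₂ q) → there q })
              (λ { (here p) → inj₁ p ; (there q) → inj₂ q }))) ⟩
    ∏ (allFin n) (λ i → f i ^⟦ i ∈ˡ? (x ∷ xs) ⟧) ∎

  ∏-unique-cong : ∀ {n} {xs : List (Fin n)} {p} {P : Fin n → Set p} (P? : ∀ i → Dec (P i)) → Unique xs →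
    (∀ {i} → i ∈ˡ xs → P i) → (∀ {i} → P i → i ∈ˡ xs) → (f : Fin n → Carrier) →
    ∏ xs f ≈ ∏ (filter P? (allFin n)) f
  ∏-unique-cong {n} {xs} P? xs! to from f = begin
    ∏ xs f                                    ≈⟨ ∏-unique xs! f ⟩
    ∏ (allFin n) (λ i → f i ^⟦ i ∈ˡ? xs ⟧)    ≈⟨ ∏-cong (allFin n) (λ i → ^⟦⟧-cong (i ∈ˡ? xs) (P? i) to from) ⟩
    ∏ (allFin n) (λ i → f i ^⟦ P? i ⟧)        ≈⟨ ∏-filter P? (allFin n) f ⟨
    ∏ (filter P? (allFin n)) f                ∎

  ∑-subsets-δ : ∀ {m} (S : Subset m) (f : Subset m → Carrier) → ∑ (subsets m) (λ T → ⟦ S ≟ˢ T ⟧ * f T) ≈ f S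
  ∑-subsets-δ {zero} [] f = ≈-trans (+-identityʳ _) (*-identityˡ _)
  ∑-subsets-δ {suc m} (b ∷ S) f = ≈-trans (∑-++ (map (outside ∷_) (subsets m)) _ _)
    (≈-trans (+-cong (∑-map (outside ∷_) (subsets m) _) (∑-map (inside ∷_) (subsets m) _)) (cases b))
    where
    g : ∀ b b' → Subset m → Carrier
    g b b' T = ⟦ (b ∷ S) ≟ˢ (b' ∷ T) ⟧ * f (b' ∷ T)
    same : ∀ b → ∑ (subsets m) (g b b) ≈ f (b ∷ S)
    same b = ≈-trans (∑-cong (subsets m) λ T → *-congʳ
      (⟦⟧-cong ((b ∷ S) ≟ˢ (b ∷ T)) (S ≟ˢ T) Vec.∷-injectiveʳ (cong (b ∷_)))) (∑-subsets-δ S (λ T → f (b ∷ T)))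
    diff : ∀ b b' → b ≢ b' → ∑ (subsets m) (g b b') ≈ 0#
    diff b b' b≢b' = ≈-trans (∑-cong (subsets m) λ T →
      ≈-trans (*-congʳ (⟦⟧-no ((b ∷ S) ≟ˢ (b' ∷ T)) (b≢b' ∘ Vec.∷-injectiveˡ))) (zeroˡ _)) (∑-zero (subsets m))
    cases : ∀ b → ∑ (subsets m) (g b outside) + ∑ (subsets m) (g b inside) ≈ f (b ∷ S)
    cases outside = ≈-trans (+-cong (same outside) (diff outside inside λ ())) (+-identityʳ _)
    cases inside  = ≈-trans (+-cong (diff inside outside λ ()) (same inside)) (+-identityˡ _)

  open IsStrictPartialOrder isStrictPartialOrder using (<-respʳ-≈; <-respˡ-≈) renaming (trans to <-trans)

  -- One is apart from zero because `1# - 0#` is invertible. Were it negative, then its negative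
  -- would be positive and so would the square of that, which is one.
  0<1 : 0# < 1#
  0<1 with #⇒<⊎> (invertible⇒# (1# , ≈-trans (*-identityˡ _) 1-0 , ≈-trans (*-identityʳ _) 1-0))
    where
    1-0 : 1# - 0# ≈ 1#
    1-0 = ≈-trans (+-congˡ -0#≈0#) (+-identityʳ _)
  ... | inj₂ 0<1 = 0<1
  ... | inj₁ 1<0 = <-respʳ-≈ square (*-pos 0<-1 0<-1)
    where
    0<-1 : 0# < - 1#
    0<-1 = <-respˡ-≈ (-‿inverseˡ 1#) (<-respʳ-≈ (+-identityʳ _) (+-monoʳ-< (- 1#) 1<0))
    square : - 1# * - 1# ≈ 1#
    square = ≈-trans (≈-sym (-‿distribˡ-* 1# (- 1#))) (≈-trans (-‿cong (*-identityˡ _)) (-‿involutive 1#))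

  ∏-pos : ∀ {b} {A : Set b} (xs : List A) {f : A → Carrier} → (∀ y → 0# < f y) → 0# < ∏ xs f
  ∏-pos []       pos = 0<1
  ∏-pos (x ∷ xs) pos = *-pos (pos x) (∏-pos xs pos)

  ∑-pos : ∀ {b} {A : Set b} {x : A} {xs : List A} {f : A → Carrier} → x ∈ˡ xs → (∀ y → 0# < f y) → 0# < ∑ xs f
  ∑-pos {xs = x ∷ []}     _ pos = <-respʳ-≈ (≈-sym (+-identityʳ _)) (pos x)
  ∑-pos {xs = x ∷ y ∷ xs} {f} _ pos =
    <-trans (<-respʳ-≈ (≈-sym (+-identityʳ _)) (pos x)) (+-monoʳ-< (f x) (∑-pos {xs = y ∷ xs} (here refl) pos))

module TreeTheorem {a ℓ₁ ℓ₂ ℓ₃ : Level} (F : OrderedField a ℓ₁ ℓ₂ ℓ₃) {n m : ℕ} (G : Graph n m)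
                   (c : Fin m → OrderedField.Carrier F) where
  open Sums F
  open Products F
  open WeightedSums F m
  open Graph G
  open Parents G
  open Forests G
  open Network F G c

  rootedAt⇒treeTo : ∀ {u f} → RootedAt (u ∷ []) f → Forest f → TreeTo u f
  rootedAt⇒treeTo {u} {f} at fst = record
    { valid = valid ; forest = fst ; isRoot = isRoot (here refl) ; root≡ = λ r → single (root∈ r) }
    where
    open RootedAt at
    single : ∀ {v} → v ∈ˡ (u ∷ []) → v ≡ u
    single (here eq) = eq

  -- Every edge of the image has exactly one owner, so multiplying over the owners is multiplying
  -- over the edges.
  treeTo-weight : ∀ {u f} → TreeTo u f →
    ∏ (allFin n) (λ v → rooted (u ∷ []) v (lookup f v)) ≈ ∏ (filter (_∈? image f) (allFin m)) c
  treeTo-weight {u} {f} t = begin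
    ∏ (allFin n) (λ v → rooted (u ∷ []) v (lookup f v))
      ≈⟨ ∏-cong (allFin n) perVertex ⟩
    ∏ (allFin n) (λ v → ∏ (allFin m) λ e → c e ^⟦ lookup f v ≟ᵐ just e ⟧)
      ≈⟨ ∏-swap (allFin n) (allFin m) _ ⟩
    ∏ (allFin m) (λ e → ∏ (allFin n) λ v → c e ^⟦ lookup f v ≟ᵐ just e ⟧)
      ≈⟨ ∏-cong (allFin m) perEdge ⟩
    ∏ (allFin m) (λ e → c e ^⟦ e ∈? image f ⟧)
      ≈⟨ ∏-filter (_∈? image f) (allFin m) c ⟨
    ∏ (filter (_∈? image f) (allFin m)) c ∎
    where
    open TreeTo t
    root-case : ∀ v b → lookup f v ≡ b → rooted (u ∷ []) v b ≈ ∏ (allFin m) λ e → c e ^⟦ b ≟ᵐ just e ⟧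
    root-case v nothing  fv = ≈-trans (⟦⟧-yes (v ∈ˡ? (u ∷ [])) (here (root≡ fv))) (≈-sym (∏-one (allFin m)))
    root-case v (just e) fv = begin
      ⟦ ¬? (v ∈ˡ? (u ∷ [])) ⟧ * (⟦ v ∈ₑ? e ⟧ * c e)
        ≈⟨ *-cong (⟦⟧-yes (¬? (v ∈ˡ? (u ∷ []))) (λ { (here refl) → contradiction (trans (sym isRoot) fv) λ () }))
                  (*-congʳ (⟦⟧-yes (v ∈ₑ? e) (valid fv))) ⟩
      1# * (1# * c e)
        ≈⟨ ≈-trans (*-identityˡ _) (*-identityˡ _) ⟩
      c e
        ≈⟨ ^⟦⟧-yes (just e ≟ᵐ just e) refl ⟨
      c e ^⟦ just e ≟ᵐ just e ⟧
        ≈⟨ ∏-single e (λ e' → c e' ^⟦ just e ≟ᵐ just e' ⟧) (λ e' e'≢e → ^⟦⟧-no (just e ≟ᵐ just e') λ { refl → e'≢e refl }) ⟨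
      ∏ (allFin m) (λ e' → c e' ^⟦ just e ≟ᵐ just e' ⟧) ∎
    perVertex : ∀ v → _
    perVertex v = root-case v (lookup f v) refl
    perEdge : ∀ e → ∏ (allFin n) (λ v → c e ^⟦ lookup f v ≟ᵐ just e ⟧) ≈ c e ^⟦ e ∈? image f ⟧
    perEdge e with e ∈? image f
    ... | no e∉ = ≈-trans (∏-cong (allFin n) λ v → ^⟦⟧-no (lookup f v ≟ᵐ just e) (e∉ ∘ image⁺ f)) (∏-one (allFin n))
    ... | yes e∈ with image⁻ f e∈
    ...   | v , fv = ≈-trans (∏-single v _ (λ w w≢v → ^⟦⟧-no (lookup f w ≟ᵐ just e)
                        (λ fw → w≢v (owner-unique f injective fw fv)))) (^⟦⟧-yes (lookup f v ≟ᵐ just e) fv)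

  -- For a fixed root, `image` is a bijection from the trees directed towards `u` onto the spanning
  -- trees. The value is independent of `u`, as `resistance-forests` requires.
  forests≈treeWeight : ∀ u → forests (u ∷ []) ≈ treeWeight G c
  forests≈treeWeight u = begin
    𝔼 (rooted (u ∷ [])) (λ f → ⟦ forest? f ⟧)
      ≈⟨ 𝔼-rooted-cong (u ∷ []) (λ f at → expand f at) ⟩
    𝔼 (rooted (u ∷ [])) (λ f → ∑ (subsets m) λ T → ⟦ isSpanningTree? G T ⟧ * (⟦ forest? f ⟧ * ⟦ image f ≟ˢ T ⟧))
      ≈⟨ 𝔼-∑ (rooted (u ∷ [])) (subsets m) _ ⟩
    ∑ (subsets m) (λ T → 𝔼 (rooted (u ∷ [])) λ f → ⟦ isSpanningTree? G T ⟧ * (⟦ forest? f ⟧ * ⟦ image f ≟ˢ T ⟧))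
      ≈⟨ ∑-cong (subsets m) (λ T → ≈-trans (𝔼-*ˡ (rooted (u ∷ [])) _ _) (⟦⟧-guard (isSpanningTree? G T) (perTree T))) ⟩
    ∑ (subsets m) (λ T → ⟦ isSpanningTree? G T ⟧ * ∏ (filter (_∈? T) (allFin m)) c)
      ≈⟨ ∑-filter (isSpanningTree? G) (subsets m) _ ⟨
    treeWeight G c ∎
    where
    expand : ∀ f → RootedAt (u ∷ []) f →
      ⟦ forest? f ⟧ ≈ ∑ (subsets m) λ T → ⟦ isSpanningTree? G T ⟧ * (⟦ forest? f ⟧ * ⟦ image f ≟ˢ T ⟧)
    expand f at = begin
      ⟦ forest? f ⟧
        ≈⟨ *-identityʳ _ ⟨
      ⟦ forest? f ⟧ * 1#
        ≈⟨ ⟦⟧-guard (forest? f) (λ fst →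
             ⟦⟧-yes (isSpanningTree? G (image f)) (treeTo⇒spanningTree (rootedAt⇒treeTo at fst))) ⟨
      ⟦ forest? f ⟧ * ⟦ isSpanningTree? G (image f) ⟧
        ≈⟨ *-congˡ (∑-subsets-δ (image f) (λ T → ⟦ isSpanningTree? G T ⟧)) ⟨
      ⟦ forest? f ⟧ * ∑ (subsets m) (λ T → ⟦ image f ≟ˢ T ⟧ * ⟦ isSpanningTree? G T ⟧)
        ≈⟨ ∑-*ˡ _ (subsets m) _ ⟨
      ∑ (subsets m) (λ T → ⟦ forest? f ⟧ * (⟦ image f ≟ˢ T ⟧ * ⟦ isSpanningTree? G T ⟧))
        ≈⟨ ∑-cong (subsets m) (λ T → solve 3 (λ p q r → p :* (q :* r) := r :* (p :* q)) ≈-refl _ _ _) ⟩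
      ∑ (subsets m) (λ T → ⟦ isSpanningTree? G T ⟧ * (⟦ forest? f ⟧ * ⟦ image f ≟ˢ T ⟧)) ∎
    unique : ∀ T → (∃ λ g → TreeTo u g × image g ⊆ T × T ⊆ image g) →
      𝔼 (rooted (u ∷ [])) (λ f → ⟦ forest? f ⟧ * ⟦ image f ≟ˢ T ⟧) ≈ ∏ (filter (_∈? T) (allFin m)) c
    unique T (g , t , g⊆T , T⊆g) with ⊆-antisym g⊆T T⊆g
    ... | refl = begin
      𝔼 (rooted (u ∷ [])) (λ f → ⟦ forest? f ⟧ * ⟦ image f ≟ˢ image g ⟧)
        ≈⟨ 𝔼-rooted-cong (u ∷ []) (λ f at → ≈-trans (≈-sym (⟦⟧-× (forest? f) (image f ≟ˢ image g)))
             (⟦⟧-cong (forest? f ×-dec (image f ≟ˢ image g)) (g ≟ᵖ f)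
               (λ (fst , eq) → sym (treeTo-unique t (rootedAt⇒treeTo at fst) (⊆-reflexive eq)))
               (λ { refl → TreeTo.forest t , refl }))) ⟩
      𝔼 (rooted (u ∷ [])) (λ f → ⟦ g ≟ᵖ f ⟧)
        ≈⟨ 𝔼-δ g (rooted (u ∷ [])) ⟩
      ∏ (allFin n) (λ v → rooted (u ∷ []) v (lookup g v))
        ≈⟨ treeTo-weight t ⟩
      ∏ (filter (_∈? image g) (allFin m)) c ∎
    perTree : ∀ T → IsSpanningTree G T →
      𝔼 (rooted (u ∷ [])) (λ f → ⟦ forest? f ⟧ * ⟦ image f ≟ˢ T ⟧) ≈ ∏ (filter (_∈? T) (allFin m)) c
    perTree T sp = unique T (spanningTree⇒treeTo sp u)

  -- One spanning tree suffices, and shortest walks towards some vertex provide it.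
  treeWeight-pos : Connected G → (∀ e → 0# < c e) → 0# < treeWeight G c
  treeWeight-pos (1≤n , conn) c>0 = found (treeTo u (λ v → conn v u))
    where
    u = Fin.fromℕ< 1≤n
    found : (∃ λ f → TreeTo u f × image f ⊆ ⊤) → 0# < treeWeight G c
    found (f , t , _) = ∑-pos (∈-filter⁺ (isSpanningTree? G) (∈-subsets (image f)) (treeTo⇒spanningTree t))
                              (λ T → ∏-pos (filter (_∈? T) (allFin m)) c>0)

-- Inclusion–exclusion over cycles

module _ {a} {A : Set a} where

  sublists-All : ∀ {p} {P : A → Set p} {xs ys : List A} → ys ∈ˡ sublists xs → All P xs → All P ys
  sublists-All {xs = []}     (here refl) _ = []
  sublists-All {xs = x ∷ xs} ys∈ (p ∷ ps) with ∈-++⁻ (sublists xs) ys∈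
  ... | inj₁ ys∈′ = sublists-All ys∈′ ps
  ... | inj₂ ys∈′ with ∈-map⁻ (x ∷_) ys∈′
  ... | zs , zs∈ , refl = p ∷ sublists-All zs∈ ps

  sublists-AllPairs : ∀ {r} {R : A → A → Set r} {xs ys : List A} → ys ∈ˡ sublists xs → AllPairs R xs → AllPairs R ys
  sublists-AllPairs {xs = []}     (here refl) _ = []
  sublists-AllPairs {xs = x ∷ xs} ys∈ (r ∷ rs) with ∈-++⁻ (sublists xs) ys∈
  ... | inj₁ ys∈′ = sublists-AllPairs ys∈′ rs
  ... | inj₂ ys∈′ with ∈-map⁻ (x ∷_) ys∈′
  ... | zs , zs∈ , refl = sublists-All zs∈ r ∷ sublists-AllPairs zs∈ rs

  unique-⊆-length : {xs ys : List A} → Unique xs → (∀ {x} → x ∈ˡ xs → x ∈ˡ ys) → length xs ≤ length ys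
  unique-⊆-length {xs} {ys} xs! sub = Fin.injective⇒≤ {f = position} λ eq →
    lookup-unique xs! (trans (at _) (trans (cong (List.lookup ys) eq) (sym (at _))))
    where
    position : Fin (length xs) → Fin (length ys)
    position i = Any.index (sub (∈-lookup i))
    at : ∀ i → List.lookup xs i ≡ List.lookup ys (position i)
    at i = Any.lookup-index (sub (∈-lookup i))

  length-filter-⊎ : ∀ {p q r} {P : A → Set p} {Q : A → Set q} {R : A → Set r}
    (P? : ∀ x → Dec (P x)) (Q? : ∀ x → Dec (Q x)) (R? : ∀ x → Dec (R x)) →
    (∀ {x} → P x → R x) → (∀ {x} → Q x → R x) → (∀ {x} → R x → P x ⊎ Q x) → (∀ {x} → P x → ¬ Q x) →
    ∀ xs → length (filter R? xs) ≡ length (filter P? xs) ℕ.+ length (filter Q? xs)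
  length-filter-⊎ P? Q? R? p⇒r q⇒r r⇒pq ¬pq []       = refl
  length-filter-⊎ P? Q? R? p⇒r q⇒r r⇒pq ¬pq (x ∷ xs) with length-filter-⊎ P? Q? R? p⇒r q⇒r r⇒pq ¬pq xs | P? x | Q? x | R? x
  ... | ih | yes p | yes q | _     = contradiction q (¬pq p)
  ... | ih | yes p | no _  | yes _ = cong suc ih
  ... | ih | no _  | yes q | yes _ = trans (cong suc ih) (sym (ℕ.+-suc _ _))
  ... | ih | no _  | no _  | no _  = ih
  ... | ih | yes p | no _  | no ¬r = contradiction (p⇒r p) ¬r
  ... | ih | no _  | yes q | no ¬r = contradiction (q⇒r q) ¬r
  ... | ih | no ¬p | no ¬q | yes r with r⇒pq r
  ...   | inj₁ p = contradiction p ¬p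
  ...   | inj₂ q = contradiction q ¬q

subsets-unique : ∀ m → Unique (subsets m)
subsets-unique zero    = [] ∷ []
subsets-unique (suc m) = Unique.++⁺ (Unique.map⁺ Vec.∷-injectiveʳ (subsets-unique m))
  (Unique.map⁺ Vec.∷-injectiveʳ (subsets-unique m)) λ (p , q) → disjoint (∈-map⁻ (outside ∷_) p) (∈-map⁻ (inside ∷_) q)
  where
  disjoint : ∀ {S : Subset (suc m)} → (∃ λ T → T ∈ˡ subsets m × S ≡ outside ∷ T) →
             (∃ λ T → T ∈ˡ subsets m × S ≡ inside ∷ T) → ⊥
  disjoint (_ , _ , refl) (_ , _ , ())

-- Cutting an oriented cycle out of a parent map

module Assignments {n m : ℕ} where

  -- A list of prescribed owners. It serves for the edges of an oriented cycle and, later, for the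
  -- half-edges of a matching.
  Assignment : Set
  Assignment = List (Fin n × Fin m)

  infixl 5 _◂_
  _◂_ : ParentMap n m → Assignment → ParentMap n m
  f ◂ []            = f
  f ◂ ((v , e) ∷ s) = (f ◂ s) [ v ]≔ just e

  Agrees : Assignment → ParentMap n m → Set
  Agrees s f = All (λ (v , e) → just e ≡ lookup f v) s

  agrees? : ∀ s f → Dec (Agrees s f)
  agrees? s f = All.all? (λ (v , e) → just e ≟ᵐ lookup f v) s

  ◂-∉ : ∀ s f {v} → v ∉ˡ map proj₁ s → lookup (f ◂ s) v ≡ lookup f v
  ◂-∉ []            f v∉ = refl
  ◂-∉ ((w , e) ∷ s) f {v} v∉ = trans (Vec.lookup∘updateAt′ v w (v∉ ∘ here) (f ◂ s)) (◂-∉ s f (v∉ ∘ there))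

  ◂-∈ : ∀ s f {v e} → Unique (map proj₁ s) → (v , e) ∈ˡ s → lookup (f ◂ s) v ≡ just e
  ◂-∈ ((w , _) ∷ s) f _          (here refl) = Vec.lookup∘updateAt w (f ◂ s)
  ◂-∈ ((w , _) ∷ s) f (w∉ ∷ s!) (there p)   =
    trans (Vec.lookup∘updateAt′ _ w (λ { refl → All.lookup w∉ (∈-map⁺ proj₁ p) refl }) (f ◂ s)) (◂-∈ s f s! p)

rootCount : ∀ {n m} → ParentMap n m → ℕ
rootCount []            = 0
rootCount (nothing ∷ f) = suc (rootCount f)
rootCount (just _ ∷ f)  = rootCount f

rootCount-fill : ∀ {n m} (f : ParentMap n m) v {e} → lookup f v ≡ nothing → rootCount f ≡ suc (rootCount (f [ v ]≔ just e))
rootCount-fill (nothing ∷ f) zero    _  = refl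
rootCount-fill (nothing ∷ f) (suc v) fv = cong suc (rootCount-fill f v fv)
rootCount-fill (just _ ∷ f)  (suc v) fv = rootCount-fill f v fv

module _ {n m : ℕ} where
  open Assignments {n} {m}

  rootCount-◂ : ∀ s f → Unique (map proj₁ s) → (∀ {v} → v ∈ˡ map proj₁ s → lookup f v ≡ nothing) →
                rootCount f ≡ length s ℕ.+ rootCount (f ◂ s)
  rootCount-◂ []            f _         _    = refl
  rootCount-◂ ((v , e) ∷ s) f (v∉ ∷ s!) free = 
    trans (rootCount-◂ s f s! (free ∘ there))
      (trans (cong (length s ℕ.+_) (rootCount-fill (f ◂ s) v {e} (trans (◂-∉ s f (λ v∈ → All.lookup v∉ v∈ refl)) (free (here refl)))))
             (ℕ.+-suc _ _))

module AssignmentSums {a ℓ₁ ℓ₂ ℓ₃ : Level} (F : OrderedField a ℓ₁ ℓ₂ ℓ₃) {n m : ℕ} where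
  open Sums F
  open WeightedSums F m
  open Assignments {n} {m}

  clear : Weight n → Assignment → Weight n
  clear ω []            = ω
  clear ω ((v , e) ∷ s) = clear (updateAt ω v (const root)) s

  clear-∉ : ∀ ω s {v} b → v ∉ˡ map proj₁ s → clear ω s v b ≡ ω v b
  clear-∉ ω []            b v∉ = refl
  clear-∉ ω ((w , e) ∷ s) {v} b v∉ = trans (clear-∉ (updateAt ω w (const root)) s b (v∉ ∘ there))
    (cong (λ h → h b) (updateAt-minimal v w ω (v∉ ∘ here)))

  clear-∈ : ∀ ω s {v} b → Unique (map proj₁ s) → v ∈ˡ map proj₁ s → clear ω s v b ≡ root b
  clear-∈ ω ((w , e) ∷ s) b (w∉ ∷ s!) (there v∈)  = clear-∈ (updateAt ω w (const root)) s b s! v∈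
  clear-∈ ω ((w , e) ∷ s) b (w∉ ∷ s!) (here refl) = trans
    (clear-∉ (updateAt ω w (const root)) s b (λ w∈ → All.lookup w∉ w∈ refl)) (cong (λ h → h b) (updateAt-updates w ω))

  -- The prescribed values come out as a constant factor. What remains is a sum over maps in which
  -- their vertices are mere placeholders, refilled by `_◂_` before `g` is applied.
  𝔼-agrees : ∀ s → Unique (map proj₁ s) → ∀ (ω : Weight n) (g : ParentMap n m → Carrier) →
    𝔼 ω (λ f → ⟦ agrees? s f ⟧ * g f) ≈ ∏ s (λ (v , e) → ω v (just e)) * 𝔼 (clear ω s) (λ f → g (f ◂ s))
  𝔼-agrees [] _ ω g = ≈-trans (𝔼-cong ω (λ f → *-identityˡ _)) (≈-sym (*-identityˡ _))
  𝔼-agrees ((v , e) ∷ s) (v∉ ∷ s!) ω g = begin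
    𝔼 ω (λ f → ⟦ agrees? ((v , e) ∷ s) f ⟧ * g f)
      ≈⟨ 𝔼-cong ω (λ f → ≈-trans (*-congʳ (≈-trans
           (⟦⟧-cong (agrees? ((v , e) ∷ s) f) ((just e ≟ᵐ lookup f v) ×-dec agrees? s f)
             (λ { (p ∷ ps) → p , ps }) (uncurry _∷_))
           (⟦⟧-× (just e ≟ᵐ lookup f v) (agrees? s f)))) (*-assoc _ _ _)) ⟩
    𝔼 ω (λ f → ⟦ just e ≟ᵐ lookup f v ⟧ * (⟦ agrees? s f ⟧ * g f))
      ≈⟨ 𝔼-fix v (just e) ω _ ⟩
    ω v (just e) * 𝔼 ω′ (λ f → ⟦ agrees? s (f [ v ]≔ just e) ⟧ * g (f [ v ]≔ just e))
      ≈⟨ *-congˡ (𝔼-cong ω′ (λ f → *-congʳ (⟦⟧-cong (agrees? s (f [ v ]≔ just e)) (agrees? s f)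
           (λ ps → All.tabulate λ p∈ → trans (All.lookup ps p∈) (stable f p∈))
           (λ ps → All.tabulate λ p∈ → trans (All.lookup ps p∈) (sym (stable f p∈)))))) ⟩
    ω v (just e) * 𝔼 ω′ (λ f → ⟦ agrees? s f ⟧ * g (f [ v ]≔ just e))
      ≈⟨ *-congˡ (𝔼-agrees s s! ω′ (λ f → g (f [ v ]≔ just e))) ⟩
    ω v (just e) * (∏ s (λ (v , e) → ω′ v (just e)) * 𝔼 (clear ω′ s) (λ f → g ((f ◂ s) [ v ]≔ just e)))
      ≈⟨ *-assoc _ _ _ ⟨
    ω v (just e) * ∏ s (λ (v , e) → ω′ v (just e)) * 𝔼 (clear ω′ s) (λ f → g ((f ◂ s) [ v ]≔ just e))
      ≈⟨ *-congʳ (*-congˡ (∏-cong-∈ s λ {p} p∈ →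
           reflexive (cong (λ h → h (just (proj₂ p))) (updateAt-minimal (proj₁ p) v ω (≢v p∈))))) ⟩
    ω v (just e) * ∏ s (λ (v , e) → ω v (just e)) * 𝔼 (clear ω′ s) (λ f → g ((f ◂ s) [ v ]≔ just e)) ∎
    where
    ω′ = updateAt ω v (const root)
    ≢v : ∀ {p} → p ∈ˡ s → proj₁ p ≢ v
    ≢v p∈ eq = All.lookup v∉ (∈-map⁺ proj₁ p∈) (sym eq)
    stable : ∀ f {p} → p ∈ˡ s → lookup (f [ v ]≔ just e) (proj₁ p) ≡ lookup f (proj₁ p)
    stable f {p} p∈ = Vec.lookup∘updateAt′ (proj₁ p) v (≢v p∈) f

module CircuitOwners {n m : ℕ} (G : Graph n m) where
  open Graph G
  open Parents G
  open Circuits G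
  open Assignments {n} {m}

  private
    assign : ∀ {D ps} → All (uncurry (Adjacent D)) ps → Assignment
    assign [] = []
    assign {ps = (a , b) ∷ _} ((e , _) ∷ as) = (a , e) ∷ assign as

    assign-keys : ∀ {D ps} (as : All (uncurry (Adjacent D)) ps) → map proj₁ (assign as) ≡ map proj₁ ps
    assign-keys [] = refl
    assign-keys {ps = (a , _) ∷ _} (_ ∷ as) = cong (a ∷_) (assign-keys as)

    assign⁻ : ∀ {D ps a e} (as : All (uncurry (Adjacent D)) ps) → (a , e) ∈ˡ assign as →
              ∃ λ b → (a , b) ∈ˡ ps × e ∈ D × Joins e a b
    assign⁻ ((e , e∈D , j) ∷ as) (here refl) = _ , here refl , e∈D , j
    assign⁻ (_ ∷ as) (there p) with assign⁻ as p
    ... | b , ab , q = b , there ab , q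

    assign⁺ : ∀ {D ps a b} (as : All (uncurry (Adjacent D)) ps) → (a , b) ∈ˡ ps →
              ∃ λ e → (a , e) ∈ˡ assign as × Joins e a b
    assign⁺ ((e , _ , j) ∷ as) (here refl) = e , here refl , j
    assign⁺ (_ ∷ as) (there p) with assign⁺ as p
    ... | e , ae , j = e , there ae , j

  module _ {D : Subset m} (C : Circuit D) where
    open Circuit C

    -- Each vertex of the cycle gets the edge to its successor; agreeing with this list is the same
    -- as following `C`.
    owners : Assignment
    owners = assign (All.tabulate adjacent)

    owners⁻ : ∀ {a e} → (a , e) ∈ˡ owners → ∃ λ b → (a , b) ∈ˡ arcs × e ∈ D × Joins e a b
    owners⁻ = assign⁻ (All.tabulate adjacent)

    owners⁺ : ∀ {a b} → (a , b) ∈ˡ arcs → ∃ λ e → (a , e) ∈ˡ owners × Joins e a b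
    owners⁺ = assign⁺ (All.tabulate adjacent)

    owner-keys! : Unique (map proj₁ owners)
    owner-keys! = subst Unique (sym (assign-keys (All.tabulate adjacent)))
      (unique-map-on proj₁ arcs-unique λ { {_ , b} ab ab' refl → cong (_ ,_) (next-unique ab ab') })

    -- Two arcs along the same edge are equal or opposite, and `asymmetric` excludes opposite ones.
    owner-edges! : Unique (map proj₂ owners)
    owner-edges! = unique-map-on proj₂ (Unique.map⁻ owner-keys!) λ { p q refl → cong (_, _) (same (owners⁻ p) (owners⁻ q)) }
      where
      same : ∀ {a a' e} → (∃ λ b → (a , b) ∈ˡ arcs × e ∈ D × Joins e a b) →
             (∃ λ b → (a' , b) ∈ˡ arcs × e ∈ D × Joins e a' b) → a ≡ a'
      same (b , ab , _ , inj₁ (refl , _)) (b' , ab' , _ , inj₁ (refl , _)) = refl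
      same (b , ab , _ , inj₁ (refl , refl)) (b' , ab' , _ , inj₂ (refl , refl)) = contradiction ab' (asymmetric ab)
      same (b , ab , _ , inj₂ (refl , refl)) (b' , ab' , _ , inj₁ (refl , refl)) = contradiction ab' (asymmetric ab)
      same (b , ab , _ , inj₂ (_ , refl)) (b' , ab' , _ , inj₂ (_ , refl)) = refl

    key⇒covered : ∀ {v} → v ∈ˡ map proj₁ owners → Covers D v
    key⇒covered v∈ with ∈-map⁻ proj₁ v∈
    ... | (_ , e) , p , refl = arc⇒covered (proj₁ (proj₂ (owners⁻ p)))

    covered⇒owner : ∀ {v} → Covers D v → ∃ λ e → (v , e) ∈ˡ owners
    covered⇒owner cov with owners⁺ (proj₂ (covered⇒arc cov))
    ... | e , p , _ = e , p

    covered⇒key : ∀ {v} → Covers D v → v ∈ˡ map proj₁ owners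
    covered⇒key cov = ∈-map⁺ proj₁ (proj₂ (covered⇒owner cov))

    owned⇒∈ : ∀ {e} → e ∈ˡ map proj₂ owners → e ∈ D
    owned⇒∈ e∈ with ∈-map⁻ proj₂ e∈
    ... | (a , _) , p , refl = proj₁ (proj₂ (proj₂ (owners⁻ p)))

    ∈⇒owned : ∀ {e} → e ∈ D → e ∈ˡ map proj₂ owners
    ∈⇒owned e∈D with arcOf e∈D
    ... | a , b , ab , j with owners⁺ ab
    ... | e' , p , j' with joins-injective j j'
    ... | refl = ∈-map⁺ proj₂ p

    follows⇒agrees : ∀ {f} → Follows C f → Agrees owners f
    follows⇒agrees {f} fol = All.tabulate λ p → agree (owners⁻ p)
      where
      agree : ∀ {a e} → (∃ λ b → (a , b) ∈ˡ arcs × e ∈ D × Joins e a b) → just e ≡ lookup f a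
      agree (b , ab , _ , j) with fol ab
      ... | e' , fa , j' with joins-injective j j'
      ... | refl = sym fa

    agrees⇒follows : ∀ {f} → Agrees owners f → Follows C f
    agrees⇒follows agr ab with owners⁺ ab
    ... | e , p , j = e , sym (All.lookup agr p) , j

    length-owners : length owners ≡ length (filter (covers? D) (allFin n))
    length-owners = trans (sym (length-map proj₁ owners)) (ℕ.≤-antisym
      (unique-⊆-length owner-keys! (λ v∈ → ∈-filter⁺ (covers? D) (∈-allFin _) (key⇒covered v∈)))
      (unique-⊆-length (Unique.filter⁺ (covers? D) (Unique.allFin⁺ n))
        (λ v∈ → covered⇒key (proj₂ (∈-filter⁻ (covers? D) {xs = allFin n} v∈)))))

    module _ {f : Map} (val : Valid f) (free : ∀ {v} → Covers D v → lookup f v ≡ nothing) where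

      ◂-uncovered : ∀ {v} → ¬ Covers D v → lookup (f ◂ owners) v ≡ lookup f v
      ◂-uncovered ¬cov = ◂-∉ owners f (¬cov ∘ key⇒covered)

      private
        -- An edge of `D` has both ends on `D`, so no vertex off `D` can own it.
        mixed : ∀ {v w} → (∃ λ e → (v , e) ∈ˡ owners) → ¬ Covers D w → lookup (f ◂ owners) v ≢ lookup (f ◂ owners) w
        mixed (e , ve) ¬cov eq = ¬cov (e , proj₁ (proj₂ (proj₂ (owners⁻ ve))) ,
          val (trans (sym (◂-uncovered ¬cov)) (trans (sym eq) (◂-∈ owners f owner-keys! ve))))

      ◂-injective⁺ : EdgeInjective f → EdgeInjective (f ◂ owners)
      ◂-injective⁺ inj v w eq with covers? D v | covers? D w
      ... | no ¬p | no ¬q with inj v w (trans (sym (◂-uncovered ¬p)) (trans eq (◂-uncovered ¬q)))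
      ...   | inj₁ r = inj₁ (trans (◂-uncovered ¬p) r)
      ...   | inj₂ r = inj₂ r
      ◂-injective⁺ inj v w eq | yes p | yes q = same (covered⇒owner p) (covered⇒owner q)
        where
        same : (∃ λ e → (v , e) ∈ˡ owners) → (∃ λ e → (w , e) ∈ˡ owners) → _ ⊎ v ≡ w
        same (e , ve) (e' , we') with trans (sym (◂-∈ owners f owner-keys! ve)) (trans eq (◂-∈ owners f owner-keys! we'))
        ... | refl = inj₂ (cong proj₁ (unique-map-injective proj₂ owner-edges! ve we' refl))
      ◂-injective⁺ inj v w eq | yes p | no ¬q = ⊥-elim (mixed (covered⇒owner p) ¬q eq)
      ◂-injective⁺ inj v w eq | no ¬p | yes q = ⊥-elim (mixed (covered⇒owner q) ¬p (sym eq))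

      ◂-injective⁻ : EdgeInjective (f ◂ owners) → EdgeInjective f
      ◂-injective⁻ inj v w eq with covers? D v | covers? D w
      ... | yes p | _     = inj₁ (free p)
      ... | no _  | yes q = inj₁ (trans eq (free q))
      ... | no ¬p | no ¬q with inj v w (trans (◂-uncovered ¬p) (trans eq (sym (◂-uncovered ¬q))))
      ...   | inj₁ r = inj₁ (trans (sym (◂-uncovered ¬p)) r)
      ...   | inj₂ r = inj₂ r

      module _ {D' : Subset m} (disj : VertexDisjoint G D D') where

        ◂-rotates⁺ : Rotates D' f → Rotates D' (f ◂ owners)
        ◂-rotates⁺ rot v cov with rot v cov
        ... | e , e∈ , fv = e , e∈ , trans (◂-uncovered (λ cov' → disj v (cov' , cov))) fv

        ◂-rotates⁻ : Rotates D' (f ◂ owners) → Rotates D' f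
        ◂-rotates⁻ rot v cov with rot v cov
        ... | e , e∈ , fv = e , e∈ , trans (sym (◂-uncovered (λ cov' → disj v (cov' , cov)))) fv

      -- Without the cycle its vertices are roots. This is the origin of the shift by |C| in the
      -- size of the matchings.
      ◂-rootCount : rootCount f ≡ length (filter (covers? D) (allFin n)) ℕ.+ rootCount (f ◂ owners)
      ◂-rootCount = trans (rootCount-◂ owners f owner-keys! (free ∘ key⇒covered)) (cong (ℕ._+ rootCount (f ◂ owners)) length-owners)

-- The signed sum over unions of cycles

module InclusionExclusion {a ℓ₁ ℓ₂ ℓ₃ : Level} (F : OrderedField a ℓ₁ ℓ₂ ℓ₃) {n m : ℕ} (G : Graph n m)
                          (c : Fin m → OrderedField.Carrier F) (x : Fin n → OrderedField.Carrier F) where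
  open Sums F
  open Products F
  open WeightedSums F m
  open Graph G
  open Parents G
  open Circuits G
  open Forests G
  open Network F G c
  open Assignments {n} {m}
  open AssignmentSums F {n} {m}
  open CircuitOwners G
  open CycleUnion G using (edgeList; size)

  -- Vertices in W neither own an edge nor carry weight.
  away : {W : Fin n → Set} → (∀ v → Dec (W v)) → Weight n
  away W? = net (λ v → x v ^⟦ ¬? (W? v) ⟧) (λ v → ⟦ ¬? (W? v) ⟧)

  away-cong : {W W' : Fin n → Set} (W? : ∀ v → Dec (W v)) (W'? : ∀ v → Dec (W' v)) →
              (∀ {v} → W v → W' v) → (∀ {v} → W' v → W v) → ∀ v b → away W? v b ≈ away W'? v b
  away-cong W? W'? to from v nothing  = ^⟦⟧-cong (¬? (W? v)) (¬? (W'? v)) (_∘ from) (_∘ to)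
  away-cong W? W'? to from v (just e) = *-congʳ (⟦⟧-cong (¬? (W? v)) (¬? (W'? v)) (_∘ from) (_∘ to))

  𝔼-away-cong : {W : Fin n → Set} (W? : ∀ v → Dec (W v)) {g g' : Map → Carrier} →
                (∀ f → Valid f → (∀ {v} → W v → lookup f v ≡ nothing) → g f ≈ g' f) → 𝔼 (away W?) g ≈ 𝔼 (away W?) g'
  𝔼-away-cong {W} W? eq = 𝔼-cong-on Owning supp λ f sp → eq f
    (λ {v} fv → proj₂ (subst (Owning v) fv (sp v))) (λ {v} → free v (lookup f v) (sp v))
    where
    Owning : Fin n → Maybe (Fin m) → Set
    Owning v nothing  = Unit
    Owning v (just e) = ¬ W v × v ∈ₑ e
    free : ∀ v b → Owning v b → W v → b ≡ nothing
    free v nothing  _        _ = refl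
    free v (just e) (¬w , _) w = contradiction w ¬w
    supp : ∀ v b → Owning v b ⊎ away W? v b ≈ 0#
    supp v nothing = inj₁ tt
    supp v (just e) with W? v
    ... | yes _ = inj₂ (zeroˡ _)
    ... | no ¬w with v ∈ₑ? e
    ...   | yes v∈e = inj₁ (¬w , v∈e)
    ...   | no v∉e  = inj₂ (≈-trans (*-congˡ (incident-zero v∉e)) (zeroʳ _))

  -- The term that belongs to `Cs` when the product of 1 - [`f` runs around D] over all cycles D is
  -- multiplied out.
  signed : List (Subset m) → Map → Carrier
  signed Cs f = ∏ Cs (λ D → - ⟦ rotates? D f ⟧)

  private
    ∑-sublists-empty : ∀ {b} {A : Set b} (xs : List A) (t : List A → Carrier) →
      ∑ (sublists xs) (λ ys → ⟦ ¬? (1 ℕ.≤? length ys) ⟧ * t ys) ≈ t []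
    ∑-sublists-empty []       t = ≈-trans (+-identityʳ _) (*-identityˡ _)
    ∑-sublists-empty (y ∷ xs) t = begin
      ∑ (sublists xs ++ map (y ∷_) (sublists xs)) (λ ys → ⟦ ¬? (1 ℕ.≤? length ys) ⟧ * t ys)
        ≈⟨ ∑-++ (sublists xs) _ _ ⟩
      _ + ∑ (map (y ∷_) (sublists xs)) (λ ys → ⟦ ¬? (1 ℕ.≤? length ys) ⟧ * t ys)
        ≈⟨ +-cong (∑-sublists-empty xs t) (≈-trans (∑-map (y ∷_) (sublists xs) _)
             (∑-vanish (sublists xs) _)) ⟩
      t [] + 0#
        ≈⟨ +-identityʳ _ ⟩
      t [] ∎

    signed-zero : ∀ {Cs f D} → D ∈ˡ Cs → ¬ Rotates D f → signed Cs f ≈ 0#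
    signed-zero {f = f} {D} D∈ ¬rot = ∏-zero-∈ _ D∈ (≈-trans (-‿cong (⟦⟧-no (rotates? D f) ¬rot)) -0#≈0#)

    -- If two members share a vertex and `f` runs around both, they are equal by `rotates-⊆`,
    -- whereas `Cs` has no repetitions. So one of the factors is zero.
    signed-disjoint : ∀ {f} → Valid f → EdgeInjective f → ∀ Cs → All (IsCycle G) Cs → Unique Cs →
                      ¬ AllPairs (VertexDisjoint G) Cs → signed Cs f ≈ 0#
    signed-disjoint val inj [] _ _ ¬disj = contradiction [] ¬disj
    signed-disjoint {f} val inj (D ∷ Cs) (cyc ∷ cycs) (D∉ ∷ Cs!) ¬disj with allPairs? (vertexDisjoint? G) Cs
    ... | no ¬ap = ≈-trans (*-congˡ (signed-disjoint {f} val inj Cs cycs Cs! ¬ap)) (zeroʳ _)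
    ... | yes ap with rotates? D f
    ...   | no ¬rot = signed-zero {D ∷ Cs} {f} (here refl) ¬rot
    ...   | yes rot with All.all? (vertexDisjoint? G D) Cs
    ...     | yes vd = contradiction (vd ∷ ap) ¬disj
    ...     | no ¬vd = ≈-trans (*-congˡ (search Cs cycs D∉ ¬vd)) (zeroʳ _)
      where
      search : ∀ Cs → All (IsCycle G) Cs → All (D ≢_) Cs → ¬ All (VertexDisjoint G D) Cs → signed Cs f ≈ 0#
      search [] _ _ ¬vd = contradiction [] ¬vd
      search (E ∷ Es) (cyc' ∷ cycs) (D≢E ∷ D∉) ¬vd with vertexDisjoint? G D E
      ... | yes vd = ≈-trans (*-congˡ (search Es cycs D∉ (λ vds → ¬vd (vd ∷ vds)))) (zeroʳ _)
      ... | no ¬d = signed-zero {E ∷ Es} {f} (here refl) λ rot' → ¬d λ v (covD , covE) → D≢E (⊆-antisym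
              (rotates-⊆ {f = f} val inj cyc rot rot' covD covE)
              (rotates-⊆ {f = f} val inj cyc' rot' rot covE covD))

  cyclesList! : Unique (cycles G)
  cyclesList! = Unique.filter⁺ (isCycle? G) (subsets-unique m)

  cyclesAll : All (IsCycle G) (cycles G)
  cyclesAll = All.tabulate λ D∈ → proj₂ (∈-filter⁻ (isCycle? G) {xs = subsets m} D∈)

  -- Forests are edge-injective and run around no cycle; an edge-injective map that is not a forest
  -- runs around some cycle by `rotatedCycle`, which makes a factor vanish.
  forest-product : ∀ {f} → Valid f → ⟦ forest? f ⟧ ≈ ⟦ edgeInjective? f ⟧ * ∏ (cycles G) (λ D → 1# + - ⟦ rotates? D f ⟧)
  forest-product {f} val = cases (forest? f) (edgeInjective? f)
    where
    P = ∏ (cycles G) (λ D → 1# + - ⟦ rotates? D f ⟧)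
    vanish : (∃ λ D → IsCycle G D × Rotates D f × D ⊆ image f) → P ≈ 0#
    vanish (D , cyc , rot , _) = ∏-zero-∈ _ (∈-filter⁺ (isCycle? G) (∈-subsets D) cyc)
      (≈-trans (+-congˡ (-‿cong (⟦⟧-yes (rotates? D f) rot))) (-‿inverseʳ 1#))
    cases : (p : Dec (Forest f)) (q : Dec (EdgeInjective f)) → ⟦ p ⟧ ≈ ⟦ q ⟧ * P
    cases (yes fst) (no ¬inj)  = contradiction (forest⇒injective val fst) ¬inj
    cases (yes fst) (yes _)    = ≈-sym (≈-trans (*-identityˡ _) (≈-trans (∏-cong-∈ (cycles G) λ {D} D∈ →
      ≈-trans (+-congˡ (≈-trans (-‿cong (⟦⟧-no (rotates? D f) (forest⇒¬rotates (All.lookup cyclesAll D∈) val fst))) -0#≈0#))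
              (+-identityʳ _)) (∏-one (cycles G))))
    cases (no ¬fst) (no _)     = ≈-sym (zeroˡ _)
    cases (no ¬fst) (yes inj)  = ≈-sym (≈-trans (*-identityˡ _) (vanish (rotatedCycle {f = f} val inj ¬fst)))

  -- The empty list of cycles gives the first term and lists with overlapping cycles vanish, so that
  -- exactly `cycleUnions` is left.
  forest-expansion : ∀ {f} → Valid f →
    ⟦ forest? f ⟧ ≈ ⟦ edgeInjective? f ⟧ + ∑ (cycleUnions G) (λ Cs → ⟦ edgeInjective? f ⟧ * signed Cs f)
  forest-expansion {f} val = begin
    ⟦ forest? f ⟧
      ≈⟨ forest-product val ⟩
    ι * ∏ (cycles G) (λ D → 1# + - ⟦ rotates? D f ⟧)
      ≈⟨ *-congˡ (∑-sublists-∏ (cycles G) _) ⟨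
    ι * ∑ (sublists (cycles G)) (λ Cs → signed Cs f)
      ≈⟨ ∑-*ˡ ι (sublists (cycles G)) _ ⟨
    ∑ (sublists (cycles G)) t
      ≈⟨ ∑-cong-∈ (sublists (cycles G)) (λ {Cs} → split Cs) ⟩
    ∑ (sublists (cycles G)) (λ Cs → ⟦ ¬? (1 ℕ.≤? length Cs) ⟧ * t Cs + ⟦ union? Cs ⟧ * t Cs)
      ≈⟨ ∑-+ (sublists (cycles G)) _ _ ⟩
    ∑ (sublists (cycles G)) (λ Cs → ⟦ ¬? (1 ℕ.≤? length Cs) ⟧ * t Cs) + ∑ (sublists (cycles G)) (λ Cs → ⟦ union? Cs ⟧ * t Cs)
      ≈⟨ +-cong (≈-trans (∑-sublists-empty (cycles G) t) (*-identityʳ ι))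
                (≈-sym (∑-filter union? (sublists (cycles G)) t)) ⟩
    ι + ∑ (cycleUnions G) t ∎
    where
    ι = ⟦ edgeInjective? f ⟧
    t : List (Subset m) → Carrier
    t Cs = ι * signed Cs f
    union? : ∀ Cs → Dec (1 ≤ length Cs × AllPairs (VertexDisjoint G) Cs)
    union? Cs = (1 ℕ.≤? length Cs) ×-dec allPairs? (vertexDisjoint? G) Cs
    split : ∀ Cs → Cs ∈ˡ sublists (cycles G) → t Cs ≈ ⟦ ¬? (1 ℕ.≤? length Cs) ⟧ * t Cs + ⟦ union? Cs ⟧ * t Cs
    split Cs Cs∈ = cases (1 ℕ.≤? length Cs) (allPairs? (vertexDisjoint? G) Cs)
      where
      cases : (p : Dec (1 ≤ length Cs)) (q : Dec (AllPairs (VertexDisjoint G) Cs)) →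
              t Cs ≈ ⟦ ¬? p ⟧ * t Cs + ⟦ p ×-dec q ⟧ * t Cs
      cases (no _)  _       = ≈-sym (≈-trans (+-cong (*-identityˡ _) (zeroˡ _)) (+-identityʳ _))
      cases (yes _) (yes _) = ≈-sym (≈-trans (+-cong (zeroˡ _) (*-identityˡ _)) (+-identityˡ _))
      cases (yes _) (no ¬d) = ≈-trans (≈-trans (⟦⟧-guard (edgeInjective? f) (λ inj →
          signed-disjoint {f} val inj Cs (sublists-All Cs∈ cyclesAll) (sublists-AllPairs Cs∈ cyclesList!) ¬d)) (zeroʳ _))
        (≈-sym (≈-trans (+-cong (zeroˡ _) (zeroˡ _)) (+-identityˡ _)))

  cycleWeight : Subset m → Carrier
  cycleWeight D = ∏ (filter (_∈? D) (allFin m)) c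

  order : Subset m → ℕ
  order D = length (filter (covers? D) (allFin n))

  -- The cycles of a union are cut out one by one: `W` holds the vertices already removed, `D` is
  -- the next cycle and `Cs` the cycles still to come.
  module _ {D : Subset m} {W : Fin n → Set} (W? : ∀ v → Dec (W v)) (away-D : ∀ {v} → Covers D v → ¬ W v) where

    beyond? : ∀ v → Dec (Covers D v ⊎ W v)
    beyond? v = covers? D v ⊎-dec W? v

    module _ {Cs : List (Subset m)} (disj : All (VertexDisjoint G D) Cs) (k : ℕ) where

      residue : ℕ → Map → Carrier
      residue k f = ⟦ edgeInjective? f ⟧ * (signed Cs f * ⟦ rootCount f ℕ.≟ k ⟧)

      -- The maps that follow `C` are those on the remaining vertices with `C` superimposed. As the
      -- later cycles avoid `D`, this changes nothing in their indicators.
      sum-agreeing : (C : Circuit D) → 𝔼 (away W?) (λ f → ⟦ agrees? (owners C) f ⟧ * residue k f) ≈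
                     cycleWeight D * 𝔼 (away beyond?) (residue (order D ℕ.+ k))
      sum-agreeing C = ≈-trans (𝔼-agrees (owners C) (owner-keys! C) (away W?) (residue k)) (*-cong weights (≈-trans
        (𝔼-congʷ _ cleared) (𝔼-away-cong beyond? λ f val free → pointwise f val (free ∘ inj₁))))
        where
        weights : ∏ (owners C) (λ (v , e) → away W? v (just e)) ≈ cycleWeight D
        weights = begin
          ∏ (owners C) (λ (v , e) → away W? v (just e))
            ≈⟨ ∏-cong-∈ (owners C) (λ {(v , e)} ve∈ → owned v e (owners⁻ C ve∈)) ⟩
          ∏ (owners C) (c ∘ proj₂)
            ≈⟨ ∏-map proj₂ (owners C) c ⟨
          ∏ (map proj₂ (owners C)) c
            ≈⟨ ∏-unique-cong (_∈? D) (owner-edges! C) (owned⇒∈ C) (∈⇒owned C) c ⟩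
          cycleWeight D ∎
          where
          owned : ∀ v e → (∃ λ b → (v , b) ∈ˡ Circuit.arcs C × e ∈ D × Joins e v b) → away W? v (just e) ≈ c e
          owned v e (b , vb , _ , j) = ≈-trans
            (*-cong (⟦⟧-yes (¬? (W? v)) (away-D (Circuit.arc⇒covered C vb))) (*-congʳ (⟦⟧-yes (v ∈ₑ? e) (joins⇒∈ j))))
            (≈-trans (*-identityˡ _) (*-identityˡ _))

        cleared : ∀ v b → clear (away W?) (owners C) v b ≈ away beyond? v b
        cleared v b with covers? D v
        ... | yes cov = ≈-trans (reflexive (clear-∈ (away W?) (owners C) b (owner-keys! C) (covered⇒key C cov))) (≈-sym (vanish b))
          where
          vanish : ∀ b → away beyond? v b ≈ root b
          vanish nothing  = ^⟦⟧-no (¬? (beyond? v)) (λ ¬w → ¬w (inj₁ cov))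
          vanish (just e) = ≈-trans (*-congʳ (⟦⟧-no (¬? (beyond? v)) (λ ¬w → ¬w (inj₁ cov)))) (zeroˡ _)
        ... | no ¬cov = ≈-trans (reflexive (clear-∉ (away W?) (owners C) b (¬cov ∘ key⇒covered C))) (keep b)
          where
          elim : Covers D v ⊎ W v → W v
          elim (inj₁ cov) = contradiction cov ¬cov
          elim (inj₂ w)   = w
          keep : ∀ b → away W? v b ≈ away beyond? v b
          keep nothing  = ^⟦⟧-cong (¬? (W? v)) (¬? (beyond? v)) (_∘ elim) (_∘ inj₂)
          keep (just e) = *-congʳ (⟦⟧-cong (¬? (W? v)) (¬? (beyond? v)) (_∘ elim) (_∘ inj₂))

        pointwise : ∀ f → Valid f → (∀ {v} → Covers D v → lookup f v ≡ nothing) →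
                    residue k (f ◂ owners C) ≈ residue (order D ℕ.+ k) f
        pointwise f val free = *-cong
          (⟦⟧-cong (edgeInjective? (f ◂ owners C)) (edgeInjective? f) (◂-injective⁻ C val free) (◂-injective⁺ C val free))
          (*-cong
            (∏-cong-∈ Cs λ {E} E∈ → -‿cong (⟦⟧-cong (rotates? E (f ◂ owners C)) (rotates? E f)
              (◂-rotates⁻ C val free (All.lookup disj E∈)) (◂-rotates⁺ C val free (All.lookup disj E∈))))
            (⟦⟧-cong (rootCount (f ◂ owners C) ℕ.≟ k) (rootCount f ℕ.≟ order D ℕ.+ k)
              (λ eq → trans (◂-rootCount C val free) (cong (order D ℕ.+_) eq))
              (λ eq → ℕ.+-cancelˡ-≡ (order D) _ _ (trans (sym (◂-rootCount C val free)) eq))))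

      -- The origin of the constant -2: the sign belongs to inclusion-exclusion, and the 2 counts
      -- the senses `C` and `C′` of the cycle, which exclude each other and contribute equally.
      sum-rotating : IsCycle G D → 𝔼 (away W?) (λ f → ⟦ edgeInjective? f ⟧ * (signed (D ∷ Cs) f * ⟦ rootCount f ℕ.≟ k ⟧)) ≈
                     - (1# + 1#) * cycleWeight D * 𝔼 (away beyond?) (residue (order D ℕ.+ k))
      sum-rotating cyc = begin
        𝔼 (away W?) (λ f → ⟦ edgeInjective? f ⟧ * (signed (D ∷ Cs) f * ⟦ rootCount f ℕ.≟ k ⟧))
          ≈⟨ 𝔼-away-cong W? (λ f val _ → senses f val) ⟩
        𝔼 (away W?) (λ f → - (⟦ agrees? (owners C) f ⟧ * residue k f + ⟦ agrees? (owners C′) f ⟧ * residue k f))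
          ≈⟨ 𝔼-neg (away W?) _ ⟩
        - 𝔼 (away W?) (λ f → ⟦ agrees? (owners C) f ⟧ * residue k f + ⟦ agrees? (owners C′) f ⟧ * residue k f)
          ≈⟨ -‿cong (≈-trans (𝔼-+ (away W?) _ _) (+-cong (sum-agreeing C) (sum-agreeing C′))) ⟩
        - (X + X)
          ≈⟨ -‿cong (+-cong (*-identityˡ X) (*-identityˡ X)) ⟨
        - (1# * X + 1# * X)
          ≈⟨ -‿cong (distribʳ X 1# 1#) ⟨
        - ((1# + 1#) * X)
          ≈⟨ -‿distribˡ-* _ _ ⟩
        - (1# + 1#) * X
          ≈⟨ *-assoc _ _ _ ⟨
        - (1# + 1#) * cycleWeight D * 𝔼 (away beyond?) (residue (order D ℕ.+ k)) ∎
        where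
        C = circuit cyc
        C′ = reverse C
        X = cycleWeight D * 𝔼 (away beyond?) (residue (order D ℕ.+ k))
        senses : ∀ f → Valid f → ⟦ edgeInjective? f ⟧ * (signed (D ∷ Cs) f * ⟦ rootCount f ℕ.≟ k ⟧) ≈
          - (⟦ agrees? (owners C) f ⟧ * residue k f + ⟦ agrees? (owners C′) f ⟧ * residue k f)
        senses f val = begin
          ι * (- ρ * s * q)
            ≈⟨ solve 4 (λ i r s q → i :* (r :* s :* q) := r :* (i :* (s :* q))) ≈-refl _ _ _ _ ⟩
          - ρ * (ι * (s * q))
            ≈⟨ -‿distribˡ-* _ _ ⟨
          - (ρ * (ι * (s * q)))
            ≈⟨ -‿cong (x∙yz≈y∙xz _ _ _) ⟩
          - (ι * (ρ * (s * q)))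
            ≈⟨ -‿cong (⟦⟧-guard (edgeInjective? f) (λ inj → *-congʳ (≈-trans
                 (⟦⟧-cong (rotates? D f) (agrees? (owners C) f ⊎-dec agrees? (owners C′) f) (to inj) (from inj))
                 (⟦⟧-⊎ (agrees? (owners C) f) (agrees? (owners C′) f)
                   (λ (p , q) → ¬follows-both {f = f} val inj C (agrees⇒follows C {f} p) (agrees⇒follows C′ {f} q)))))) ⟩
          - (ι * ((⟦ agrees? (owners C) f ⟧ + ⟦ agrees? (owners C′) f ⟧) * (s * q)))
            ≈⟨ -‿cong (solve 4 (λ i u v y → i :* ((u :+ v) :* y) := u :* (i :* y) :+ v :* (i :* y)) ≈-refl _ _ _ _) ⟩
          - (⟦ agrees? (owners C) f ⟧ * (ι * (s * q)) + ⟦ agrees? (owners C′) f ⟧ * (ι * (s * q))) ∎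
          where
          ι = ⟦ edgeInjective? f ⟧
          ρ = ⟦ rotates? D f ⟧
          s = signed Cs f
          q = ⟦ rootCount f ℕ.≟ k ⟧
          to : EdgeInjective f → Rotates D f → Agrees (owners C) f ⊎ Agrees (owners C′) f
          to inj rot with rotates⇒follows {f = f} val inj C rot
          ... | inj₁ fol = inj₁ (follows⇒agrees C {f} fol)
          ... | inj₂ fol = inj₂ (follows⇒agrees C′ {f} fol)
          from : EdgeInjective f → Agrees (owners C) f ⊎ Agrees (owners C′) f → Rotates D f
          from inj (inj₁ agr) = follows⇒rotates {f = f} val inj C (agrees⇒follows C {f} agr)
          from inj (inj₂ agr) = follows⇒rotates {f = f} val inj C′ (agrees⇒follows C′ {f} agr)

  covers-∪⁻ : ∀ {D Cs v} → Covers (⋃ (D ∷ Cs)) v → Covers D v ⊎ Covers (⋃ Cs) v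
  covers-∪⁻ {D} {Cs} (e , e∈ , v∈e) with x∈p∪q⁻ D (⋃ Cs) e∈
  ... | inj₁ e∈D = inj₁ (e , e∈D , v∈e)
  ... | inj₂ e∈U = inj₂ (e , e∈U , v∈e)

  covers-∪⁺ : ∀ {D Cs v} → Covers D v ⊎ Covers (⋃ Cs) v → Covers (⋃ (D ∷ Cs)) v
  covers-∪⁺ {D} {Cs} (inj₁ (e , e∈D , v∈e)) = e , x∈p∪q⁺ {p = D} {q = ⋃ Cs} (inj₁ e∈D) , v∈e
  covers-∪⁺ {D} {Cs} (inj₂ (e , e∈U , v∈e)) = e , x∈p∪q⁺ {p = D} {q = ⋃ Cs} (inj₂ e∈U) , v∈e

  disjoint-⋃ : ∀ {D} Cs → All (VertexDisjoint G D) Cs → ∀ {v} → Covers D v → ¬ Covers (⋃ Cs) v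
  disjoint-⋃ []       _          covD (e , e∈ , _) = ∉⊥ e∈
  disjoint-⋃ (E ∷ Cs) (vd ∷ vds) covD cov with covers-∪⁻ {E} {Cs} cov
  ... | inj₁ covE = vd _ (covD , covE)
  ... | inj₂ covU = disjoint-⋃ Cs vds covD covU

  size-∷ : ∀ {D Cs} → All (VertexDisjoint G D) Cs → size (D ∷ Cs) ≡ order D ℕ.+ size Cs
  size-∷ {D} {Cs} disj = length-filter-⊎ (covers? D) (covers? (⋃ Cs)) (covers? (⋃ (D ∷ Cs)))
    (covers-∪⁺ {D} {Cs} ∘ inj₁) (covers-∪⁺ {D} {Cs} ∘ inj₂) (covers-∪⁻ {D} {Cs}) (disjoint-⋃ Cs disj) (allFin n)

  edgeWeight-∷ : ∀ {D Cs} → All (VertexDisjoint G D) Cs → ∏ (edgeList (D ∷ Cs)) c ≈ cycleWeight D * ∏ (edgeList Cs) c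
  edgeWeight-∷ {D} {Cs} disj = begin
    ∏ (edgeList (D ∷ Cs)) c
      ≈⟨ ∏-filter (_∈? ⋃ (D ∷ Cs)) (allFin m) c ⟩
    ∏ (allFin m) (λ e → c e ^⟦ e ∈? ⋃ (D ∷ Cs) ⟧)
      ≈⟨ ∏-cong (allFin m) (λ e → ≈-trans
           (^⟦⟧-cong (e ∈? ⋃ (D ∷ Cs)) ((e ∈? D) ⊎-dec (e ∈? ⋃ Cs)) (x∈p∪q⁻ D (⋃ Cs)) x∈p∪q⁺)
           (^⟦⟧-⊎ (e ∈? D) (e ∈? ⋃ Cs) λ (p , q) → disjoint-⋃ Cs disj (e , p , inj₁ refl) (e , q , inj₁ refl))) ⟩
    ∏ (allFin m) (λ e → c e ^⟦ e ∈? D ⟧ * c e ^⟦ e ∈? ⋃ Cs ⟧)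
      ≈⟨ ∏-* (allFin m) _ _ ⟩
    ∏ (allFin m) (λ e → c e ^⟦ e ∈? D ⟧) * ∏ (allFin m) (λ e → c e ^⟦ e ∈? ⋃ Cs ⟧)
      ≈⟨ *-cong (∏-filter (_∈? D) (allFin m) c) (∏-filter (_∈? ⋃ Cs) (allFin m) c) ⟨
    cycleWeight D * ∏ (edgeList Cs) c ∎

  -- `W` and `k` are arbitrary for the sake of the induction: each cycle enlarges the removed set
  -- and raises the number of roots by its order.
  sum-union : ∀ Cs → All (IsCycle G) Cs → AllPairs (VertexDisjoint G) Cs →
    ∀ {W : Fin n → Set} (W? : ∀ v → Dec (W v)) → All (λ D → ∀ {v} → Covers D v → ¬ W v) Cs → ∀ k →
    𝔼 (away W?) (λ f → ⟦ edgeInjective? f ⟧ * (signed Cs f * ⟦ rootCount f ℕ.≟ k ⟧)) ≈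
    (- (1# + 1#)) ^ length Cs * ∏ (edgeList Cs) c *
    𝔼 (away (λ v → covers? (⋃ Cs) v ⊎-dec W? v)) (λ f → ⟦ edgeInjective? f ⟧ * ⟦ rootCount f ℕ.≟ size Cs ℕ.+ k ⟧)
  sum-union [] _ _ {W} W? _ k = begin
    𝔼 (away W?) (λ f → ⟦ edgeInjective? f ⟧ * (1# * ⟦ rootCount f ℕ.≟ k ⟧))
      ≈⟨ 𝔼-congʷ _ (away-cong W? (λ v → covers? (⋃ []) v ⊎-dec W? v) inj₂ elim) ⟩
    𝔼 (away (λ v → covers? (⋃ []) v ⊎-dec W? v)) (λ f → ⟦ edgeInjective? f ⟧ * (1# * ⟦ rootCount f ℕ.≟ k ⟧))
      ≈⟨ 𝔼-cong (away (λ v → covers? (⋃ []) v ⊎-dec W? v)) (λ f → *-congˡ (≈-trans (*-identityˡ _) (reflexive (cong (λ j → ⟦ rootCount f ℕ.≟ j ⟧) (sym (cong (ℕ._+ k) no-vertices)))))) ⟩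
    E
      ≈⟨ *-identityˡ E ⟨
    1# * E
      ≈⟨ *-congʳ (≈-trans (*-identityˡ _) no-edges) ⟨
    1# * ∏ (edgeList []) c * E ∎
    where
    E = 𝔼 (away (λ v → covers? (⋃ []) v ⊎-dec W? v)) (λ f → ⟦ edgeInjective? f ⟧ * ⟦ rootCount f ℕ.≟ size [] ℕ.+ k ⟧)
    uncovered : ∀ {v} → ¬ Covers (⋃ []) v
    uncovered (e , e∈ , _) = ∉⊥ e∈
    elim : ∀ {v} → Covers (⋃ []) v ⊎ W v → W v
    elim (inj₁ cov) = contradiction cov uncovered
    elim (inj₂ w)   = w
    no-vertices : size [] ≡ 0
    no-vertices = ℕ.n≤0⇒n≡0 (unique-⊆-length {ys = []} (Unique.filter⁺ (covers? (⋃ [])) (Unique.allFin⁺ n))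
      λ v∈ → contradiction (proj₂ (∈-filter⁻ (covers? (⋃ [])) {xs = allFin n} v∈)) uncovered)
    no-edges : ∏ (edgeList []) c ≈ 1#
    no-edges = ≈-trans (∏-filter (_∈? ⋃ []) (allFin m) c)
      (≈-trans (∏-cong (allFin m) (λ e → ^⟦⟧-no (e ∈? ⋃ []) ∉⊥)) (∏-one (allFin m)))
  sum-union (D ∷ Cs) (cyc ∷ cycs) (disj ∷ disjs) {W} W? (away-D ∷ aways) k = begin
    𝔼 (away W?) (λ f → ⟦ edgeInjective? f ⟧ * (signed (D ∷ Cs) f * ⟦ rootCount f ℕ.≟ k ⟧))
      ≈⟨ sum-rotating W? away-D disj k cyc ⟩
    t * cycleWeight D * 𝔼 (away B?) (λ f → ⟦ edgeInjective? f ⟧ * (signed Cs f * ⟦ rootCount f ℕ.≟ order D ℕ.+ k ⟧))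
      ≈⟨ *-congˡ (sum-union Cs cycs disjs B? (All.tabulate λ E∈ → far E∈) (order D ℕ.+ k)) ⟩
    t * cycleWeight D * (t ^ length Cs * ∏ (edgeList Cs) c * 𝔼 (away (λ v → covers? (⋃ Cs) v ⊎-dec B? v)) (counted (size Cs ℕ.+ (order D ℕ.+ k))))
      ≈⟨ *-congˡ (*-congˡ (≈-trans
           (𝔼-congʷ _ (away-cong (λ v → covers? (⋃ Cs) v ⊎-dec B? v) (λ v → covers? (⋃ (D ∷ Cs)) v ⊎-dec W? v) to from))
           (𝔼-cong (away (λ v → covers? (⋃ (D ∷ Cs)) v ⊎-dec W? v)) (λ f → reflexive (cong (λ j → counted j f) sizes))))) ⟩
    t * cycleWeight D * (t ^ length Cs * ∏ (edgeList Cs) c * E)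
      ≈⟨ solve 5 (λ a b p q e → a :* b :* (p :* q :* e) := a :* p :* (b :* q) :* e) ≈-refl _ _ _ _ _ ⟩
    t * t ^ length Cs * (cycleWeight D * ∏ (edgeList Cs) c) * E
      ≈⟨ *-congʳ (*-congˡ (edgeWeight-∷ disj)) ⟨
    t * t ^ length Cs * ∏ (edgeList (D ∷ Cs)) c * E ∎
    where
    t = - (1# + 1#)
    B? = beyond? W? away-D
    counted : ℕ → Map → Carrier
    counted j f = ⟦ edgeInjective? f ⟧ * ⟦ rootCount f ℕ.≟ j ⟧
    E = 𝔼 (away (λ v → covers? (⋃ (D ∷ Cs)) v ⊎-dec W? v)) (counted (size (D ∷ Cs) ℕ.+ k))
    far : ∀ {E} → E ∈ˡ Cs → ∀ {v} → Covers E v → ¬ (Covers D v ⊎ W v)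
    far E∈ covE (inj₁ covD) = All.lookup disj E∈ _ (covD , covE)
    far E∈ covE (inj₂ w)    = All.lookup aways E∈ covE w
    to : ∀ {v} → Covers (⋃ Cs) v ⊎ (Covers D v ⊎ W v) → Covers (⋃ (D ∷ Cs)) v ⊎ W v
    to (inj₁ covU)        = inj₁ (covers-∪⁺ {D} {Cs} (inj₂ covU))
    to (inj₂ (inj₁ covD)) = inj₁ (covers-∪⁺ {D} {Cs} (inj₁ covD))
    to (inj₂ (inj₂ w))    = inj₂ w
    from : ∀ {v} → Covers (⋃ (D ∷ Cs)) v ⊎ W v → Covers (⋃ Cs) v ⊎ (Covers D v ⊎ W v)
    from (inj₂ w) = inj₂ (inj₂ w)
    from (inj₁ cov) with covers-∪⁻ {D} {Cs} cov
    ... | inj₁ covD = inj₂ (inj₁ covD)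
    ... | inj₂ covU = inj₁ covU
    sizes : size Cs ℕ.+ (order D ℕ.+ k) ≡ size (D ∷ Cs) ℕ.+ k
    sizes = trans (sym (ℕ.+-assoc (size Cs) _ k))
                  (cong (ℕ._+ k) (trans (ℕ.+-comm (size Cs) _) (sym (size-∷ disj))))

  -- The matchings of the subdivision graph without `W`, times the `x v` for `v` off `W`. Vertices
  -- in `W` are roots of weight one and still counted in `k`.
  matched : {W : Fin n → Set} → (∀ v → Dec (W v)) → ℕ → Carrier
  matched W? k = 𝔼 (away W?) (λ f → ⟦ edgeInjective? f ⟧ * ⟦ rootCount f ℕ.≟ k ⟧)

  nowhere? : ∀ (v : Fin n) → Dec ⊥
  nowhere? _ = no λ ()

  inclusion-exclusion : ∀ k → 𝔼 (away nowhere?) (λ f → ⟦ forest? f ⟧ * ⟦ rootCount f ℕ.≟ k ⟧) ≈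
    matched nowhere? k + ∑ (cycleUnions G) (λ Cs →
      (- (1# + 1#)) ^ length Cs * ∏ (edgeList Cs) c * matched (covers? (⋃ Cs)) (size Cs ℕ.+ k))
  inclusion-exclusion k = begin
    𝔼 ω (λ f → ⟦ forest? f ⟧ * q f)
      ≈⟨ 𝔼-away-cong nowhere? (λ f val _ → ≈-trans (*-congʳ (forest-expansion val)) (≈-trans (distribʳ _ _ _)
           (+-congˡ (≈-trans (≈-sym (∑-*ʳ (q f) (cycleUnions G) _)) (∑-cong (cycleUnions G) (λ _ → *-assoc _ _ _)))))) ⟩
    𝔼 ω (λ f → ⟦ edgeInjective? f ⟧ * q f + ∑ (cycleUnions G) (λ Cs → ⟦ edgeInjective? f ⟧ * (signed Cs f * q f)))
      ≈⟨ ≈-trans (𝔼-+ ω _ _) (+-congˡ (𝔼-∑ ω (cycleUnions G) _)) ⟩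
    matched nowhere? k + ∑ (cycleUnions G) (λ Cs → 𝔼 ω (λ f → ⟦ edgeInjective? f ⟧ * (signed Cs f * q f)))
      ≈⟨ +-congˡ (∑-cong-∈ (cycleUnions G) (λ {Cs} Cs∈ → perUnion Cs (∈-filter⁻ union? {xs = sublists (cycles G)} Cs∈))) ⟩
    _ ∎
    where
    ω = away nowhere?
    q : Map → Carrier
    q f = ⟦ rootCount f ℕ.≟ k ⟧
    union? : ∀ Cs → Dec (1 ≤ length Cs × AllPairs (VertexDisjoint G) Cs)
    union? Cs = (1 ℕ.≤? length Cs) ×-dec allPairs? (vertexDisjoint? G) Cs
    elim : ∀ {A : Set} → A ⊎ ⊥ → A
    elim (inj₁ p) = p
    perUnion : ∀ Cs → Cs ∈ˡ sublists (cycles G) × (1 ≤ length Cs × AllPairs (VertexDisjoint G) Cs) →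
      𝔼 ω (λ f → ⟦ edgeInjective? f ⟧ * (signed Cs f * q f)) ≈
      (- (1# + 1#)) ^ length Cs * ∏ (edgeList Cs) c * matched (covers? (⋃ Cs)) (size Cs ℕ.+ k)
    perUnion Cs (Cs∈ , _ , disj) = ≈-trans
      (sum-union Cs (sublists-All Cs∈ cyclesAll) disj nowhere? (All.tabulate (λ _ _ ())) k)
      (*-congˡ (𝔼-congʷ _ (away-cong (λ v → covers? (⋃ Cs) v ⊎-dec nowhere? v) (covers? (⋃ Cs)) elim inj₁)))

-- Matchings of the subdivision graph

filter-map : ∀ {a b p} {A : Set a} {B : Set b} {P : B → Set p} (P? : Decidable P) (f : A → B) (xs : List A) →
             filter P? (map f xs) ≡ map f (filter (P? ∘ f) xs)
filter-map P? f []       = refl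
filter-map P? f (x ∷ xs) with P? (f x)
... | yes _ = cong (f x ∷_) (filter-map P? f xs)
... | no _  = filter-map P? f xs

sublists-map : ∀ {a b} {A : Set a} {B : Set b} (f : A → B) (xs : List A) → sublists (map f xs) ≡ map (map f) (sublists xs)
sublists-map f []       = refl
sublists-map f (x ∷ xs) = trans (≡.cong₂ _++_ ih (trans (cong (map (f x ∷_)) ih) tails)) (sym (map-++ (map f) (sublists xs) _))
  where
  ih = sublists-map f xs
  tails : map (f x ∷_) (map (map f) (sublists xs)) ≡ map (map f) (map (x ∷_) (sublists xs))
  tails = trans (sym (map-∘ (sublists xs))) (map-∘ (sublists xs))

rootless : ∀ n {m} → ParentMap n m
rootless n = Vec.replicate n nothing

rootCount-rootless : ∀ n {m} → rootCount (rootless n {m}) ≡ n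
rootCount-rootless zero        = refl
rootCount-rootless (suc n) {m} = cong suc (rootCount-rootless n {m})

rootCount≤n : ∀ {n m} (f : ParentMap n m) → rootCount f ≤ n
rootCount≤n []            = z≤n
rootCount≤n (nothing ∷ f) = s≤s (rootCount≤n f)
rootCount≤n (just _ ∷ f)  = ℕ.m≤n⇒m≤1+n (rootCount≤n f)

module HalfEdges {a ℓ₁ ℓ₂ ℓ₃ : Level} (F : OrderedField a ℓ₁ ℓ₂ ℓ₃) {n m : ℕ}
                 (wt : Fin n × Fin m → OrderedField.Carrier F) where
  open Sums F
  open WeightedSums F m
  open Assignments {n} {m}

  _≟ʰ_ : ∀ (h h' : Fin n × Fin m) → Dec (h ≡ h')
  _≟ʰ_ = Product.≡-dec Fin._≟_ Fin._≟_

  -- Summing over the occurrences in the list makes the weight additive in `hs`, on which the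
  -- induction of `∑-sublists` relies.
  owning : Assignment → Weight n
  owning hs v nothing  = 1#
  owning hs v (just e) = ∑ hs (λ h → ⟦ h ≟ʰ (v , e) ⟧ * wt h)

  𝔼-root : ∀ {k} (g : ParentMap k m → Carrier) → 𝔼 (λ _ → root) g ≈ g (rootless k)
  𝔼-root {zero}  g = ≈-refl
  𝔼-root {suc k} g = begin
    ∑ choices (λ b → root b * 𝔼 (λ _ → root) (λ f → g (b ∷ f)))
      ≈⟨ ∑-choices (λ b → root b * 𝔼 (λ _ → root) (λ f → g (b ∷ f))) ⟩
    1# * 𝔼 (λ _ → root) (λ f → g (nothing ∷ f)) + ∑ (allFin m) (λ e → 0# * 𝔼 (λ _ → root) (λ f → g (just e ∷ f)))
      ≈⟨ +-cong (≈-trans (*-identityˡ _) (𝔼-root (λ f → g (nothing ∷ f)))) (∑-vanish (allFin m) _) ⟩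
    g (rootless (suc k)) + 0#
      ≈⟨ +-identityʳ _ ⟩
    g (rootless (suc k)) ∎

  keys! : ∀ (M : Assignment) → Dec (Unique (map proj₁ M))
  keys! M = DecUnique.unique? Fin._≟_ (map proj₁ M)

  owning-∷ : ∀ v e hs b → owning ((v , e) ∷ hs) v b ≈ owning hs v b + ⟦ just e ≟ᵐ b ⟧ * wt (v , e)
  owning-∷ v e hs nothing   = ≈-sym (≈-trans (+-congˡ (zeroˡ _)) (+-identityʳ _))
  owning-∷ v e hs (just e') = ≈-trans (+-comm _ _) (+-congˡ (*-congʳ
    (⟦⟧-cong ((v , e) ≟ʰ (v , e')) (just e ≟ᵐ just e') (λ { refl → refl }) (λ { refl → refl }))))

  -- Half-edges with distinct vertices form a parent map. In the induction, a selection either omits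
  -- `(v , e)`, or contains it and leaves `v` free otherwise; this adds `e` to the options at `v`.
  ∑-sublists : ∀ hs (I : ParentMap n m → Carrier) →
    ∑ (sublists hs) (λ M → ⟦ keys! M ⟧ * (∏ M wt * I (rootless n ◂ M))) ≈ 𝔼 (owning hs) I
  ∑-sublists [] I = begin
    1# * (1# * I (rootless n)) + 0#  ≈⟨ ≈-trans (+-identityʳ _) (≈-trans (*-identityˡ _) (*-identityˡ _)) ⟩
    I (rootless n)                   ≈⟨ 𝔼-root I ⟨
    𝔼 (λ _ → root) I                 ≈⟨ 𝔼-congʷ I (λ { v nothing → ≈-refl ; v (just e) → ≈-refl }) ⟩
    𝔼 (owning []) I                  ∎
  ∑-sublists ((v , e) ∷ hs) I = begin
    ∑ (sublists hs ++ map ((v , e) ∷_) (sublists hs)) t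
      ≈⟨ ∑-++ (sublists hs) _ t ⟩
    ∑ (sublists hs) t + ∑ (map ((v , e) ∷_) (sublists hs)) t
      ≈⟨ +-cong (∑-sublists hs I) (∑-map ((v , e) ∷_) (sublists hs) t) ⟩
    𝔼 (owning hs) I + ∑ (sublists hs) (λ M → t ((v , e) ∷ M))
      ≈⟨ +-congˡ (≈-trans (∑-cong (sublists hs) extend) (∑-*ˡ (wt (v , e)) (sublists hs) _)) ⟩
    𝔼 (owning hs) I + wt (v , e) * ∑ (sublists hs) (λ M → ⟦ keys! M ⟧ * (∏ M wt * I⁺ (rootless n ◂ M)))
      ≈⟨ +-congˡ (*-congˡ (≈-trans (∑-sublists hs I⁺) (≈-trans (𝔼-fix v nothing (owning hs) _) (*-identityˡ _)))) ⟩
    𝔼 (owning hs) I + wt (v , e) * 𝔼 ω (λ f → I ((f [ v ]≔ nothing) [ v ]≔ just e))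
      ≈⟨ +-cong (𝔼-split v (owning hs) I) (*-congˡ (𝔼-cong ω λ f →
           reflexive (cong I (Vec.updateAt-updateAt v f)))) ⟩
    𝔼 ω (λ f → ∑ choices λ b → owning hs v b * I (f [ v ]≔ b)) + wt (v , e) * 𝔼 ω (λ f → I (f [ v ]≔ just e))
      ≈⟨ ≈-trans (𝔼-+ ω _ _) (+-congˡ (𝔼-*ˡ ω (wt (v , e)) _)) ⟨
    𝔼 ω (λ f → (∑ choices λ b → owning hs v b * I (f [ v ]≔ b)) + wt (v , e) * I (f [ v ]≔ just e))
      ≈⟨ 𝔼-cong ω (λ f → merge f) ⟩
    𝔼 ω (λ f → ∑ choices λ b → owning ((v , e) ∷ hs) v b * I (f [ v ]≔ b))
      ≈⟨ 𝔼-congʷ _ same ⟩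
    𝔼 (updateAt (owning ((v , e) ∷ hs)) v (const root)) (λ f → ∑ choices λ b → owning ((v , e) ∷ hs) v b * I (f [ v ]≔ b))
      ≈⟨ 𝔼-split v (owning ((v , e) ∷ hs)) I ⟨
    𝔼 (owning ((v , e) ∷ hs)) I ∎
    where
    t : Assignment → Carrier
    t M = ⟦ keys! M ⟧ * (∏ M wt * I (rootless n ◂ M))
    I⁺ : ParentMap n m → Carrier
    I⁺ f = ⟦ nothing ≟ᵐ lookup f v ⟧ * I (f [ v ]≔ just e)
    ω = updateAt (owning hs) v (const root)

    free : ∀ M → v ∉ˡ map proj₁ M → nothing ≡ lookup (rootless n ◂ M) v
    free M v∉ = sym (trans (◂-∉ M (rootless n) v∉) (Vec.lookup-replicate v nothing))

    extend : ∀ M → t ((v , e) ∷ M) ≈ wt (v , e) * (⟦ keys! M ⟧ * (∏ M wt * I⁺ (rootless n ◂ M)))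
    extend M = begin
      ⟦ keys! ((v , e) ∷ M) ⟧ * (wt (v , e) * ∏ M wt * y)
        ≈⟨ *-congʳ (≈-trans
             (⟦⟧-cong (keys! ((v , e) ∷ M)) (keys! M ×-dec (nothing ≟ᵐ lookup (rootless n ◂ M) v))
               (λ { (v∉ ∷ M!) → M! , free M (λ v∈ → All.lookup v∉ v∈ refl) })
               (λ (M! , r) → All.tabulate (λ { v∈ refl → taken M! r (∈-map⁻ proj₁ v∈) }) ∷ M!))
             (⟦⟧-× (keys! M) (nothing ≟ᵐ lookup (rootless n ◂ M) v))) ⟩
      ⟦ keys! M ⟧ * ⟦ nothing ≟ᵐ lookup (rootless n ◂ M) v ⟧ * (wt (v , e) * ∏ M wt * y)
        ≈⟨ solve 5 (λ k r w p y → k :* r :* (w :* p :* y) := w :* (k :* (p :* (r :* y)))) ≈-refl _ _ _ _ _ ⟩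
      wt (v , e) * (⟦ keys! M ⟧ * (∏ M wt * (⟦ nothing ≟ᵐ lookup (rootless n ◂ M) v ⟧ * y))) ∎
      where
      y = I ((rootless n ◂ M) [ v ]≔ just e)
      taken : ∀ {v} → Unique (map proj₁ M) → nothing ≡ lookup (rootless n ◂ M) v → (∃ λ h → h ∈ˡ M × v ≡ proj₁ h) → ⊥
      taken M! r ((_ , e') , h∈ , refl) = contradiction (trans r (◂-∈ M (rootless n) M! h∈)) λ ()

    merge : ∀ f → (∑ choices λ b → owning hs v b * I (f [ v ]≔ b)) + wt (v , e) * I (f [ v ]≔ just e) ≈
                  ∑ choices λ b → owning ((v , e) ∷ hs) v b * I (f [ v ]≔ b)
    merge f = begin
      _ + wt (v , e) * I (f [ v ]≔ just e)
        ≈⟨ +-congˡ (∑-choices-δ (just e) (λ b → wt (v , e) * I (f [ v ]≔ b))) ⟨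
      _ + ∑ choices (λ b → ⟦ just e ≟ᵐ b ⟧ * (wt (v , e) * I (f [ v ]≔ b)))
        ≈⟨ ∑-+ choices _ _ ⟨
      ∑ choices (λ b → owning hs v b * I (f [ v ]≔ b) + ⟦ just e ≟ᵐ b ⟧ * (wt (v , e) * I (f [ v ]≔ b)))
        ≈⟨ ∑-cong choices (λ b → ≈-trans (≈-trans (+-congˡ (≈-sym (*-assoc _ _ _))) (≈-sym (distribʳ _ _ _)))
                                         (*-congʳ (≈-sym (owning-∷ v e hs b)))) ⟩
      ∑ choices (λ b → owning ((v , e) ∷ hs) v b * I (f [ v ]≔ b)) ∎

    same : ∀ w b → ω w b ≈ updateAt (owning ((v , e) ∷ hs)) v (const root) w b
    same w b with w Fin.≟ v
    ... | yes refl = reflexive (trans (cong (λ h → h b) (updateAt-updates w (owning hs)))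
                                      (sym (cong (λ h → h b) (updateAt-updates w (owning ((v , e) ∷ hs))))))
    ... | no w≢v   = ≈-trans (reflexive (cong (λ h → h b) (updateAt-minimal w v (owning hs) w≢v)))
      (≈-trans (fresh b) (reflexive (sym (cong (λ h → h b) (updateAt-minimal w v (owning ((v , e) ∷ hs)) w≢v)))))
      where
      fresh : ∀ b → owning hs w b ≈ owning ((v , e) ∷ hs) w b
      fresh nothing   = ≈-refl
      fresh (just e') = ≈-sym (≈-trans (+-congʳ (≈-trans
        (*-congʳ (⟦⟧-no ((v , e) ≟ʰ (w , e')) (λ { refl → w≢v refl }))) (zeroˡ _))) (+-identityˡ _))

module Matchings {a ℓ₁ ℓ₂ ℓ₃ : Level} (F : OrderedField a ℓ₁ ℓ₂ ℓ₃) {n m : ℕ} (G : Graph n m)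
                 (wt : Fin n × Fin m → OrderedField.Carrier F) where
  open Sums F
  open WeightedSums F m
  open Assignments {n} {m}
  open HalfEdges F {n} {m} wt
  open Parents G

  halfEdge : Fin n × Fin m → WeightedEdge (Fin n ⊎ Fin m)
  halfEdge (v , e) = edge (inj₁ v) (inj₂ e) (wt (v , e))

  module _ {M : Assignment} (M! : Unique (map proj₁ M)) where

    private
      f = rootless n ◂ M

      lookup⁻ : ∀ {v e} → lookup f v ≡ just e → (v , e) ∈ˡ M
      lookup⁻ {v} fv with v ∈ˡ? map proj₁ M
      ... | no v∉ = contradiction (trans (sym fv) (trans (◂-∉ M (rootless n) v∉) (Vec.lookup-replicate v nothing))) λ ()
      ... | yes v∈ with ∈-map⁻ proj₁ v∈
      ... | (_ , e') , p , refl with trans (sym fv) (◂-∈ M (rootless n) M! p)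
      ... | refl = p

    edges-unique⇒injective : Unique (map proj₂ M) → EdgeInjective f
    edges-unique⇒injective E! v w eq = cases (lookup f v) refl
      where
      cases : ∀ b → lookup f v ≡ b → lookup f v ≡ nothing ⊎ v ≡ w
      cases nothing  fv = inj₁ fv
      cases (just e) fv = inj₂ (cong proj₁ (unique-map-injective proj₂ E! (lookup⁻ fv) (lookup⁻ (trans (sym eq) fv)) refl))

    injective⇒edges-unique : EdgeInjective f → Unique (map proj₂ M)
    injective⇒edges-unique inj = unique-map-on proj₂ (Unique.map⁻ M!) λ { {v , e} {w , _} p q refl →
      cong (_, e) (owner-unique f inj (◂-∈ M (rootless n) M! p) (◂-∈ M (rootless n) M! q)) }

    rootCount-matching : n ≡ length M ℕ.+ rootCount f
    rootCount-matching = trans (sym (rootCount-rootless n {m}))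
      (rootCount-◂ M (rootless n) M! (λ {v} _ → Vec.lookup-replicate v nothing))

  private
    _≟ᵛ_ = ⊎-≡-dec (Fin._≟_ {n}) (Fin._≟_ {m})
    Independent : Assignment → Set a
    Independent M = AllPairs (NoCommonEnd _≟ᵛ_) (map halfEdge M)

    independent⇒unique : ∀ {M} → Independent M → Unique (map proj₁ M) × Unique (map proj₂ M)
    independent⇒unique ind =
      AllPairs.map⁺ (AllPairs.map (λ (p , _) eq → p (cong inj₁ eq)) (AllPairs.map⁻ ind)) ,
      AllPairs.map⁺ (AllPairs.map (λ (_ , _ , _ , q) eq → q (cong inj₂ eq)) (AllPairs.map⁻ ind))

    unique⇒independent : ∀ {M} → Unique (map proj₁ M) → Unique (map proj₂ M) → Independent M
    unique⇒independent M! E! = AllPairs.map⁺ (AllPairs.zipWith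
      (λ (p , q) → (λ { refl → p refl }) , (λ ()) , (λ ()) , (λ { refl → q refl }))
      (AllPairs.map⁻ M! , AllPairs.map⁻ E!))

  counted : ℕ → Map → Carrier
  counted k f = ⟦ edgeInjective? f ⟧ * ⟦ rootCount f ℕ.≟ k ⟧

  -- Distinct ends in `G` make a matching a parent map, distinct ends e* make this map
  -- edge-injective, and its `k` roots are the vertices of `G` that remain unmatched.
  matchings-sum : (H : WeightedGraph (Fin n ⊎ Fin m)) (hs : Assignment) → WeightedGraph.edges H ≡ map halfEdge hs →
    ∀ j k → j ℕ.+ k ≡ n → matchingWeight _≟ᵛ_ H (+ j) ≈ 𝔼 (owning hs) (counted k)
  matchings-sum H hs eq j k jk = begin
    ∑ (matchings _≟ᵛ_ H j) (λ M → ∏ M weight)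
      ≈⟨ ∑-filter good? (sublists (WeightedGraph.edges H)) _ ⟩
    ∑ (sublists (WeightedGraph.edges H)) (λ M → ⟦ good? M ⟧ * ∏ M weight)
      ≡⟨ cong (λ es → ∑ es (λ M → ⟦ good? M ⟧ * ∏ M weight)) (trans (cong sublists eq) (sublists-map halfEdge hs)) ⟩
    ∑ (map (map halfEdge) (sublists hs)) (λ M → ⟦ good? M ⟧ * ∏ M weight)
      ≈⟨ ∑-map (map halfEdge) (sublists hs) _ ⟩
    ∑ (sublists hs) (λ M → ⟦ good? (map halfEdge M) ⟧ * ∏ (map halfEdge M) weight)
      ≈⟨ ∑-cong (sublists hs) perMatching ⟩
    ∑ (sublists hs) (λ M → ⟦ keys! M ⟧ * (∏ M wt * counted k (rootless n ◂ M)))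
      ≈⟨ ∑-sublists hs (counted k) ⟩
    𝔼 (owning hs) (counted k) ∎
    where
    open WeightedEdge
    good? : ∀ M → Dec (length M ≡ j × AllPairs (NoCommonEnd _≟ᵛ_) M)
    good? M = (length M ℕ.≟ j) ×-dec allPairs? (noCommonEnd? _≟ᵛ_) M
    perMatching : ∀ M → ⟦ good? (map halfEdge M) ⟧ * ∏ (map halfEdge M) weight ≈
                        ⟦ keys! M ⟧ * (∏ M wt * counted k (rootless n ◂ M))
    perMatching M = begin
      ⟦ good? (map halfEdge M) ⟧ * ∏ (map halfEdge M) weight
        ≈⟨ *-cong (⟦⟧-cong (good? (map halfEdge M)) (keys! M ×-dec (i? ×-dec r?)) to from) (∏-map halfEdge M weight) ⟩
      ⟦ keys! M ×-dec (i? ×-dec r?) ⟧ * ∏ M wt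
        ≈⟨ *-congʳ (≈-trans (⟦⟧-× (keys! M) (i? ×-dec r?)) (*-congˡ (⟦⟧-× i? r?))) ⟩
      ⟦ keys! M ⟧ * counted k (rootless n ◂ M) * ∏ M wt
        ≈⟨ solve 3 (λ p q r → p :* q :* r := p :* (r :* q)) ≈-refl _ _ _ ⟩
      ⟦ keys! M ⟧ * (∏ M wt * counted k (rootless n ◂ M)) ∎
      where
      i? = edgeInjective? (rootless n ◂ M)
      r? = rootCount (rootless n ◂ M) ℕ.≟ k
      to : length (map halfEdge M) ≡ j × Independent M →
           Unique (map proj₁ M) × (EdgeInjective (rootless n ◂ M) × rootCount (rootless n ◂ M) ≡ k)
      to (len , ind) with independent⇒unique {M} ind
      ... | M! , E! = M! , edges-unique⇒injective M! E! , ℕ.+-cancelˡ-≡ j _ _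
        (trans (cong (ℕ._+ rootCount (rootless n ◂ M)) (trans (sym len) (length-map halfEdge M)))
               (trans (sym (rootCount-matching M!)) (sym jk)))
      from : Unique (map proj₁ M) × (EdgeInjective (rootless n ◂ M) × rootCount (rootless n ◂ M) ≡ k) →
             length (map halfEdge M) ≡ j × Independent M
      from (M! , inj , rc) = trans (length-map halfEdge M) (ℕ.+-cancelʳ-≡ k (length M) j
          (trans (cong (length M ℕ.+_) (sym rc)) (trans (sym (rootCount-matching M!)) (sym jk)))) ,
        unique⇒independent M! (injective⇒edges-unique M! inj)

  -- For `k` above `n` the size is negative and the matching weight zero by definition; the sum is
  -- zero as well, since no map has more than `n` roots.
  matchingWeight-𝔼 : (H : WeightedGraph (Fin n ⊎ Fin m)) (hs : Assignment) → WeightedGraph.edges H ≡ map halfEdge hs →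
    ∀ k → matchingWeight _≟ᵛ_ H (n ⊖ k) ≈ 𝔼 (owning hs) (counted k)
  matchingWeight-𝔼 H hs eq k with k ℕ.≤? n
  ... | yes k≤n = ≈-trans (reflexive (cong (matchingWeight _≟ᵛ_ H) (ℤ.⊖-≥ k≤n)))
                          (matchings-sum H hs eq (n ℕ.∸ k) k (ℕ.m∸n+n≡m k≤n))
  ... | no k≰n  = ≈-trans (negative (k ℕ.∸ n) (ℕ.m<n⇒0<n∸m (ℕ.≰⇒> k≰n)) (ℤ.⊖-< (ℕ.≰⇒> k≰n))) (≈-sym (begin
      𝔼 (owning hs) (counted k)
        ≈⟨ 𝔼-cong (owning hs) (λ f → ≈-trans (*-congˡ (⟦⟧-no (rootCount f ℕ.≟ k)
             (λ rc → k≰n (subst (_≤ n) rc (rootCount≤n f))))) (*-comm _ _)) ⟩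
      𝔼 (owning hs) (λ f → 0# * ⟦ edgeInjective? f ⟧)
        ≈⟨ 𝔼-*ˡ (owning hs) 0# _ ⟩
      0# * _
        ≈⟨ zeroˡ _ ⟩
      0# ∎))
    where
    -- That `d` is positive matters: at size zero the empty matching would contribute one.
    negative : ∀ d → 0 ℕ.< d → n ⊖ k ≡ ℤ.- (+ d) → matchingWeight _≟ᵛ_ H (n ⊖ k) ≈ 0#
    negative (suc d) _ eq = reflexive (cong (matchingWeight _≟ᵛ_ H) eq)

module SubdivisionMatchings {a ℓ₁ ℓ₂ ℓ₃ : Level} (F : OrderedField a ℓ₁ ℓ₂ ℓ₃) {n m : ℕ} (G : Graph n m)
    (c : Fin m → OrderedField.Carrier F) (x : Fin n → OrderedField.Carrier F)
    (x>0 : ∀ v → OrderedField._<_ F (OrderedField.0# F) (x v)) where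
  open Sums F
  open Products F
  open WeightedSums F m
  open Graph G
  open Assignments {n} {m}
  open InclusionExclusion F G c x
  open CycleUnion G

  x⁻¹ : Fin n → Carrier
  x⁻¹ v = inverse (pos⇒#0 (x>0 v))

  -- `inverse` comes from the apartness of `y` and `0#`, and so inverts the difference `y - 0#`.
  inverse-* : ∀ {y} (y#0 : y # 0#) → y * inverse y#0 ≈ 1#
  inverse-* {y} y#0 = ≈-trans (*-congʳ (≈-sym (≈-trans (+-congˡ -0#≈0#) (+-identityʳ y)))) (proj₂ (proj₂ (#⇒invertible y#0)))

  wt : Fin n × Fin m → Carrier
  wt (v , e) = c e * x⁻¹ v

  open HalfEdges F {n} {m} wt
  open Matchings F G wt

  halfEdges : Assignment
  halfEdges = concatMap (λ e → (src e , e) ∷ (tgt e , e) ∷ []) (allFin m)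

  subdivision-edges : WeightedGraph.edges (subdivision G c x x>0) ≡ map halfEdge halfEdges
  subdivision-edges = sym (map-concatMap halfEdge (λ e → (src e , e) ∷ (tgt e , e) ∷ []) (allFin m))

  -- Both halves of an edge are listed, and as there are no loops, at most one of them is at `v`.
  ∑-halfEdges : ∀ v e → ∑ halfEdges (λ h → ⟦ h ≟ʰ (v , e) ⟧) ≈ ⟦ v ∈ₑ? e ⟧
  ∑-halfEdges v e = begin
    ∑ halfEdges (λ h → ⟦ h ≟ʰ (v , e) ⟧)
      ≈⟨ ∑-concatMap (λ e → (src e , e) ∷ (tgt e , e) ∷ []) (allFin m) _ ⟩
    ∑ (allFin m) (λ e' → ⟦ (src e' , e') ≟ʰ (v , e) ⟧ + (⟦ (tgt e' , e') ≟ʰ (v , e) ⟧ + 0#))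
      ≈⟨ ∑-cong (allFin m) (λ e' → ≈-trans (+-cong (at src e') (≈-trans (+-identityʳ _) (at tgt e'))) (≈-sym (distribˡ _ _ _))) ⟩
    ∑ (allFin m) (λ e' → ⟦ e Fin.≟ e' ⟧ * (⟦ src e' Fin.≟ v ⟧ + ⟦ tgt e' Fin.≟ v ⟧))
      ≈⟨ ∑-δ e _ ⟩
    ⟦ src e Fin.≟ v ⟧ + ⟦ tgt e Fin.≟ v ⟧
      ≈⟨ ⟦⟧-⊎ (src e Fin.≟ v) (tgt e Fin.≟ v) (λ (p , q) → loopless e (trans p (sym q))) ⟨
    ⟦ v ∈ₑ? e ⟧ ∎
    where
    at : ∀ (end : Fin m → Fin n) e' → ⟦ (end e' , e') ≟ʰ (v , e) ⟧ ≈ ⟦ e Fin.≟ e' ⟧ * ⟦ end e' Fin.≟ v ⟧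
    at end e' = ≈-trans (⟦⟧-cong ((end e' , e') ≟ʰ (v , e)) ((e Fin.≟ e') ×-dec (end e' Fin.≟ v))
      (λ { refl → refl , refl }) (λ { (refl , refl) → refl })) (⟦⟧-× (e Fin.≟ e') (end e' Fin.≟ v))

  owning-filter : ∀ {p} {K : Fin n × Fin m → Set p} (K? : Decidable K) v e →
    owning (filter K? halfEdges) v (just e) ≈ ⟦ K? (v , e) ⟧ * (⟦ v ∈ₑ? e ⟧ * wt (v , e))
  owning-filter K? v e = begin
    ∑ (filter K? halfEdges) (λ h → ⟦ h ≟ʰ (v , e) ⟧ * wt h)
      ≈⟨ ∑-filter K? halfEdges _ ⟩
    ∑ halfEdges (λ h → ⟦ K? h ⟧ * (⟦ h ≟ʰ (v , e) ⟧ * wt h))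
      ≈⟨ ∑-cong halfEdges (λ h → ≈-trans (x∙yz≈y∙xz _ _ _)
           (⟦⟧-guard (h ≟ʰ (v , e)) (λ { refl → ≈-refl {⟦ K? (v , e) ⟧ * wt (v , e)} }))) ⟩
    ∑ halfEdges (λ h → ⟦ h ≟ʰ (v , e) ⟧ * (⟦ K? (v , e) ⟧ * wt (v , e)))
      ≈⟨ ∑-*ʳ _ halfEdges _ ⟩
    ∑ halfEdges (λ h → ⟦ h ≟ʰ (v , e) ⟧) * (⟦ K? (v , e) ⟧ * wt (v , e))
      ≈⟨ ≈-trans (*-congʳ (∑-halfEdges v e)) (x∙yz≈y∙xz _ _ _) ⟩
    ⟦ K? (v , e) ⟧ * (⟦ v ∈ₑ? e ⟧ * wt (v , e)) ∎

  -- x_v scales the weight of vertex v: a root then weighs x_v, and a half-edge (c_e / x_v) weighs c_e.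
  matched-owning : ∀ {W : Fin n → Set} (W? : ∀ v → Dec (W v)) {p} {K : Fin n × Fin m → Set p} (K? : Decidable K) →
    (∀ {v e} → W v → ¬ K (v , e)) → (∀ {v e} → ¬ W v → v ∈ₑ e → K (v , e)) → ∀ k →
    matched W? k ≈ 𝔼 (owning (filter K? halfEdges)) (counted k) * ∏ (filter (¬? ∘ W?) (allFin n)) x
  matched-owning {W} W? {K = K} K? W⇒¬K ¬W⇒K k = begin
    𝔼 (away W?) (counted k)
      ≈⟨ 𝔼-congʷ _ scaled ⟩
    𝔼 (λ v b → ξ v * owning (filter K? halfEdges) v b) (counted k)
      ≈⟨ 𝔼-scale ξ (owning (filter K? halfEdges)) (counted k) ⟩
    ∏ (allFin n) ξ * 𝔼 (owning (filter K? halfEdges)) (counted k)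
      ≈⟨ ≈-trans (*-comm _ _) (*-congˡ (≈-sym (∏-filter (¬? ∘ W?) (allFin n) x))) ⟩
    𝔼 (owning (filter K? halfEdges)) (counted k) * ∏ (filter (¬? ∘ W?) (allFin n)) x ∎
    where
    ξ : Fin n → Carrier
    ξ v = x v ^⟦ ¬? (W? v) ⟧
    scaled : ∀ v b → away W? v b ≈ ξ v * owning (filter K? halfEdges) v b
    scaled v nothing  = ≈-sym (*-identityʳ _)
    scaled v (just e) = ≈-trans (cases (W? v) (v ∈ₑ? e)) (*-congˡ (≈-sym (owning-filter K? v e)))
      where
      cases : (w : Dec (W v)) (i : Dec (v ∈ₑ e)) →
              ⟦ ¬? w ⟧ * (⟦ i ⟧ * c e) ≈ x v ^⟦ ¬? w ⟧ * (⟦ K? (v , e) ⟧ * (⟦ i ⟧ * wt (v , e)))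
      cases (yes w) i        = ≈-trans (zeroˡ _) (≈-sym (≈-trans (*-identityˡ _)
        (≈-trans (*-congʳ (⟦⟧-no (K? (v , e)) (W⇒¬K w))) (zeroˡ _))))
      cases (no _)  (no _)   = ≈-trans (≈-trans (*-congˡ (zeroˡ _)) (zeroʳ _))
        (≈-sym (≈-trans (*-congˡ (≈-trans (*-congˡ (zeroˡ _)) (zeroʳ _))) (zeroʳ _)))
      cases (no ¬w) (yes v∈) = begin
        1# * (1# * c e)            ≈⟨ ≈-trans (*-identityˡ _) (*-identityˡ _) ⟩
        c e                        ≈⟨ *-identityʳ _ ⟨
        c e * 1#                   ≈⟨ *-congˡ (inverse-* (pos⇒#0 (x>0 v))) ⟨
        c e * (x v * x⁻¹ v)        ≈⟨ x∙yz≈y∙xz _ _ _ ⟩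
        x v * (c e * x⁻¹ v)        ≈⟨ *-congˡ (≈-trans (*-congʳ (⟦⟧-yes (K? (v , e)) (¬W⇒K ¬w v∈)))
                                        (≈-trans (*-identityˡ _) (*-identityˡ _))) ⟨
        x v * (⟦ K? (v , e) ⟧ * (1# * wt (v , e))) ∎

  private
    filter-all : ∀ {b} {A : Set b} (xs : List A) → filter (λ _ → yes tt) xs ≡ xs
    filter-all []       = refl
    filter-all (y ∷ ys) = cong (y ∷_) (filter-all ys)

  matched-subdivision : ∀ k → matched nowhere? k ≈ m[ subdivision G c x x>0 , n ⊖ k ] * ∏ (allFin n) x
  matched-subdivision k = ≈-trans (matched-owning nowhere? {K = λ _ → Unit} (λ _ → yes tt) (λ ()) (λ _ _ → tt) k) (*-cong
    (≈-sym (matchingWeight-𝔼 (subdivision G c x x>0) _ (trans subdivision-edges (cong (map halfEdge) (sym (filter-all halfEdges)))) k))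
    (≈-trans (∏-filter (¬? ∘ nowhere?) (allFin n) x) (∏-cong (allFin n) (λ _ → ≈-refl))))

  matched-deletion : ∀ Cs k → matched (covers? (⋃ Cs)) k ≈
    m[ subdivision G c x x>0 ∖ subdivisionVertices Cs , n ⊖ k ] * ∏ (outsideVertexList Cs) x
  matched-deletion Cs k = ≈-trans (matched-owning (covers? (⋃ Cs)) K? covered uncovered k) (*-congʳ
    (≈-sym (matchingWeight-𝔼 (subdivision G c x x>0 ∖ subdivisionVertices Cs) _
      (trans (cong (filter E?) subdivision-edges) (filter-map E? halfEdge halfEdges)) k)))
    where
    open DecMembership (⊎-≡-dec (Fin._≟_ {n}) (Fin._≟_ {m})) using (_∉?_)
    open WeightedEdge
    S = subdivisionVertices Cs
    E? : ∀ e → Dec (end₁ e ∉ˡ S × end₂ e ∉ˡ S)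
    E? e = (end₁ e ∉? S) ×-dec (end₂ e ∉? S)
    K? = E? ∘ halfEdge
    covered : ∀ {v e} → Covers (⋃ Cs) v → ¬ (inj₁ v ∉ˡ S × inj₂ e ∉ˡ S)
    covered cov (v∉ , _) = v∉ (∈-++⁺ˡ (∈-map⁺ inj₁ (∈-filter⁺ (covers? (⋃ Cs)) (∈-allFin _) cov)))
    -- An edge of the union has both ends on it, so a half-edge at a vertex off the union survives
    -- the deletion of the vertices e* too.
    uncovered : ∀ {v e} → ¬ Covers (⋃ Cs) v → v ∈ₑ e → inj₁ v ∉ˡ S × inj₂ e ∉ˡ S
    uncovered {v} {e} ¬cov v∈e = (λ p → vertex (∈-++⁻ (map inj₁ (vertexList Cs)) p)) , (λ p → edge′ (∈-++⁻ (map inj₁ (vertexList Cs)) p))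
      where
      vertex : inj₁ v ∈ˡ map inj₁ (vertexList Cs) ⊎ inj₁ v ∈ˡ map inj₂ (edgeList Cs) → ⊥
      vertex (inj₁ p) with ∈-map⁻ inj₁ p
      ... | _ , q , refl = ¬cov (proj₂ (∈-filter⁻ (covers? (⋃ Cs)) {xs = allFin n} q))
      vertex (inj₂ p) with ∈-map⁻ inj₂ p
      ... | _ , _ , ()
      edge′ : inj₂ e ∈ˡ map inj₁ (vertexList Cs) ⊎ inj₂ e ∈ˡ map inj₂ (edgeList Cs) → ⊥
      edge′ (inj₁ p) with ∈-map⁻ inj₁ p
      ... | _ , _ , ()
      edge′ (inj₂ p) with ∈-map⁻ inj₂ p
      ... | _ , q , refl = ¬cov (e , proj₂ (∈-filter⁻ (_∈? ⋃ Cs) {xs = allFin m} q) , v∈e)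

-- The Kirchhoff index

roots : ∀ {n m} → ParentMap n m → List (Fin n)
roots {n} f = filter (λ v → lookup f v ≟ᵐ nothing) (allFin n)

length-roots : ∀ {n m} (f : ParentMap n m) → length (roots f) ≡ rootCount f
length-roots [] = refl
length-roots {suc n} (b ∷ f) = head b
  where
  tail : ∀ b → length (filter (λ v → lookup (b ∷ f) v ≟ᵐ nothing) (tabulate {n = n} suc)) ≡ rootCount f
  tail b = trans (cong (λ vs → length (filter (λ v → lookup (b ∷ f) v ≟ᵐ nothing) vs)) (sym (map-tabulate id suc)))
    (trans (cong length (filter-map (λ v → lookup (b ∷ f) v ≟ᵐ nothing) suc (allFin n)))
      (trans (length-map suc (roots f)) (length-roots f)))
  head : ∀ b → length (roots (b ∷ f)) ≡ rootCount (b ∷ f)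
  head nothing  = cong suc (tail nothing)
  head (just e) = tail (just e)

module RootPairs {a ℓ₁ ℓ₂ ℓ₃ : Level} (F : OrderedField a ℓ₁ ℓ₂ ℓ₃) {n m : ℕ} where
  open Sums F

  -- The root set is prescribed vertex by vertex so that `𝔼-restrict` can move the condition into
  -- the weight.
  RootIn : List (Fin n) → Fin n → Maybe (Fin m) → Set
  RootIn R v nothing  = v ∈ˡ R
  RootIn R v (just _) = v ∉ˡ R

  rootIn? : ∀ R v b → Dec (RootIn R v b)
  rootIn? R v nothing  = v ∈ˡ? R
  rootIn? R v (just _) = ¬? (v ∈ˡ? R)

  RootSet : List (Fin n) → ParentMap n m → Set
  RootSet R f = ∀ v → RootIn R v (lookup f v)

  rootSet? : ∀ R f → Dec (RootSet R f)
  rootSet? R f = Fin.all? λ v → rootIn? R v (lookup f v)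

  rootSet⁻ : ∀ {R f} → RootSet R f → ∀ {v} → v ∈ˡ R → v ∈ˡ roots f
  rootSet⁻ {R} {f} rs {v} v∈ = ∈-filter⁺ (λ v → lookup f v ≟ᵐ nothing) (∈-allFin v) (cases (lookup f v) (rs v))
    where
    cases : ∀ b → RootIn R v b → b ≡ nothing
    cases nothing  _  = refl
    cases (just _) v∉ = contradiction v∈ v∉

  rootSet⁺ : ∀ {R f} → RootSet R f → ∀ {v} → v ∈ˡ roots f → v ∈ˡ R
  rootSet⁺ {R} {f} rs {v} v∈ = subst (RootIn R v) (proj₂ (∈-filter⁻ (λ v → lookup f v ≟ᵐ nothing) {xs = allFin n} v∈)) (rs v)

  rootSet : ∀ {R} f → (∀ {v} → v ∈ˡ R → v ∈ˡ roots f) → (∀ {v} → v ∈ˡ roots f → v ∈ˡ R) → RootSet R f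
  rootSet {R} f to from v with lookup f v in fv
  ... | nothing = from (∈-filter⁺ (λ v → lookup f v ≟ᵐ nothing) (∈-allFin v) fv)
  ... | just e  = λ v∈ → contradiction (trans (sym fv) (proj₂ (∈-filter⁻ (λ v → lookup f v ≟ᵐ nothing) {xs = allFin n} (to v∈)))) λ ()

  pair : Fin n × Fin n → List (Fin n)
  pair (u , v) = u ∷ v ∷ []

  increasing : List (Fin n × Fin n)
  increasing = filter (λ (u , v) → u Fin.<? v) (cartesianProduct (allFin n) (allFin n))

  increasing⁻ : ∀ {u v} → (u , v) ∈ˡ increasing → u Fin.< v
  increasing⁻ p∈ = proj₂ (∈-filter⁻ (λ (u , v) → u Fin.<? v) {xs = cartesianProduct (allFin n) (allFin n)} p∈)

  private
    pair! : ∀ {u v} → u Fin.< v → Unique (pair (u , v))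
    pair! u<v = (Fin.<⇒≢ u<v ∷ []) ∷ [] ∷ []

    roots! : ∀ (f : ParentMap n m) → Unique (roots f)
    roots! f = Unique.filter⁺ (λ v → lookup f v ≟ᵐ nothing) (Unique.allFin⁺ n)

    rootSet-count : ∀ {f u v} → u Fin.< v → RootSet (pair (u , v)) f → rootCount f ≡ 2
    rootSet-count {f} u<v rs = trans (sym (length-roots f))
      (ℕ.≤-antisym (unique-⊆-length (roots! f) (rootSet⁺ {f = f} rs)) (unique-⊆-length (pair! u<v) (rootSet⁻ {f = f} rs)))

    orient : ∀ (f : ParentMap n m) → rootCount f ≡ 2 → ∃₂ λ u v → u Fin.< v × RootSet (pair (u , v)) f
    orient f two = go (roots f) (roots! f) (trans (length-roots f) two) id id
      where
      go : ∀ rs → Unique rs → length rs ≡ 2 → (∀ {v} → v ∈ˡ rs → v ∈ˡ roots f) → (∀ {v} → v ∈ˡ roots f → v ∈ˡ rs) →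
           ∃₂ λ u v → u Fin.< v × RootSet (pair (u , v)) f
      go (u ∷ v ∷ []) ((u≢v ∷ _) ∷ _) _ to from with Fin.<-cmp u v
      ... | tri< u<v _ _ = u , v , u<v , rootSet f to from
      ... | tri≈ _ u≡v _ = contradiction u≡v u≢v
      ... | tri> _ _ v<u = v , u , v<u , rootSet f (to ∘ exchange) (exchange ∘ from)
        where
        exchange : ∀ {a b z : Fin n} → z ∈ˡ (a ∷ b ∷ []) → z ∈ˡ (b ∷ a ∷ [])
        exchange (here eq)         = there (here eq)
        exchange (there (here eq)) = here eq

    same-pair : ∀ {u v u' v' : Fin n} → u Fin.< v → u' Fin.< v' → (∀ {z} → z ∈ˡ pair (u' , v') → z ∈ˡ pair (u , v)) → u ≡ u' × v ≡ v'
    same-pair u<v u'<v' sub with sub (here refl) | sub (there (here refl))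
    ... | here refl         | here refl         = contradiction refl (Fin.<⇒≢ u'<v')
    ... | here refl         | there (here refl) = refl , refl
    ... | there (here refl) | here refl         = contradiction u<v (Fin.<-asym u'<v')
    ... | there (here refl) | there (here refl) = contradiction refl (Fin.<⇒≢ u'<v')

  -- Two roots form exactly one increasing pair, and `increasing` is the list over which
  -- `kirchhoffIndex` sums.
  rootCount-pairs : ∀ (f : ParentMap n m) → ⟦ rootCount f ℕ.≟ 2 ⟧ ≈ ∑ increasing (λ p → ⟦ rootSet? (pair p) f ⟧)
  rootCount-pairs f = ≈-trans (cases (rootCount f ℕ.≟ 2)) (≈-sym (≈-trans
    (∑-filter (λ (u , v) → u Fin.<? v) (cartesianProduct (allFin n) (allFin n)) _)
    (∑-cartesianProduct (allFin n) (allFin n) _)))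
    where
    both? : ∀ u v → Dec (u Fin.< v × RootSet (pair (u , v)) f)
    both? u v = (u Fin.<? v) ×-dec rootSet? (pair (u , v)) f
    cases : (d : Dec (rootCount f ≡ 2)) →
      ⟦ d ⟧ ≈ ∑ (allFin n) (λ u → ∑ (allFin n) λ v → ⟦ u Fin.<? v ⟧ * ⟦ rootSet? (pair (u , v)) f ⟧)
    cases (no ≢2) = ≈-sym (≈-trans (∑-cong (allFin n) λ u → ≈-trans (∑-cong (allFin n) λ v →
      ≈-trans (≈-sym (⟦⟧-× (u Fin.<? v) (rootSet? (pair (u , v)) f)))
              (⟦⟧-no (both? u v) (λ (u<v , rs) → ≢2 (rootSet-count {f} u<v rs)))) (∑-zero (allFin n))) (∑-zero (allFin n)))
    cases (yes two) with orient f two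
    ... | u₀ , v₀ , u₀<v₀ , rs₀ = ≈-sym (begin
      ∑ (allFin n) (λ u → ∑ (allFin n) λ v → ⟦ u Fin.<? v ⟧ * ⟦ rootSet? (pair (u , v)) f ⟧)
        ≈⟨ ∑-cong (allFin n) (λ u → ≈-trans (∑-cong (allFin n) (λ v → single u v)) (∑-*ˡ _ (allFin n) _)) ⟩
      ∑ (allFin n) (λ u → ⟦ u₀ Fin.≟ u ⟧ * ∑ (allFin n) λ v → ⟦ v₀ Fin.≟ v ⟧ * 1#)
        ≈⟨ ∑-δ u₀ _ ⟩
      ∑ (allFin n) (λ v → ⟦ v₀ Fin.≟ v ⟧ * 1#)
        ≈⟨ ∑-δ v₀ _ ⟩
      1# ∎)
      where
      single : ∀ u v → ⟦ u Fin.<? v ⟧ * ⟦ rootSet? (pair (u , v)) f ⟧ ≈ ⟦ u₀ Fin.≟ u ⟧ * (⟦ v₀ Fin.≟ v ⟧ * 1#)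
      single u v = begin
        ⟦ u Fin.<? v ⟧ * ⟦ rootSet? (pair (u , v)) f ⟧
          ≈⟨ ⟦⟧-× (u Fin.<? v) (rootSet? (pair (u , v)) f) ⟨
        ⟦ both? u v ⟧
          ≈⟨ ⟦⟧-cong (both? u v) ((u₀ Fin.≟ u) ×-dec (v₀ Fin.≟ v))
               (λ (u<v , rs) → same-pair u₀<v₀ u<v (rootSet⁺ {f = f} rs₀ ∘ rootSet⁻ {f = f} rs))
               (λ { (refl , refl) → u₀<v₀ , rs₀ }) ⟩
        ⟦ (u₀ Fin.≟ u) ×-dec (v₀ Fin.≟ v) ⟧
          ≈⟨ ⟦⟧-× (u₀ Fin.≟ u) (v₀ Fin.≟ v) ⟩
        ⟦ u₀ Fin.≟ u ⟧ * ⟦ v₀ Fin.≟ v ⟧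
          ≈⟨ *-congˡ (*-identityʳ _) ⟨
        ⟦ u₀ Fin.≟ u ⟧ * (⟦ v₀ Fin.≟ v ⟧ * 1#) ∎

module _ {a ℓ₁ ℓ₂ ℓ₃ : Level} (F : OrderedField a ℓ₁ ℓ₂ ℓ₃) {m : ℕ} where
  open Sums F
  open WeightedSums F m

  -- The indicator of a condition tested at each vertex separately is a product over the vertices
  -- and can be absorbed by the weight.
  𝔼-restrict : ∀ {n} {P : Fin n → Maybe (Fin m) → Set} (P? : ∀ v b → Dec (P v b)) (ω : Weight n) (g : ParentMap n m → Carrier) →
    𝔼 ω (λ f → g f * ⟦ Fin.all? (λ v → P? v (lookup f v)) ⟧) ≈ 𝔼 (λ v b → ⟦ P? v b ⟧ * ω v b) g
  𝔼-restrict {zero}  P? ω g = ≈-trans (*-congˡ (⟦⟧-yes (Fin.all? (λ v → P? v (lookup [] v))) λ ())) (*-identityʳ _)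
  𝔼-restrict {suc n} {P} P? ω g = ∑-cong choices λ b → begin
    ω zero b * 𝔼 (ω ∘ suc) (λ f → g (b ∷ f) * ⟦ Fin.all? (λ v → P? v (lookup (b ∷ f) v)) ⟧)
      ≈⟨ *-congˡ (𝔼-cong (ω ∘ suc) (λ f → ≈-trans (*-congˡ (≈-trans
           (⟦⟧-cong (Fin.all? (λ v → P? v (lookup (b ∷ f) v))) (P? zero b ×-dec Fin.all? (λ v → P? (suc v) (lookup f v)))
             (λ ps → ps zero , ps ∘ suc) (λ { (p , ps) zero → p ; (p , ps) (suc v) → ps v }))
           (⟦⟧-× (P? zero b) (Fin.all? (λ v → P? (suc v) (lookup f v))))))
           (x∙yz≈y∙xz _ _ _))) ⟩
    ω zero b * 𝔼 (ω ∘ suc) (λ f → ⟦ P? zero b ⟧ * (g (b ∷ f) * ⟦ Fin.all? (λ v → P? (suc v) (lookup f v)) ⟧))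
      ≈⟨ *-congˡ (𝔼-*ˡ (ω ∘ suc) _ _) ⟩
    ω zero b * (⟦ P? zero b ⟧ * 𝔼 (ω ∘ suc) (λ f → g (b ∷ f) * ⟦ Fin.all? (λ v → P? (suc v) (lookup f v)) ⟧))
      ≈⟨ *-congˡ (*-congˡ (𝔼-restrict (P? ∘ suc) (ω ∘ suc) (λ f → g (b ∷ f)))) ⟩
    ω zero b * (⟦ P? zero b ⟧ * 𝔼 (λ v b → ⟦ P? (suc v) b ⟧ * ω (suc v) b) (λ f → g (b ∷ f)))
      ≈⟨ solve 3 (λ w p e → w :* (p :* e) := p :* w :* e) ≈-refl _ _ _ ⟩
    ⟦ P? zero b ⟧ * ω zero b * 𝔼 (λ v b → ⟦ P? (suc v) b ⟧ * ω (suc v) b) (λ f → g (b ∷ f)) ∎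

module KirchhoffSum {a ℓ₁ ℓ₂ ℓ₃ : Level} (F : OrderedField a ℓ₁ ℓ₂ ℓ₃) {n m : ℕ} (G : Graph n m)
                    (c : Fin m → OrderedField.Carrier F) (x : Fin n → OrderedField.Carrier F) where
  open Sums F
  open Products F
  open WeightedSums F m
  open Parents G
  open Network F G c
  open InclusionExclusion F G c x
  open RootPairs F {n} {m}

  -- The vertex weights of the Kirchhoff index enter here: `away nowhere?` gives every root `v` the
  -- weight `x v`, so fixing the root set splits off the product over `R`.
  weighted-forests : ∀ {R} → Unique R → 𝔼 (away nowhere?) (λ f → ⟦ forest? f ⟧ * ⟦ rootSet? R f ⟧) ≈ ∏ R x * forests R
  weighted-forests {R} R! = begin
    𝔼 (away nowhere?) (λ f → ⟦ forest? f ⟧ * ⟦ rootSet? R f ⟧)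
      ≈⟨ 𝔼-restrict F (rootIn? R) (away nowhere?) _ ⟩
    𝔼 (λ v b → ⟦ rootIn? R v b ⟧ * away nowhere? v b) (λ f → ⟦ forest? f ⟧)
      ≈⟨ 𝔼-congʷ _ scaled ⟩
    𝔼 (λ v b → x v ^⟦ v ∈ˡ? R ⟧ * rooted R v b) (λ f → ⟦ forest? f ⟧)
      ≈⟨ 𝔼-scale _ (rooted R) _ ⟩
    ∏ (allFin n) (λ v → x v ^⟦ v ∈ˡ? R ⟧) * forests R
      ≈⟨ *-congʳ (∏-unique R! x) ⟨
    ∏ R x * forests R ∎
    where
    scaled : ∀ v b → ⟦ rootIn? R v b ⟧ * away nowhere? v b ≈ x v ^⟦ v ∈ˡ? R ⟧ * rooted R v b
    scaled v nothing with v ∈ˡ? R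
    ... | yes _ = *-comm _ _
    ... | no _  = ≈-trans (zeroˡ _) (≈-sym (zeroʳ _))
    scaled v (just e) with v ∈ˡ? R
    ... | yes _ = ≈-trans (zeroˡ _) (≈-sym (≈-trans (*-congˡ (zeroˡ _)) (zeroʳ _)))
    ... | no _  = ≈-refl

  forests-two-roots : 𝔼 (away nowhere?) (λ f → ⟦ forest? f ⟧ * ⟦ rootCount f ℕ.≟ 2 ⟧) ≈
                      ∑ increasing (λ (u , v) → x u * x v * forests (u ∷ v ∷ []))
  forests-two-roots = begin
    𝔼 (away nowhere?) (λ f → ⟦ forest? f ⟧ * ⟦ rootCount f ℕ.≟ 2 ⟧)
      ≈⟨ 𝔼-cong (away nowhere?) (λ f → ≈-trans (*-congˡ (rootCount-pairs f)) (≈-sym (∑-*ˡ _ increasing _))) ⟩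
    𝔼 (away nowhere?) (λ f → ∑ increasing (λ p → ⟦ forest? f ⟧ * ⟦ rootSet? (pair p) f ⟧))
      ≈⟨ 𝔼-∑ (away nowhere?) increasing _ ⟩
    ∑ increasing (λ p → 𝔼 (away nowhere?) (λ f → ⟦ forest? f ⟧ * ⟦ rootSet? (pair p) f ⟧))
      ≈⟨ ∑-cong-∈ increasing (λ {(u , v)} p∈ → ≈-trans
           (weighted-forests ((Fin.<⇒≢ (increasing⁻ p∈) ∷ []) ∷ [] ∷ [])) (*-congʳ (*-congˡ (*-identityʳ _)))) ⟩
    ∑ increasing (λ (u , v) → x u * x v * forests (u ∷ v ∷ [])) ∎

  module _ (r : Fin n → Fin n → Carrier) (r-resistance : ∀ u v → IsEffectiveResistance G c u v (r u v)) where
    open Kirchhoff F G c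
    open TreeTheorem F G c

    τ-kirchhoff : treeWeight G c * kirchhoffIndex r x ≈ 𝔼 (away nowhere?) (λ f → ⟦ forest? f ⟧ * ⟦ rootCount f ℕ.≟ 2 ⟧)
    τ-kirchhoff = ≈-trans (≈-sym (∑-*ˡ _ increasing _)) (≈-trans
      (∑-cong-∈ increasing (λ {(u , v)} p∈ → ≈-trans (x∙yz≈y∙xz _ _ _)
        (*-congˡ (resistance-forests forests≈treeWeight (Fin.<⇒≢ (increasing⁻ p∈)) (r-resistance u v)))))
      (≈-sym forests-two-roots))

index-shift : ∀ n s → + n -ℤ + 2 -ℤ + s ≡ n ⊖ (s ℕ.+ 2)
index-shift n s = trans (ℤ.+-assoc (+ n) (ℤ.- (+ 2)) (ℤ.- (+ s)))
  (trans (cong (ℤ._+_ (+ n)) (sym (ℤ.neg-distrib-+ (+ 2) (+ s))))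
    (trans (ℤ.m-n≡m⊖n n (2 ℕ.+ s)) (cong (n ⊖_) (ℕ.+-comm 2 s))))

theorem7p2 : ∀ {a ℓ₁ ℓ₂ ℓ₃} (F : OrderedField a ℓ₁ ℓ₂ ℓ₃) →
  let open OrderedField F
      open Weighted F
      open CycleUnion
  in
  {n m : ℕ} (G : Graph n m) → Connected G →
  (c : Fin m → Carrier) → (∀ e → 0# < c e) →
  (x : Fin n → Carrier) (x>0 : ∀ v → 0# < x v) →
  (r : Fin n → Fin n → Carrier) → (∀ u v → IsEffectiveResistance G c u v (r u v)) →
  Σ[ τ#0 ∈ treeWeight G c # 0# ]
    kirchhoffIndex r x ≈
      inverse τ#0 *
        ( m[ subdivision G c x x>0 , + n -ℤ + 2 ] * ∏ (allFin n) x
        + ∑ (cycleUnions G) (λ C →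
            (- (1# + 1#)) ^ components G C
            * ∏ (edgeList G C) c
            * m[ subdivision G c x x>0 ∖ subdivisionVertices G C , + n -ℤ + 2 -ℤ + size G C ]
            * ∏ (outsideVertexList G C) x) )
theorem7p2 {a} {ℓ₁} {ℓ₂} {ℓ₃} F {n} {m} G conn c c>0 x x>0 r r-res = τ#0 , (begin
  K                                ≈⟨ *-identityˡ K ⟨
  1# * K                           ≈⟨ *-congʳ (≈-trans (*-comm _ _) (inverse-* τ#0)) ⟨
  inverse τ#0 * τ * K              ≈⟨ *-assoc _ _ _ ⟩
  -- The 2 counts the roots `u` and `v`. In a map with two roots n - 2 edges are owned, the size of
  -- the matchings in the first term.
  inverse τ#0 * (τ * K)            ≈⟨ *-congˡ (≈-trans (τ-kirchhoff r r-res) (inclusion-exclusion 2)) ⟩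
  inverse τ#0 * (matched nowhere? 2 + ∑ (cycleUnions G) (λ C →
      (- (1# + 1#)) ^ components C * ∏ (edgeList C) c * matched (covers? (⋃ C)) (size C ℕ.+ 2)))
    ≈⟨ *-congˡ (+-cong
         (≈-trans (matched-subdivision 2) (*-congʳ (reflexive (cong m[ subdivision G c x x>0 ,_] (sym (ℤ.m-n≡m⊖n n 2))))))
         (∑-cong (cycleUnions G) λ C → ≈-trans (*-congˡ (≈-trans (matched-deletion C (size C ℕ.+ 2))
           (*-congʳ (reflexive (cong m[ subdivision G c x x>0 ∖ subdivisionVertices C ,_] (sym (index-shift n (size C))))))))
           (≈-sym (*-assoc _ _ _)))) ⟩
  _ ∎)
  where
  open Sums F
  open Graph G
  open CycleUnion G
  open TreeTheorem F G c
  open KirchhoffSum F G c x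
  open InclusionExclusion F G c x
  open SubdivisionMatchings F G c x x>0
  K = kirchhoffIndex r x
  τ = treeWeight G c
  τ#0 : τ # 0#
  τ#0 = pos⇒#0 (treeWeight-pos conn c>0)
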